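{- Let $a,b,C>0$ be constants. Then there is a constant $C'>0$, depending only on $a,b,C$, such that the following holds. Let $G$ be a finite simple graph with $n\ge 3$ vertices such that $P_k(G)\le C\,n^a b^k$ for every integer $k$ with $1\le k\le n$. Then, in the random order model, the expected number of colors used by FirstFit on $G$ is at most $C'\,\dfrac{\log n}{\log\log n}$.
   Context: Graphs are finite, simple and undirected; $\log$ is the natural logarithm. FirstFit: given a graph $G=(V,E)$ with $n$ vertices and a presentation order (bijection) $\sigma:[n]\to V$, the vertices are processed in the order $\sigma(1),\sigma(2),\ldots,\sigma(n)$, and each vertex irrevocably receives the smallest positive integer (color) that is not the color of any of its neighbors that were processed earlier. The number of colors used is the number of distinct colors assigned. Random order model: the graph $G$ is fixed and $\sigma$ is chosen uniformly at random among all $n!$ bijections $[n]\to V$; the expectation is over $\sigma$. $k$-paths: for $k\in\mathbb{N}$, a $k$-path in $G$ consists of $k$ (pairwise distinct) vertices $v_1,\ldots,v_k\in V$ together with edges $e_{i,i+1}\in E$ connecting $v_i$ and $v_{i+1}$ for every $i=1,\ldots,k-1$. Two $k$-paths are distinct if they differ in at least one edge. $P_k(G)$ denotes the number of distinct $k$-paths in $G$. -}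

module Defs where

open import Data.Fin.Base using (Fin)
import Data.Fin.Properties as Fin
open import Data.Integer.Base as ℤ using (+_)
import Data.Integer.Properties as ℤ
open import Data.List.Base using (List; []; _∷_; allFin; cartesianProductWith; deduplicate; drop; filter; length; map; zip)
import Data.List.Membership.DecPropositional as DecMembership
open import Data.List.Relation.Unary.All using (All; all?)
open import Data.List.Relation.Unary.Linked using (Linked; linked?)
import Data.List.Relation.Unary.Unique.DecPropositional as DecUnique
open import Data.Nat.Base as ℕ using (ℕ; zero; suc; _!)
open import Data.Nat.ListAction using (sum)
import Data.Nat.Properties as ℕ
open import Data.Product.Base using (∃-syntax; _×_; _,_; proj₁; proj₂)
open import Data.Product.Properties using (≡-dec)
open import Data.Rational.Base as ℚ
  using (ℚ; 0ℚ; 1ℚ; ½; _+_; _-_; _*_; -_; ∣_∣; _≤_; _<_; _/_; *≤*; *<*)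
open import Data.Rational.Literals using (fromℤ)
open import Data.Rational.Properties as ℚ using (≤-refl; ≤-trans; ≤-reflexive; <⇒≤; module ≤-Reasoning)
open import Data.Rational.Solver using (module +-*-Solver)
import Data.Rational.Unnormalised.Base as ℚᵘ
import Data.Rational.Unnormalised.Properties as ℚᵘ
open import Data.Sum.Base using (_⊎_; inj₁; inj₂)
open import Function.Base using (_∘_; _$_)
open import Level using (0ℓ)
open import Relation.Binary.Core using (Rel)
open import Relation.Binary.Definitions using (Decidable; Irreflexive; Symmetric)
open import Relation.Binary.PropositionalEquality
open import Relation.Nullary.Decidable using (Dec; yes; no; _×-dec_; _⊎-dec_)

open import Algebra.Definitions.RawSemiring ℚ.+-*-rawSemiring using (_^_)
open +-*-Solver using (solve; con; _:+_; _:*_; _:-_; :-_; _:=_)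

------------------------------------------------------------------------
0≤1 : 0ℚ ≤ 1ℚ
0≤1 = ℚ.nonNegative⁻¹ 1ℚ

0<1 : 0ℚ < 1ℚ
0<1 = ℚ.positive⁻¹ 1ℚ

*-mono-≤ : ∀ {p q r s} → 0ℚ ≤ p → p ≤ q → 0ℚ ≤ r → r ≤ s → p * r ≤ q * s
*-mono-≤ {p} {q} {r} {s} 0≤p p≤q 0≤r r≤s = ≤-trans
  (ℚ.*-monoˡ-≤-nonNeg p {{ℚ.nonNegative 0≤p}} r≤s)
  (ℚ.*-monoʳ-≤-nonNeg s {{ℚ.nonNegative (≤-trans 0≤r r≤s)}} p≤q)

*-monoˡ : ∀ {p r s} → 0ℚ ≤ p → r ≤ s → p * r ≤ p * s
*-monoˡ {p} 0≤p = ℚ.*-monoˡ-≤-nonNeg p {{ℚ.nonNegative 0≤p}}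

0≤*  : ∀ {p q} → 0ℚ ≤ p → 0ℚ ≤ q → 0ℚ ≤ p * q
0≤* {p} {q} 0≤p 0≤q = subst (_≤ p * q) (ℚ.*-zeroʳ p) (*-monoˡ 0≤p 0≤q)

0<*  : ∀ {p q} → 0ℚ < p → 0ℚ < q → 0ℚ < p * q
0<* {p} {q} 0<p 0<q = ℚ.positive⁻¹ (p * q)
  {{ℚ.pos*pos⇒pos p {{ℚ.positive 0<p}} q {{ℚ.positive 0<q}}}}

0≤+ : ∀ {p q} → 0ℚ ≤ p → 0ℚ ≤ q → 0ℚ ≤ p + q
0≤+ = ℚ.+-mono-≤

p≤q⇒0≤q-p : ∀ {p q} → p ≤ q → 0ℚ ≤ q - p
p≤q⇒0≤q-p {p} {q} p≤q = subst (_≤ q - p) (ℚ.+-inverseʳ p) (ℚ.+-monoˡ-≤ (- p) p≤q)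

0≤q-p⇒p≤q : ∀ {p q} → 0ℚ ≤ q - p → p ≤ q
0≤q-p⇒p≤q {p} {q} 0≤ = subst₂ _≤_ (ℚ.+-identityˡ p)
  (solve 2 (λ q p → (q :- p) :+ p := q) refl q p) (ℚ.+-monoˡ-≤ p 0≤)

p≤∣p∣ : ∀ p → p ≤ ∣ p ∣
p≤∣p∣ p with ℚ.≤-total 0ℚ p
... | inj₁ 0≤p = ≤-reflexive (sym (ℚ.0≤p⇒∣p∣≡p 0≤p))
... | inj₂ p≤0 = ≤-trans p≤0 (ℚ.0≤∣p∣ p)

fromℕ : ℕ → ℚ
fromℕ n = fromℤ (+ n)

fromℤ-mono : ∀ {i j} → i ℤ.≤ j → fromℤ i ≤ fromℤ j
fromℤ-mono {i} {j} i≤j = *≤* (subst₂ ℤ._≤_ (sym (ℤ.*-identityʳ i)) (sym (ℤ.*-identityʳ j)) i≤j)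

fromℕ-mono : ∀ {m n} → m ℕ.≤ n → fromℕ m ≤ fromℕ n
fromℕ-mono = fromℤ-mono ∘ ℤ.+≤+

0≤fromℕ : ∀ n → 0ℚ ≤ fromℕ n
0≤fromℕ n = fromℕ-mono {0} {n} ℕ.z≤n

fromℕ-suc-pos : ∀ n → 0ℚ < fromℕ (suc n)
fromℕ-suc-pos n = ℚ.positive⁻¹ (fromℕ (suc n))

fromℕ-+ : ∀ m n → fromℕ (m ℕ.+ n) ≡ fromℕ m + fromℕ n
fromℕ-+ m n = ℚ.toℚᵘ-injective (ℚᵘ.≃-trans
  (ℚᵘ.*≡* (cong (ℤ._* + 1) (cong₂ ℤ._+_ (sym (ℤ.*-identityʳ (+ m))) (sym (ℤ.*-identityʳ (+ n))))))
  (ℚᵘ.≃-sym (ℚ.toℚᵘ-homo-+ (fromℕ m) (fromℕ n))))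

fromℕ-* : ∀ m n → fromℕ (m ℕ.* n) ≡ fromℕ m * fromℕ n
fromℕ-* m n = ℚ.toℚᵘ-injective (ℚᵘ.≃-trans
  (ℚᵘ.*≡* (cong (ℤ._* + 1) (ℤ.pos-* m n)))
  (ℚᵘ.≃-sym (ℚ.toℚᵘ-homo-* (fromℕ m) (fromℕ n))))

archimedean : ∀ q → ∃[ n ] q ≤ fromℕ n
archimedean q@(ℚ.mkℚ (+ n) d _) = n , *≤* (subst₂ ℤ._≤_ (sym (ℤ.*-identityʳ (+ n))) (ℤ.pos-* n (suc d))
  (ℤ.+≤+ (ℕ.m≤m*n n (suc d))))
archimedean q@(ℚ.mkℚ (ℤ.-[1+ n ]) d _) = 0 , *≤* ℤ.-≤+

-- total inverse, with inv 0 = 0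
inv : ℚ → ℚ
inv   (ℚ.mkℚ (+ 0)       _ _) = 0ℚ
inv p@(ℚ.mkℚ ℤ.+[1+ _ ]  _ _) = ℚ.1/ p
inv p@(ℚ.mkℚ ℤ.-[1+ _ ]  _ _) = ℚ.1/ p

inv≡1/ : ∀ q .{{_ : ℚ.NonZero q}} → inv q ≡ ℚ.1/ q
inv≡1/ (ℚ.mkℚ ℤ.+[1+ _ ]  _ _) = refl
inv≡1/ (ℚ.mkℚ ℤ.-[1+ _ ]  _ _) = refl

inv-inverse : ∀ {q} → 0ℚ < q → q * inv q ≡ 1ℚ
inv-inverse {q} 0<q = trans (cong (q *_) (inv≡1/ q)) (ℚ.*-inverseʳ q)
  where instance _ = ℚ.>-nonZero 0<q

0<inv : ∀ {q} → 0ℚ < q → 0ℚ < inv q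
0<inv {q} 0<q = subst (0ℚ <_) (sym (inv≡1/ q)) (ℚ.positive⁻¹ _ {{ℚ.1/pos⇒pos q}})
  where instance
    0<q′ = ℚ.positive 0<q
    q≢0  = ℚ.pos⇒nonZero q

*-cancelˡ : ∀ {r p q} → 0ℚ < r → r * p ≤ r * q → p ≤ q
*-cancelˡ {r} 0<r = ℚ.*-cancelˡ-≤-pos r {{ℚ.positive 0<r}}

inv-antitone : ∀ {p q} → 0ℚ < p → p ≤ q → inv q ≤ inv p
inv-antitone {p} {q} 0<p p≤q = begin
  inv q                   ≡⟨ ℚ.*-identityʳ (inv q) ⟨
  inv q * 1ℚ              ≡⟨ cong (inv q *_) (inv-inverse 0<p) ⟨
  inv q * (p * inv p)     ≤⟨ *-monoˡ (<⇒≤ (0<inv 0<q)) (*-mono-≤ (<⇒≤ 0<p) p≤q (<⇒≤ (0<inv 0<p)) ≤-refl) ⟩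
  inv q * (q * inv p)     ≡⟨ solve 3 (λ i q j → i :* (q :* j) := (q :* i) :* j) refl (inv q) q (inv p) ⟩
  (q * inv q) * inv p     ≡⟨ cong (_* inv p) (inv-inverse 0<q) ⟩
  1ℚ * inv p              ≡⟨ ℚ.*-identityˡ (inv p) ⟩
  inv p                   ∎
  where
  open ≤-Reasoning
  0<q = ℚ.<-≤-trans 0<p p≤q


∣p-q∣≡∣q-p∣ : ∀ p q → ∣ p - q ∣ ≡ ∣ q - p ∣
∣p-q∣≡∣q-p∣ p q = trans (cong ∣_∣ (solve 2 (λ p q → p :- q := :- (q :- p)) refl p q)) (ℚ.∣-p∣≡∣p∣ (q - p))

------------------------------------------------------------------------
Eventually : (ℕ → Set) → Set
Eventually P = ∃[ N ] (∀ n → N ℕ.≤ n → P n)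

Eventually₂ : (ℕ → ℕ → Set) → Set
Eventually₂ P = ∃[ N ] (∀ m n → N ℕ.≤ m → N ℕ.≤ n → P m n)

always : ∀ {P} → (∀ n → P n) → Eventually P
always p = 0 , λ n _ → p n

infixr 4 _∩_ _∩₂_

_∩_ : ∀ {P Q} → Eventually P → Eventually Q → Eventually (λ n → P n × Q n)
(M , p) ∩ (N , q) = M ℕ.⊔ N , λ n ≤n → p n (ℕ.m⊔n≤o⇒m≤o M N ≤n) , q n (ℕ.m⊔n≤o⇒n≤o M N ≤n)

_∩₂_ : ∀ {P Q} → Eventually₂ P → Eventually₂ Q → Eventually₂ (λ m n → P m n × Q m n)
(M , p) ∩₂ (N , q) = M ℕ.⊔ N , λ m n ≤m ≤n →
  p m n (ℕ.m⊔n≤o⇒m≤o M N ≤m) (ℕ.m⊔n≤o⇒m≤o M N ≤n) ,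
  q m n (ℕ.m⊔n≤o⇒n≤o M N ≤m) (ℕ.m⊔n≤o⇒n≤o M N ≤n)

diagonal : ∀ {P} → Eventually P → Eventually₂ (λ m n → P m × P n)
diagonal (N , p) = N , λ m n ≤m ≤n → p m ≤m , p n ≤n

map-ev : ∀ {P Q} → (∀ n → P n → Q n) → Eventually P → Eventually Q
map-ev f (N , p) = N , λ n ≤n → f n (p n ≤n)

map-ev₂ : ∀ {P Q} → (∀ m n → P m n → Q m n) → Eventually₂ P → Eventually₂ Q
map-ev₂ f (N , p) = N , λ m n ≤m ≤n → f m n (p m n ≤m ≤n)

------------------------------------------------------------------------
-- Real numbers as Cauchy sequences of rationals, not quotiented: equality
-- of reals is x ≤ᴿ y together with y ≤ᴿ x

Cauchy : (ℕ → ℚ) → Set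
Cauchy s = ∀ ε → 0ℚ < ε → Eventually₂ λ m n → ∣ s m - s n ∣ ≤ ε

record ℝ : Set where
  constructor mkℝ
  field
    seq    : ℕ → ℚ
    cauchy : Cauchy seq

open ℝ public

infix 4 0<_ _≤ᴿ_

0<_ : ℝ → Set
0< x = ∃[ δ ] 0ℚ < δ × Eventually λ n → δ ≤ seq x n

_≤ᴿ_ : ℝ → ℝ → Set
x ≤ᴿ y = ∀ ε → 0ℚ < ε → Eventually λ n → seq x n ≤ seq y n + ε

cauchy-by : ∀ s K → 0ℚ < K →
            (∀ ε → 0ℚ < ε → Eventually₂ λ m n → ∣ s m - s n ∣ ≤ K * ε) → Cauchy s
cauchy-by s K 0<K h ε 0<ε =
  map-ev₂ (λ m n p → ≤-trans p (≤-reflexive eq)) (h (ε * inv K) (0<* 0<ε (0<inv 0<K)))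
  where
  eq : K * (ε * inv K) ≡ ε
  eq = trans (solve 3 (λ K e i → K :* (e :* i) := (K :* i) :* e) refl K ε (inv K))
             (trans (cong (_* ε) (inv-inverse 0<K)) (ℚ.*-identityˡ ε))

abstract
  bounded : ∀ x → ∃[ b ] Eventually λ n → ∣ seq x n ∣ ≤ fromℕ b
  bounded x with cauchy x 1ℚ 0<1
  ... | N , p with archimedean (1ℚ + ∣ seq x N ∣)
  ...   | b , q = b , N , λ n N≤n → begin
    ∣ seq x n ∣                          ≡⟨ cong ∣_∣ (solve 2 (λ a b → a := (a :- b) :+ b) refl (seq x n) (seq x N)) ⟩
    ∣ (seq x n - seq x N) + seq x N ∣    ≤⟨ ℚ.∣p+q∣≤∣p∣+∣q∣ (seq x n - seq x N) (seq x N) ⟩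
    ∣ seq x n - seq x N ∣ + ∣ seq x N ∣  ≤⟨ ℚ.+-monoˡ-≤ ∣ seq x N ∣ (p n N N≤n ℕ.≤-refl) ⟩
    1ℚ + ∣ seq x N ∣                     ≤⟨ q ⟩
    fromℕ b                              ∎
    where open ≤-Reasoning

fromℚ : ℚ → ℝ
fromℚ q = mkℝ (λ _ → q) λ ε 0<ε → 0 , λ _ _ _ _ →
  subst (λ z → ∣ z ∣ ≤ ε) (sym (ℚ.+-inverseʳ q)) (<⇒≤ 0<ε)

infixl 6 _+ᴿ_ _-ᴿ_
infixl 7 _*ᴿ_
infix  8 -ᴿ_

+-close : ∀ a b c d {ε} → ∣ a - c ∣ ≤ ε → ∣ b - d ∣ ≤ ε → ∣ (a + b) - (c + d) ∣ ≤ (1ℚ + 1ℚ) * ε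
+-close a b c d {ε} p q = begin
  ∣ (a + b) - (c + d) ∣    ≡⟨ cong ∣_∣ (solve 4 (λ a b c d → (a :+ b) :- (c :+ d) := (a :- c) :+ (b :- d)) refl a b c d) ⟩
  ∣ (a - c) + (b - d) ∣    ≤⟨ ℚ.∣p+q∣≤∣p∣+∣q∣ (a - c) (b - d) ⟩
  ∣ a - c ∣ + ∣ b - d ∣    ≤⟨ ℚ.+-mono-≤ p q ⟩
  ε + ε                    ≡⟨ solve 1 (λ e → e :+ e := (con 1ℚ :+ con 1ℚ) :* e) refl ε ⟩
  (1ℚ + 1ℚ) * ε            ∎
  where open ≤-Reasoning

abstract
  +-cauchy : ∀ x y → Cauchy (λ n → seq x n + seq y n)
  +-cauchy x y = cauchy-by (λ n → seq x n + seq y n) (1ℚ + 1ℚ) (ℚ.positive⁻¹ (1ℚ + 1ℚ)) λ ε 0<ε →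
    map-ev₂ (λ m n (p , q) → +-close (seq x m) (seq y m) (seq x n) (seq y n) p q)
            (cauchy x ε 0<ε ∩₂ cauchy y ε 0<ε)

  neg-cauchy : ∀ x → Cauchy (λ n → - seq x n)
  neg-cauchy x ε 0<ε = map-ev₂ (λ m n p → subst (_≤ ε) (eq (seq x m) (seq x n)) p) (cauchy x ε 0<ε)
    where
    eq : ∀ a b → ∣ a - b ∣ ≡ ∣ - a - - b ∣
    eq a b = trans (∣p-q∣≡∣q-p∣ a b) (cong ∣_∣ (solve 2 (λ a b → b :- a := (:- a) :- (:- b)) refl a b))

_+ᴿ_ : ℝ → ℝ → ℝ
x +ᴿ y = mkℝ (λ n → seq x n + seq y n) (+-cauchy x y)

-ᴿ_ : ℝ → ℝ
-ᴿ x = mkℝ (λ n → - seq x n) (neg-cauchy x)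

_-ᴿ_ : ℝ → ℝ → ℝ
x -ᴿ y = x +ᴿ -ᴿ y

*-close : ∀ a b c d {A B ε} → 0ℚ ≤ ε → ∣ a ∣ ≤ A → ∣ d ∣ ≤ B → ∣ a - c ∣ ≤ ε → ∣ b - d ∣ ≤ ε →
          ∣ a * b - c * d ∣ ≤ (1ℚ + (A + B)) * ε
*-close a b c d {A} {B} {ε} 0≤ε a≤A d≤B p q = begin
  ∣ a * b - c * d ∣                    ≡⟨ cong ∣_∣ (solve 4 (λ a b c d → a :* b :- c :* d := a :* (b :- d) :+ (a :- c) :* d) refl a b c d) ⟩
  ∣ a * (b - d) + (a - c) * d ∣        ≤⟨ ℚ.∣p+q∣≤∣p∣+∣q∣ (a * (b - d)) ((a - c) * d) ⟩
  ∣ a * (b - d) ∣ + ∣ (a - c) * d ∣    ≡⟨ cong₂ _+_ (ℚ.∣p*q∣≡∣p∣*∣q∣ a (b - d)) (ℚ.∣p*q∣≡∣p∣*∣q∣ (a - c) d) ⟩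
  ∣ a ∣ * ∣ b - d ∣ + ∣ a - c ∣ * ∣ d ∣  ≤⟨ ℚ.+-mono-≤ (*-mono-≤ (ℚ.0≤∣p∣ a) a≤A (ℚ.0≤∣p∣ (b - d)) q)
                                                      (*-mono-≤ (ℚ.0≤∣p∣ (a - c)) p (ℚ.0≤∣p∣ d) d≤B) ⟩
  A * ε + ε * B                        ≡⟨ solve 3 (λ a e b → a :* e :+ e :* b := (con 0ℚ :+ (a :+ b)) :* e) refl A ε B ⟩
  (0ℚ + (A + B)) * ε                   ≤⟨ ℚ.*-monoʳ-≤-nonNeg ε {{ℚ.nonNegative 0≤ε}} (ℚ.+-monoˡ-≤ (A + B) 0≤1) ⟩
  (1ℚ + (A + B)) * ε                   ∎
  where open ≤-Reasoning

abstract
  *-cauchy : ∀ x y → Cauchy (λ n → seq x n * seq y n)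
  *-cauchy x y =
    cauchy-by (λ n → seq x n * seq y n) (1ℚ + (A + B)) (ℚ.+-mono-<-≤ 0<1 (0≤+ (0≤fromℕ a) (0≤fromℕ b))) λ ε 0<ε →
    map-ev₂ (λ m n ((p , q) , (u , _) , (_ , v)) → *-close (seq x m) (seq y m) (seq x n) (seq y n) (<⇒≤ 0<ε) u v p q)
            ((cauchy x ε 0<ε ∩₂ cauchy y ε 0<ε) ∩₂ diagonal (proj₂ (bounded x)) ∩₂ diagonal (proj₂ (bounded y)))
    where
    a b : ℕ
    a = proj₁ (bounded x)
    b = proj₁ (bounded y)
    A B : ℚ
    A = fromℕ a
    B = fromℕ b

_*ᴿ_ : ℝ → ℝ → ℝ
x *ᴿ y = mkℝ (λ n → seq x n * seq y n) (*-cauchy x y)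

inv-close : ∀ a b {δ ε} → 0ℚ < δ → δ ≤ a → δ ≤ b → ∣ a - b ∣ ≤ ε →
            ∣ inv a - inv b ∣ ≤ (inv δ * inv δ) * ε
inv-close a b {δ} {ε} 0<δ δ≤a δ≤b p = begin
  ∣ inv a - inv b ∣                          ≡⟨ cong₂ (λ u v → ∣ u - v ∣) (ℚ.*-identityʳ (inv a)) (ℚ.*-identityʳ (inv b)) ⟨
  ∣ inv a * 1ℚ - inv b * 1ℚ ∣                ≡⟨ cong₂ (λ u v → ∣ inv a * u - inv b * v ∣) (inv-inverse 0<b) (inv-inverse 0<a) ⟨
  ∣ inv a * (b * inv b) - inv b * (a * inv a) ∣  ≡⟨ cong ∣_∣ (solve 4 (λ a b i j → i :* (b :* j) :- j :* (a :* i) := (i :* j) :* (b :- a)) refl a b (inv a) (inv b)) ⟩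
  ∣ (inv a * inv b) * (b - a) ∣              ≡⟨ ℚ.∣p*q∣≡∣p∣*∣q∣ (inv a * inv b) (b - a) ⟩
  ∣ inv a * inv b ∣ * ∣ b - a ∣              ≡⟨ cong₂ _*_ (ℚ.0≤p⇒∣p∣≡p 0≤ij) (∣p-q∣≡∣q-p∣ b a) ⟩
  (inv a * inv b) * ∣ a - b ∣                ≤⟨ *-mono-≤ 0≤ij (*-mono-≤ 0≤i (inv-antitone 0<δ δ≤a) 0≤j (inv-antitone 0<δ δ≤b)) (ℚ.0≤∣p∣ (a - b)) p ⟩
  (inv δ * inv δ) * ε                        ∎
  where
  open ≤-Reasoning
  0<a = ℚ.<-≤-trans 0<δ δ≤a
  0<b = ℚ.<-≤-trans 0<δ δ≤b
  0≤i = <⇒≤ (0<inv 0<a)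
  0≤j = <⇒≤ (0<inv 0<b)
  0≤ij = 0≤* 0≤i 0≤j

abstract
  inv-cauchy : ∀ x → 0< x → Cauchy (λ n → inv (seq x n))
  inv-cauchy x (δ , 0<δ , δ≤x) =
    cauchy-by (λ n → inv (seq x n)) (inv δ * inv δ) (0<* (0<inv 0<δ) (0<inv 0<δ)) λ ε 0<ε →
    map-ev₂ (λ m n (p , a , b) → inv-close (seq x m) (seq x n) 0<δ a b p) (cauchy x ε 0<ε ∩₂ diagonal δ≤x)

invᴿ : (x : ℝ) → 0< x → ℝ
invᴿ x 0<x = mkℝ (λ n → inv (seq x n)) (inv-cauchy x 0<x)

abstract
  0<-* : ∀ {x y} → 0< x → 0< y → 0< x *ᴿ y
  0<-* (δ , 0<δ , p) (η , 0<η , q) = δ * η , 0<* 0<δ 0<η ,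
    map-ev (λ n (p , q) → *-mono-≤ (<⇒≤ 0<δ) p (<⇒≤ 0<η) q) (p ∩ q)

  0<-+ : ∀ {x y} → 0< x → 0< y → 0< x +ᴿ y
  0<-+ (δ , 0<δ , p) (η , 0<η , q) = δ + η , ℚ.+-mono-< 0<δ 0<η ,
    map-ev (λ n (p , q) → ℚ.+-mono-≤ p q) (p ∩ q)

0<-fromℚ : ∀ {q} → 0ℚ < q → 0< fromℚ q
0<-fromℚ {q} 0<q = q , 0<q , always (λ _ → ≤-refl)

abstract
  0<-inv : ∀ {x} (p : 0< x) → 0< invᴿ x p
  0<-inv {x} (δ , 0<δ , p) = inv (K + δ) , 0<inv (ℚ.+-mono-≤-< (0≤fromℕ (proj₁ (bounded x))) 0<δ) ,
    map-ev (λ n (δ≤x , x≤K) → inv-antitone {seq x n} {K + δ} (ℚ.<-≤-trans 0<δ δ≤x)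
      (≤-trans (p≤∣p∣ (seq x n)) (≤-trans x≤K K≤K+δ))) (p ∩ proj₂ (bounded x))
    where
    K : ℚ
    K = fromℕ (proj₁ (bounded x))
    K≤K+δ : K ≤ K + δ
    K≤K+δ = subst (_≤ K + δ) (ℚ.+-identityʳ K) (ℚ.+-monoʳ-≤ K (<⇒≤ 0<δ))

------------------------------------------------------------------------
-- Power series, evaluated along the diagonal: the n-th approximation is the
-- n-th partial sum at the n-th approximation of the argument

∑ : ℕ → (ℕ → ℚ) → ℚ
∑ zero    f = 0ℚ
∑ (suc n) f = ∑ n f + f n

partialSum : (ℕ → ℚ) → ℕ → ℚ → ℚ
partialSum c n x = ∑ n (λ i → c i * x ^ i)

0≤^ : ∀ {p} → 0ℚ ≤ p → ∀ n → 0ℚ ≤ p ^ n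
0≤^ 0≤p zero    = 0≤1
0≤^ 0≤p (suc n) = 0≤* 0≤p (0≤^ 0≤p n)

∣^∣≤ : ∀ x {B} → ∣ x ∣ ≤ B → ∀ n → ∣ x ^ n ∣ ≤ B ^ n
∣^∣≤ x x≤B zero    = ≤-refl
∣^∣≤ x {B} x≤B (suc n) = subst (_≤ B * B ^ n) (sym (ℚ.∣p*q∣≡∣p∣*∣q∣ x (x ^ n)))
  (*-mono-≤ (ℚ.0≤∣p∣ x) x≤B (ℚ.0≤∣p∣ (x ^ n)) (∣^∣≤ x x≤B n))

^-close : ∀ x y {B} → ∣ x ∣ ≤ B → ∣ y ∣ ≤ B → ∀ n →
          ∣ x ^ suc n - y ^ suc n ∣ ≤ (fromℕ (suc n) * B ^ n) * ∣ x - y ∣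
^-close x y {B} p q zero = ≤-reflexive (trans
  (cong₂ (λ u v → ∣ u - v ∣) (ℚ.*-identityʳ x) (ℚ.*-identityʳ y))
  (sym (ℚ.*-identityˡ ∣ x - y ∣)))
^-close x y {B} p q (suc n) = begin
  ∣ x * X - y * Y ∣                            ≡⟨ cong ∣_∣ (solve 4 (λ x y X Y → x :* X :- y :* Y := x :* (X :- Y) :+ (x :- y) :* Y) refl x y X Y) ⟩
  ∣ x * (X - Y) + (x - y) * Y ∣                ≤⟨ ℚ.∣p+q∣≤∣p∣+∣q∣ (x * (X - Y)) ((x - y) * Y) ⟩
  ∣ x * (X - Y) ∣ + ∣ (x - y) * Y ∣            ≡⟨ cong₂ _+_ (ℚ.∣p*q∣≡∣p∣*∣q∣ x (X - Y)) (ℚ.∣p*q∣≡∣p∣*∣q∣ (x - y) Y) ⟩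
  ∣ x ∣ * ∣ X - Y ∣ + D * ∣ Y ∣                ≤⟨ ℚ.+-mono-≤ (*-mono-≤ (ℚ.0≤∣p∣ x) p (ℚ.0≤∣p∣ (X - Y)) (^-close x y p q n))
                                                            (*-monoˡ (ℚ.0≤∣p∣ (x - y)) (∣^∣≤ y q (suc n))) ⟩
  B * ((k * B ^ n) * D) + D * (B * B ^ n)      ≡⟨ solve 4 (λ B k b D → B :* ((k :* b) :* D) :+ D :* (B :* b) := ((con 1ℚ :+ k) :* (B :* b)) :* D) refl B k (B ^ n) D ⟩
  ((1ℚ + k) * B ^ suc n) * D                   ≡⟨ cong (λ u → (u * B ^ suc n) * D) (fromℕ-+ 1 (suc n)) ⟨
  (fromℕ (suc (suc n)) * B ^ suc n) * D        ∎
  where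
  open ≤-Reasoning
  X = x ^ suc n
  Y = y ^ suc n
  D = ∣ x - y ∣
  k = fromℕ (suc n)

module Geometric (d : ℚ) (0<d : 0ℚ < d) (0≤r : 0ℚ ≤ 1ℚ - d) where
  r = 1ℚ - d

  geo : ℕ → ℚ
  geo n = ∑ n (r ^_)

  d*geo : ∀ n → d * geo n ≡ 1ℚ - r ^ n
  d*geo zero    = ℚ.*-zeroʳ d
  d*geo (suc n) = begin
    d * (geo n + r ^ n)          ≡⟨ ℚ.*-distribˡ-+ d (geo n) (r ^ n) ⟩
    d * geo n + d * r ^ n        ≡⟨ cong (_+ d * r ^ n) (d*geo n) ⟩
    (1ℚ - r ^ n) + d * r ^ n     ≡⟨ solve 2 (λ d s → (con 1ℚ :- s) :+ d :* s := con 1ℚ :- (con 1ℚ :- d) :* s) refl d (r ^ n) ⟩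
    1ℚ - r ^ suc n               ∎
    where open ≡-Reasoning

  geo-bound : ∀ n → geo n ≤ inv d
  geo-bound n = *-cancelˡ 0<d (begin
    d * geo n      ≡⟨ d*geo n ⟩
    1ℚ - r ^ n     ≤⟨ ℚ.+-monoʳ-≤ 1ℚ (ℚ.neg-antimono-≤ (0≤^ 0≤r n)) ⟩
    1ℚ             ≡⟨ inv-inverse 0<d ⟨
    d * inv d      ∎)
    where open ≤-Reasoning

  geo-tail : ∀ m k → geo (m ℕ.+ k) - geo m ≤ inv d * r ^ m
  geo-tail m k = *-cancelˡ 0<d (begin
    d * (geo (m ℕ.+ k) - geo m)          ≡⟨ solve 3 (λ d a b → d :* (a :- b) := d :* a :- d :* b) refl d (geo (m ℕ.+ k)) (geo m) ⟩
    d * geo (m ℕ.+ k) - d * geo m        ≡⟨ cong₂ _-_ (d*geo (m ℕ.+ k)) (d*geo m) ⟩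
    (1ℚ - r ^ (m ℕ.+ k)) - (1ℚ - r ^ m)  ≡⟨ solve 2 (λ a b → (con 1ℚ :- a) :- (con 1ℚ :- b) := b :- a) refl (r ^ (m ℕ.+ k)) (r ^ m) ⟩
    r ^ m - r ^ (m ℕ.+ k)                ≤⟨ ℚ.+-monoʳ-≤ (r ^ m) (ℚ.neg-antimono-≤ (0≤^ 0≤r (m ℕ.+ k))) ⟩
    r ^ m + 0ℚ                           ≡⟨ solve 1 (λ a → a :+ con 0ℚ := con 1ℚ :* a) refl (r ^ m) ⟩
    1ℚ * r ^ m                           ≡⟨ cong (_* r ^ m) (inv-inverse 0<d) ⟨
    (d * inv d) * r ^ m                  ≡⟨ ℚ.*-assoc d (inv d) (r ^ m) ⟩
    d * (inv d * r ^ m)                  ∎)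
    where open ≤-Reasoning

  bernoulli : ∀ n → r ^ n * (1ℚ + fromℕ n * d) ≤ 1ℚ
  bernoulli zero    = ≤-reflexive (solve 1 (λ d → con 1ℚ :* (con 1ℚ :+ con 0ℚ :* d) := con 1ℚ) refl d)
  bernoulli (suc n) = begin
    r ^ suc n * (1ℚ + fromℕ (suc n) * d)          ≡⟨ cong (λ u → r ^ suc n * (1ℚ + u * d)) (fromℕ-+ 1 n) ⟩
    r ^ suc n * (1ℚ + (1ℚ + fromℕ n) * d)         ≡⟨ solve 3 (λ d s k → ((con 1ℚ :- d) :* s) :* (con 1ℚ :+ (con 1ℚ :+ k) :* d)
                                                        := s :* (con 1ℚ :+ k :* d) :- s :* ((con 1ℚ :+ k) :* (d :* d))) refl d (r ^ n) (fromℕ n) ⟩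
    r ^ n * (1ℚ + fromℕ n * d) - r ^ n * ((1ℚ + fromℕ n) * (d * d))
                                                  ≤⟨ ℚ.+-monoʳ-≤ (r ^ n * (1ℚ + fromℕ n * d)) (ℚ.neg-antimono-≤ 0≤) ⟩
    r ^ n * (1ℚ + fromℕ n * d) + 0ℚ               ≡⟨ ℚ.+-identityʳ (r ^ n * (1ℚ + fromℕ n * d)) ⟩
    r ^ n * (1ℚ + fromℕ n * d)                    ≤⟨ bernoulli n ⟩
    1ℚ                                            ∎
    where
    open ≤-Reasoning
    0≤d = <⇒≤ 0<d
    0≤ : 0ℚ ≤ r ^ n * ((1ℚ + fromℕ n) * (d * d))
    0≤ = 0≤* (0≤^ 0≤r n) (0≤* (0≤+ 0≤1 (0≤fromℕ n)) (0≤* 0≤d 0≤d))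

  r^n→0 : ∀ ε → 0ℚ < ε → Eventually λ n → r ^ n ≤ ε
  r^n→0 ε 0<ε with archimedean (inv d * inv ε)
  ... | N , p = N , λ n N≤n → *-cancelˡ (0<w n) (begin
    (1ℚ + fromℕ n * d) * r ^ n     ≡⟨ ℚ.*-comm (1ℚ + fromℕ n * d) (r ^ n) ⟩
    r ^ n * (1ℚ + fromℕ n * d)     ≤⟨ bernoulli n ⟩
    1ℚ                             ≡⟨ cong₂ _*_ (inv-inverse 0<d) (inv-inverse 0<ε) ⟨
    (d * inv d) * (ε * inv ε)      ≡⟨ solve 4 (λ d i e j → (d :* i) :* (e :* j) := (i :* j) :* (d :* e)) refl d (inv d) ε (inv ε) ⟩
    (inv d * inv ε) * (d * ε)      ≤⟨ ℚ.*-monoʳ-≤-nonNeg (d * ε) {{ℚ.nonNegative (0≤* (<⇒≤ 0<d) (<⇒≤ 0<ε))}} (≤-trans p (fromℕ-mono N≤n)) ⟩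
    fromℕ n * (d * ε)              ≡⟨ solve 3 (λ n d e → n :* (d :* e) := (con 0ℚ :+ n :* d) :* e) refl (fromℕ n) d ε ⟩
    (0ℚ + fromℕ n * d) * ε         ≤⟨ ℚ.*-monoʳ-≤-nonNeg ε {{ℚ.nonNegative (<⇒≤ 0<ε)}} (ℚ.+-monoˡ-≤ (fromℕ n * d) 0≤1) ⟩
    (1ℚ + fromℕ n * d) * ε         ∎)
    where
    open ≤-Reasoning
    0<w : ∀ n → 0ℚ < 1ℚ + fromℕ n * d
    0<w n = ℚ.+-mono-<-≤ 0<1 (0≤* (0≤fromℕ n) (<⇒≤ 0<d))

-- dominated: the terms of the derivative are bounded geometrically for |x| ≤ B
record Summable (c : ℕ → ℚ) (x : ℝ) : Set where
  field
    B d M     : ℚ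
    0<M       : 0ℚ < M
    0<d       : 0ℚ < d
    0≤1-d     : 0ℚ ≤ 1ℚ - d
    x-bounded : Eventually λ n → ∣ seq x n ∣ ≤ B
    dominated : ∀ i → ∣ c (suc i) ∣ * (fromℕ (suc i) * B ^ i) ≤ M * (1ℚ - d) ^ i

  0≤B : 0ℚ ≤ B
  0≤B = ≤-trans (ℚ.0≤∣p∣ _) (proj₂ x-bounded _ ℕ.≤-refl)

  open Geometric d 0<d 0≤1-d

  term-close : ∀ i {x y} → ∣ x ∣ ≤ B → ∣ y ∣ ≤ B →
               ∣ c (suc i) * x ^ suc i - c (suc i) * y ^ suc i ∣ ≤ M * r ^ i * ∣ x - y ∣
  term-close i {x} {y} p q = begin
    ∣ k * X - k * Y ∣           ≡⟨ cong ∣_∣ (solve 3 (λ k a b → k :* a :- k :* b := k :* (a :- b)) refl k X Y) ⟩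
    ∣ k * (X - Y) ∣             ≡⟨ ℚ.∣p*q∣≡∣p∣*∣q∣ k (X - Y) ⟩
    ∣ k ∣ * ∣ X - Y ∣           ≤⟨ *-monoˡ (ℚ.0≤∣p∣ k) (^-close x y p q i) ⟩
    ∣ k ∣ * (w * ∣ x - y ∣)     ≡⟨ ℚ.*-assoc (∣ k ∣) w (∣ x - y ∣) ⟨
    (∣ k ∣ * w) * ∣ x - y ∣     ≤⟨ ℚ.*-monoʳ-≤-nonNeg (∣ x - y ∣) {{ℚ.∣-∣-nonNeg (x - y)}} (dominated i) ⟩
    M * r ^ i * ∣ x - y ∣       ∎
    where
    open ≤-Reasoning
    k = c (suc i)
    X = x ^ suc i
    Y = y ^ suc i
    w = fromℕ (suc i) * B ^ i

  term-bound : ∀ i {x} → ∣ x ∣ ≤ B → ∣ c (suc i) * x ^ suc i ∣ ≤ M * r ^ i * B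
  term-bound i {x} p = begin
    ∣ k * x ^ suc i ∣                     ≡⟨ cong ∣_∣ (solve 3 (λ k a z → k :* a := k :* a :- k :* (con 0ℚ :* z)) refl k (x ^ suc i) (0ℚ ^ i)) ⟩
    ∣ k * x ^ suc i - k * 0ℚ ^ suc i ∣    ≤⟨ term-close i {x} {0ℚ} p 0≤B ⟩
    M * r ^ i * ∣ x - 0ℚ ∣                ≡⟨ cong (λ u → M * r ^ i * ∣ u ∣) (ℚ.+-identityʳ x) ⟩
    M * r ^ i * ∣ x ∣                     ≤⟨ *-monoˡ (0≤* (<⇒≤ 0<M) (0≤^ 0≤1-d i)) p ⟩
    M * r ^ i * B                         ∎
    where
    open ≤-Reasoning
    k = c (suc i)

  sum-close : ∀ n {x y} → ∣ x ∣ ≤ B → ∣ y ∣ ≤ B →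
              ∣ partialSum c (suc n) x - partialSum c (suc n) y ∣ ≤ M * geo n * ∣ x - y ∣
  sum-close zero {x} {y} p q = ≤-reflexive (trans
    (cong ∣_∣ (ℚ.+-inverseʳ (0ℚ + c 0 * 1ℚ)))
    (solve 2 (λ M D → con 0ℚ := M :* con 0ℚ :* D) refl M ∣ x - y ∣))
  sum-close (suc n) {x} {y} p q = begin
    ∣ (X + u) - (Y + v) ∣                          ≡⟨ cong ∣_∣ (solve 4 (λ X u Y v → (X :+ u) :- (Y :+ v) := (X :- Y) :+ (u :- v)) refl X u Y v) ⟩
    ∣ (X - Y) + (u - v) ∣                          ≤⟨ ℚ.∣p+q∣≤∣p∣+∣q∣ (X - Y) (u - v) ⟩
    ∣ X - Y ∣ + ∣ u - v ∣                          ≤⟨ ℚ.+-mono-≤ (sum-close n p q) (term-close n p q) ⟩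
    M * geo n * ∣ x - y ∣ + M * r ^ n * ∣ x - y ∣  ≡⟨ solve 4 (λ M g s D → M :* g :* D :+ M :* s :* D := M :* (g :+ s) :* D) refl M (geo n) (r ^ n) ∣ x - y ∣ ⟩
    M * geo (suc n) * ∣ x - y ∣                    ∎
    where
    open ≤-Reasoning
    X = partialSum c (suc n) x
    Y = partialSum c (suc n) y
    u = c (suc n) * x ^ suc n
    v = c (suc n) * y ^ suc n

  sum-tail : ∀ m k {x} → ∣ x ∣ ≤ B →
             ∣ partialSum c (suc (m ℕ.+ k)) x - partialSum c (suc m) x ∣ ≤ M * B * (geo (m ℕ.+ k) - geo m)
  sum-tail m zero {x} p rewrite ℕ.+-identityʳ m = ≤-reflexive (trans
    (cong ∣_∣ (ℚ.+-inverseʳ (partialSum c (suc m) x)))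
    (solve 3 (λ M B g → con 0ℚ := M :* B :* (g :- g)) refl M B (geo m)))
  sum-tail m (suc k) {x} p rewrite ℕ.+-suc m k = begin
    ∣ (Z + u) - Y ∣                                             ≡⟨ cong ∣_∣ (solve 3 (λ Z u Y → (Z :+ u) :- Y := (Z :- Y) :+ u) refl Z u Y) ⟩
    ∣ (Z - Y) + u ∣                                             ≤⟨ ℚ.∣p+q∣≤∣p∣+∣q∣ (Z - Y) u ⟩
    ∣ Z - Y ∣ + ∣ u ∣                                           ≤⟨ ℚ.+-mono-≤ (sum-tail m k p) (term-bound (m ℕ.+ k) p) ⟩
    M * B * (geo (m ℕ.+ k) - geo m) + M * r ^ (m ℕ.+ k) * B     ≡⟨ solve 5 (λ M B a b s → M :* B :* (a :- b) :+ M :* s :* B := M :* B :* ((a :+ s) :- b)) refl M B (geo (m ℕ.+ k)) (geo m) (r ^ (m ℕ.+ k)) ⟩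
    M * B * (geo (suc (m ℕ.+ k)) - geo m)                       ∎
    where
    open ≤-Reasoning
    Z = partialSum c (suc (m ℕ.+ k)) x
    Y = partialSum c (suc m) x
    u = c (suc (m ℕ.+ k)) * x ^ suc (m ℕ.+ k)

  K : ℚ
  K = M * inv d * (1ℚ + B)

  0<K : 0ℚ < K
  0<K = 0<* (0<* 0<M (0<inv 0<d)) (ℚ.+-mono-<-≤ 0<1 0≤B)

  sums-close : ∀ m k {x y ε} → ∣ x ∣ ≤ B → ∣ y ∣ ≤ B → ∣ x - y ∣ ≤ ε → r ^ m ≤ ε →
               ∣ partialSum c (suc m) x - partialSum c (suc (m ℕ.+ k)) y ∣ ≤ K * ε
  sums-close m k {x} {y} {ε} p q x-y≤ε r^m≤ε = begin
    ∣ X - Z ∣                                   ≡⟨ cong ∣_∣ (solve 3 (λ X Y Z → X :- Z := (X :- Y) :- (Z :- Y)) refl X Y Z) ⟩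
    ∣ (X - Y) - (Z - Y) ∣                       ≤⟨ ℚ.∣p-q∣≤∣p∣+∣q∣ (X - Y) (Z - Y) ⟩
    ∣ X - Y ∣ + ∣ Z - Y ∣                       ≤⟨ ℚ.+-mono-≤ (sum-close m p q) (sum-tail m k q) ⟩
    M * geo m * ∣ x - y ∣ + M * B * (geo (m ℕ.+ k) - geo m)
                                                ≤⟨ ℚ.+-mono-≤ (*-mono-≤ (0≤* (<⇒≤ 0<M) (0≤geo m)) (*-monoˡ (<⇒≤ 0<M) (geo-bound m)) (ℚ.0≤∣p∣ (x - y)) x-y≤ε)
                                                             (*-monoˡ 0≤MB (≤-trans (geo-tail m k) (*-monoˡ (<⇒≤ (0<inv 0<d)) r^m≤ε))) ⟩
    M * inv d * ε + M * B * (inv d * ε)         ≡⟨ solve 4 (λ M B i e → M :* i :* e :+ M :* B :* (i :* e) := M :* i :* (con 1ℚ :+ B) :* e) refl M B (inv d) ε ⟩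
    K * ε                                       ∎
    where
    open ≤-Reasoning
    X = partialSum c (suc m) x
    Y = partialSum c (suc m) y
    Z = partialSum c (suc (m ℕ.+ k)) y
    0≤MB = 0≤* (<⇒≤ 0<M) 0≤B
    0≤geo : ∀ n → 0ℚ ≤ geo n
    0≤geo zero    = ≤-refl
    0≤geo (suc n) = 0≤+ (0≤geo n) (0≤^ 0≤1-d n)

  abstract
    sums-cauchy : Cauchy (λ n → partialSum c n (seq x n))
    sums-cauchy = cauchy-by (λ n → partialSum c n (seq x n)) K 0<K λ ε 0<ε → go ε (cauchy x ε 0<ε ∩₂ diagonal (x-bounded ∩ r^n→0 ε 0<ε))
      where
      P : ℕ → ℚ
      P n = partialSum c n (seq x n)
      ordered : ∀ {m n ε} → m ℕ.≤ n →
                ∣ seq x (suc m) - seq x (suc n) ∣ ≤ ε →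
                ∣ seq x (suc m) ∣ ≤ B → ∣ seq x (suc n) ∣ ≤ B → r ^ m ≤ ε →
                ∣ P (suc m) - P (suc n) ∣ ≤ K * ε
      ordered {m} m≤n e p q s with ℕ.m≤n⇒∃[o]m+o≡n m≤n
      ... | k , refl = sums-close m k p q e s
      either : ∀ {m n ε} → ∣ seq x (suc m) - seq x (suc n) ∣ ≤ ε →
               ∣ seq x (suc m) ∣ ≤ B → ∣ seq x (suc n) ∣ ≤ B → r ^ m ≤ ε → r ^ n ≤ ε →
               ∣ P (suc m) - P (suc n) ∣ ≤ K * ε
      either {m} {n} {ε} e p q s t with ℕ.≤-total m n
      ... | inj₁ m≤n = ordered m≤n e p q s
      ... | inj₂ n≤m = subst (_≤ K * ε) (∣p-q∣≡∣q-p∣ (P (suc n)) (P (suc m)))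
        (ordered n≤m (subst (_≤ ε) (∣p-q∣≡∣q-p∣ (seq x (suc m)) (seq x (suc n))) e) q p t)
      go : ∀ ε → Eventually₂ (λ m n → ∣ seq x m - seq x n ∣ ≤ ε × ((∣ seq x m ∣ ≤ B × r ^ m ≤ ε) × (∣ seq x n ∣ ≤ B × r ^ n ≤ ε))) →
           Eventually₂ (λ m n → ∣ P m - P n ∣ ≤ K * ε)
      go ε (N , h) = suc N , λ where
        (suc m) (suc n) (ℕ.s≤s N≤m) (ℕ.s≤s N≤n) →
          let e , (p , _) , (q , _) = h (suc m) (suc n) (ℕ.m≤n⇒m≤1+n N≤m) (ℕ.m≤n⇒m≤1+n N≤n)
              _ , (_ , s) , (_ , t) = h m n N≤m N≤n
          in either e p q s t

powerSeries : (c : ℕ → ℚ) (x : ℝ) → Summable c x → ℝ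
powerSeries c x p = mkℝ (λ n → partialSum c n (seq x n)) (Summable.sums-cauchy p)

------------------------------------------------------------------------
n^i≤n^n*i! : ∀ n i → n ℕ.^ i ℕ.≤ n ℕ.^ n ℕ.* i !
n^i≤n^n*i! n zero    = ℕ.≤-trans (1≤n^n n) (ℕ.≤-reflexive (sym (ℕ.*-identityʳ (n ℕ.^ n))))
  where
  1≤n^n : ∀ n → 1 ℕ.≤ n ℕ.^ n
  1≤n^n zero    = ℕ.≤-refl
  1≤n^n (suc n) = ℕ.m^n>0 (suc n) (suc n)
n^i≤n^n*i! n (suc i) with ℕ.≤-total n (suc i)
... | inj₁ n≤i = begin
  n ℕ.* n ℕ.^ i                      ≤⟨ ℕ.*-mono-≤ n≤i (n^i≤n^n*i! n i) ⟩
  suc i ℕ.* (n ℕ.^ n ℕ.* i !)        ≡⟨ x∙yz≈y∙xz (suc i) (n ℕ.^ n) (i !) ⟩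
  n ℕ.^ n ℕ.* (suc i ℕ.* i !)        ∎
  where
  open ℕ.≤-Reasoning
  open import Algebra.Properties.CommutativeSemigroup ℕ.*-commutativeSemigroup
... | inj₂ i≤n@(ℕ.s≤s _) = begin
  n ℕ.^ suc i                        ≤⟨ ℕ.^-monoʳ-≤ n i≤n ⟩
  n ℕ.^ n                            ≡⟨ ℕ.*-identityʳ (n ℕ.^ n) ⟨
  n ℕ.^ n ℕ.* 1                      ≤⟨ ℕ.*-monoʳ-≤ (n ℕ.^ n) (ℕ.1≤n! (suc i)) ⟩
  n ℕ.^ n ℕ.* (suc i) !              ∎
  where open ℕ.≤-Reasoning

fromℕ^≡ : ∀ b i → fromℕ b ^ i ≡ fromℕ ((b ℕ.+ b) ℕ.^ i) * ½ ^ i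
fromℕ^≡ b zero    = refl
fromℕ^≡ b (suc i) = begin
  fromℕ b * fromℕ b ^ i                            ≡⟨ cong (fromℕ b *_) (fromℕ^≡ b i) ⟩
  fromℕ b * (fromℕ c * ½ ^ i)                      ≡⟨ solve 3 (λ b c h → b :* (c :* h) := ((b :+ b) :* c) :* (con ½ :* h)) refl (fromℕ b) (fromℕ c) (½ ^ i) ⟩
  ((fromℕ b + fromℕ b) * fromℕ c) * ½ ^ suc i      ≡⟨ cong (λ u → (u * fromℕ c) * ½ ^ suc i) (fromℕ-+ b b) ⟨
  (fromℕ (b ℕ.+ b) * fromℕ c) * ½ ^ suc i          ≡⟨ cong (_* ½ ^ suc i) (fromℕ-* (b ℕ.+ b) c) ⟨
  fromℕ ((b ℕ.+ b) ℕ.^ suc i) * ½ ^ suc i          ∎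
  where
  open ≡-Reasoning
  c = (b ℕ.+ b) ℕ.^ i

0<fromℕ : ∀ n .{{_ : ℕ.NonZero n}} → 0ℚ < fromℕ n
0<fromℕ (suc n) = fromℕ-suc-pos n

1/! : ℕ → ℚ
1/! i = inv (fromℕ (i !))

0<i! : ∀ i → 0ℚ < fromℕ (i !)
0<i! i = 0<fromℕ (i !) {{i ℕ.!≢0}}

abstract
  exp-summable : ∀ x → Summable 1/! x
  exp-summable x = record
    { B         = fromℕ b
    ; d         = ½
    ; M         = fromℕ (N ℕ.^ N)
    ; 0<M       = 0<fromℕ (N ℕ.^ N) {{ℕ.m^n≢0 N N}}
    ; 0<d       = ℚ.positive⁻¹ ½
    ; 0≤1-d     = ℚ.nonNegative⁻¹ ½
    ; x-bounded = proj₂ (bounded x)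
    ; dominated = λ i → begin
        ∣ 1/! (suc i) ∣ * (fromℕ (suc i) * fromℕ b ^ i)
          ≡⟨ cong (_* (fromℕ (suc i) * fromℕ b ^ i)) (ℚ.0≤p⇒∣p∣≡p (<⇒≤ (0<inv (0<i! (suc i))))) ⟩
        1/! (suc i) * (fromℕ (suc i) * fromℕ b ^ i)
          ≤⟨ *-monoˡ (<⇒≤ (0<inv (0<i! (suc i)))) (*-monoˡ (0≤fromℕ (suc i)) (power≤ i)) ⟩
        1/! (suc i) * (fromℕ (suc i) * ((fromℕ (N ℕ.^ N) * fromℕ (i !)) * ½ ^ i))
          ≡⟨ solve 5 (λ u s m f h → u :* (s :* ((m :* f) :* h)) := (m :* h) :* ((s :* f) :* u)) refl
               (1/! (suc i)) (fromℕ (suc i)) (fromℕ (N ℕ.^ N)) (fromℕ (i !)) (½ ^ i) ⟩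
        (fromℕ (N ℕ.^ N) * ½ ^ i) * ((fromℕ (suc i) * fromℕ (i !)) * 1/! (suc i))
          ≡⟨ cong (λ u → (fromℕ (N ℕ.^ N) * ½ ^ i) * (u * 1/! (suc i))) (fromℕ-* (suc i) (i !)) ⟨
        (fromℕ (N ℕ.^ N) * ½ ^ i) * (fromℕ (suc i !) * 1/! (suc i))
          ≡⟨ cong ((fromℕ (N ℕ.^ N) * ½ ^ i) *_) (inv-inverse (0<i! (suc i))) ⟩
        (fromℕ (N ℕ.^ N) * ½ ^ i) * 1ℚ
          ≡⟨ ℚ.*-identityʳ (fromℕ (N ℕ.^ N) * ½ ^ i) ⟩
        fromℕ (N ℕ.^ N) * ½ ^ i ∎
    }
    where
    open ≤-Reasoning
    b N : ℕ
    b = proj₁ (bounded x)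
    N = suc (b ℕ.+ b)
    power≤ : ∀ i → fromℕ b ^ i ≤ (fromℕ (N ℕ.^ N) * fromℕ (i !)) * ½ ^ i
    power≤ i = begin
      fromℕ b ^ i                                ≡⟨ fromℕ^≡ b i ⟩
      fromℕ ((b ℕ.+ b) ℕ.^ i) * ½ ^ i            ≤⟨ ℚ.*-monoʳ-≤-nonNeg (½ ^ i) {{ℚ.nonNegative (0≤^ (ℚ.nonNegative⁻¹ ½) i)}}
                                                     (fromℕ-mono (ℕ.≤-trans (ℕ.^-monoˡ-≤ i (ℕ.n≤1+n (b ℕ.+ b))) (n^i≤n^n*i! N i))) ⟩
      fromℕ (N ℕ.^ N ℕ.* i !) * ½ ^ i            ≡⟨ cong (_* ½ ^ i) (fromℕ-* (N ℕ.^ N) (i !)) ⟩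
      (fromℕ (N ℕ.^ N) * fromℕ (i !)) * ½ ^ i    ∎

exp : ℝ → ℝ
exp x = powerSeries 1/! x (exp-summable x)

------------------------------------------------------------------------
-- log x = 2 artanh ((x - 1) / (x + 1)) for x > 0, where
-- artanh z = z ∑ z²ⁱ / (2i + 1) for |z| < 1

1/odd : ℕ → ℚ
1/odd i = inv (fromℕ (suc (i ℕ.+ i)))

0<1/odd : ∀ i → 0ℚ < 1/odd i
0<1/odd i = 0<inv (fromℕ-suc-pos (i ℕ.+ i))

1ᴿ 2ᴿ : ℝ
1ᴿ = fromℚ (fromℕ 1)
2ᴿ = fromℚ (fromℕ 2)

abstract
  artanh-summable : ∀ z → 0< 1ᴿ -ᴿ z *ᴿ z → Summable 1/odd (z *ᴿ z)
  artanh-summable z (δ , 0<δ , N , δ≤1-z²) = record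
    { B         = 1ℚ - δ
    ; d         = δ
    ; M         = 1ℚ
    ; 0<M       = 0<1
    ; 0<d       = 0<δ
    ; 0≤1-d     = 0≤1-δ
    ; x-bounded = N , λ n N≤n → subst (_≤ 1ℚ - δ) (sym (ℚ.0≤p⇒∣p∣≡p (0≤square (seq z n)))) (z²≤1-δ n N≤n)
    ; dominated = λ i → begin
        ∣ 1/odd (suc i) ∣ * (fromℕ (suc i) * (1ℚ - δ) ^ i)
          ≡⟨ cong (_* (fromℕ (suc i) * (1ℚ - δ) ^ i)) (ℚ.0≤p⇒∣p∣≡p (<⇒≤ (0<1/odd (suc i)))) ⟩
        1/odd (suc i) * (fromℕ (suc i) * (1ℚ - δ) ^ i)
          ≡⟨ ℚ.*-assoc (1/odd (suc i)) (fromℕ (suc i)) ((1ℚ - δ) ^ i) ⟨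
        (1/odd (suc i) * fromℕ (suc i)) * (1ℚ - δ) ^ i
          ≤⟨ ℚ.*-monoʳ-≤-nonNeg ((1ℚ - δ) ^ i) {{ℚ.nonNegative (0≤^ 0≤1-δ i)}} (coefficient≤ i) ⟩
        1ℚ * (1ℚ - δ) ^ i ∎
    }
    where
    open ≤-Reasoning
    0≤square : ∀ q → 0ℚ ≤ q * q
    0≤square q = subst (0ℚ ≤_) (sq q) (0≤* (ℚ.0≤∣p∣ q) (ℚ.0≤∣p∣ q))
      where
      sq : ∀ q → ∣ q ∣ * ∣ q ∣ ≡ q * q
      sq q with ℚ.∣p∣≡p∨∣p∣≡-p q
      ... | inj₁ e = cong₂ _*_ e e
      ... | inj₂ e = trans (cong₂ _*_ e e) (solve 1 (λ q → (:- q) :* (:- q) := q :* q) refl q)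
    z²≤1-δ : ∀ n → N ℕ.≤ n → seq z n * seq z n ≤ 1ℚ - δ
    z²≤1-δ n N≤n = 0≤q-p⇒p≤q (subst (0ℚ ≤_)
      (solve 2 (λ s d → (con 1ℚ :- s) :- d := (con 1ℚ :- d) :- s) refl (seq z n * seq z n) δ)
      (p≤q⇒0≤q-p (δ≤1-z² n N≤n)))
    0≤1-δ : 0ℚ ≤ 1ℚ - δ
    0≤1-δ = ≤-trans (0≤square (seq z N)) (z²≤1-δ N ℕ.≤-refl)
    coefficient≤ : ∀ i → 1/odd (suc i) * fromℕ (suc i) ≤ 1ℚ
    coefficient≤ i = begin
      1/odd (suc i) * fromℕ (suc i)                  ≤⟨ *-monoˡ (<⇒≤ (0<1/odd (suc i))) (fromℕ-mono (ℕ.m≤n⇒m≤1+n (ℕ.m≤m+n (suc i) (suc i)))) ⟩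
      1/odd (suc i) * fromℕ (suc (suc i ℕ.+ suc i))  ≡⟨ ℚ.*-comm (1/odd (suc i)) (fromℕ (suc (suc i ℕ.+ suc i))) ⟩
      fromℕ (suc (suc i ℕ.+ suc i)) * 1/odd (suc i)  ≡⟨ inv-inverse (fromℕ-suc-pos (suc i ℕ.+ suc i)) ⟩
      1ℚ                                             ∎

artanh : (z : ℝ) → 0< 1ᴿ -ᴿ z *ᴿ z → ℝ
artanh z p = z *ᴿ powerSeries 1/odd (z *ᴿ z) (artanh-summable z p)

abstract
  0<x+1 : ∀ {x} → 0< x → 0< x +ᴿ 1ᴿ
  0<x+1 {x} p = 0<-+ {x} {1ᴿ} p (0<-fromℚ 0<1)

cayley : (x : ℝ) → 0< x → ℝ
cayley x p = (x -ᴿ 1ᴿ) *ᴿ invᴿ (x +ᴿ 1ᴿ) (0<x+1 {x} p)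

abstract
  cayley-domain : ∀ x (p : 0< x) → 0< 1ᴿ -ᴿ cayley x p *ᴿ cayley x p
  cayley-domain x p@(δ , 0<δ , δ≤x) =
    4ℚ * δ * (i * i) , 0<* (0<* (fromℕ-suc-pos 3) 0<δ) (0<* 0<i 0<i) , map-ev bound (δ≤x ∩ proj₂ (bounded x))
    where
    4ℚ K i : ℚ
    4ℚ = fromℕ 4
    K = fromℕ (proj₁ (bounded x))
    0≤K : 0ℚ ≤ K
    0≤K = 0≤fromℕ (proj₁ (bounded x))
    i = inv (K + 1ℚ)
    0<i : 0ℚ < i
    0<i = 0<inv (ℚ.+-mono-≤-< 0≤K 0<1)
    bound : ∀ n → δ ≤ seq x n × ∣ seq x n ∣ ≤ K →
            4ℚ * δ * (i * i) ≤ seq (1ᴿ -ᴿ cayley x p *ᴿ cayley x p) n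
    bound n (δ≤xn , xn≤K) = begin
      4ℚ * δ * (i * i)                          ≤⟨ *-mono-≤ (0≤* (0≤fromℕ 4) (<⇒≤ 0<δ)) (*-monoˡ (0≤fromℕ 4) δ≤xn)
                                                           (0≤* (<⇒≤ 0<i) (<⇒≤ 0<i)) (*-mono-≤ (<⇒≤ 0<i) i≤j (<⇒≤ 0<i) i≤j) ⟩
      4ℚ * v * (j * j)                          ≡⟨ solve 2 (λ v j → con 4ℚ :* v :* (j :* j)
                                                     := ((v :+ con 1ℚ) :* j) :* ((v :+ con 1ℚ) :* j) :- ((v :- con 1ℚ) :* j) :* ((v :- con 1ℚ) :* j)) refl v j ⟩
      ((v + 1ℚ) * j) * ((v + 1ℚ) * j) - ((v - 1ℚ) * j) * ((v - 1ℚ) * j)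
                                                ≡⟨ cong (λ u → u * u - ((v - 1ℚ) * j) * ((v - 1ℚ) * j)) (inv-inverse 0<v+1) ⟩
      1ℚ - ((v - 1ℚ) * j) * ((v - 1ℚ) * j)      ∎
      where
      open ≤-Reasoning
      v j : ℚ
      v = seq x n
      j = inv (v + 1ℚ)
      0<v+1 : 0ℚ < v + 1ℚ
      0<v+1 = ℚ.+-mono-< (ℚ.<-≤-trans 0<δ δ≤xn) 0<1
      i≤j : i ≤ j
      i≤j = inv-antitone 0<v+1 (ℚ.+-monoˡ-≤ 1ℚ (≤-trans (p≤∣p∣ v) xn≤K))

log : (x : ℝ) → 0< x → ℝ
log x p = 2ᴿ *ᴿ artanh (cayley x p) (cayley-domain x p)

------------------------------------------------------------------------
_÷ᴿ_[_] : (x y : ℝ) → 0< y → ℝ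
x ÷ᴿ y [ 0<y ] = x *ᴿ invᴿ y 0<y

infixr 8 _^ᴿ_
_^ᴿ_ : ℝ → ℕ → ℝ
x ^ᴿ zero  = 1ᴿ
x ^ᴿ suc n = x *ᴿ x ^ᴿ n

rpow : (x : ℝ) → 0< x → ℝ → ℝ
rpow x 0<x y = exp (y *ᴿ log x 0<x)

1+w/3≤sum : ∀ {w} → 0ℚ ≤ w → ∀ n → 1ℚ + 1/odd 1 * w ≤ partialSum 1/odd (2 ℕ.+ n) w
1+w/3≤sum {w} 0≤w zero    = ≤-reflexive (solve 2 (λ w k → con 1ℚ :+ k :* w := (con 0ℚ :+ con 1ℚ :* con 1ℚ) :+ k :* (w :* con 1ℚ)) refl w (1/odd 1))
1+w/3≤sum {w} 0≤w (suc n) = begin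
  1ℚ + 1/odd 1 * w                                          ≤⟨ 1+w/3≤sum 0≤w n ⟩
  S                                                         ≡⟨ ℚ.+-identityʳ S ⟨
  S + 0ℚ                                                    ≤⟨ ℚ.+-monoʳ-≤ S (0≤* (<⇒≤ (0<1/odd (2 ℕ.+ n))) (0≤^ 0≤w (2 ℕ.+ n))) ⟩
  S + 1/odd (2 ℕ.+ n) * w ^ (2 ℕ.+ n)                       ∎
  where
  open ≤-Reasoning
  S = partialSum 1/odd (2 ℕ.+ n) w

abstract
  1<x⇒0<x : ∀ {x} → 0< x -ᴿ 1ᴿ → 0< x
  1<x⇒0<x {x} (δ , 0<δ , δ≤x-1) = δ , 0<δ , map-ev (λ n p → ≤-trans p (x-1≤x (seq x n))) δ≤x-1
    where
    x-1≤x : ∀ q → q - 1ℚ ≤ q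
    x-1≤x q = subst (q - 1ℚ ≤_) (ℚ.+-identityʳ q) (ℚ.+-monoʳ-≤ q (ℚ.neg-antimono-≤ 0≤1))

  0<-log : ∀ {x} (0<x : 0< x) → 0< x -ᴿ 1ᴿ → 0< log x 0<x
  0<-log {x} 0<x 1<x = 0<-* {2ᴿ} {artanh z dom} (0<-fromℚ (fromℕ-suc-pos 1)) (0<-* {z} {S} 0<z 0<S)
    where
    z : ℝ
    z = cayley x 0<x
    dom : 0< 1ᴿ -ᴿ z *ᴿ z
    dom = cayley-domain x 0<x
    S : ℝ
    S = powerSeries 1/odd (z *ᴿ z) (artanh-summable z dom)
    0<z : 0< z
    0<z = 0<-* {x -ᴿ 1ᴿ} {invᴿ (x +ᴿ 1ᴿ) (0<x+1 {x} 0<x)} 1<x (0<-inv {x +ᴿ 1ᴿ} (0<x+1 {x} 0<x))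
    0<z² : 0< z *ᴿ z
    0<z² = 0<-* {z} {z} 0<z 0<z
    bound : ∀ n → (proj₁ 0<z² ≤ seq (z *ᴿ z) n) × 2 ℕ.≤ n → 1ℚ ≤ seq S n
    bound (suc (suc n)) (p , _) = begin
      1ℚ                        ≡⟨ ℚ.+-identityʳ 1ℚ ⟨
      1ℚ + 0ℚ                   ≤⟨ ℚ.+-monoʳ-≤ 1ℚ (0≤* (<⇒≤ (0<1/odd 1)) 0≤w) ⟩
      1ℚ + 1/odd 1 * w          ≤⟨ 1+w/3≤sum 0≤w n ⟩
      seq S (2 ℕ.+ n)           ∎
      where
      open ≤-Reasoning
      w : ℚ
      w = seq (z *ᴿ z) (2 ℕ.+ n)
      0≤w : 0ℚ ≤ w
      0≤w = ≤-trans (<⇒≤ (proj₁ (proj₂ 0<z²))) p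
    bound zero       (_ , ())
    bound (suc zero) (_ , ℕ.s≤s ())
    0<S : 0< S
    0<S = 1ℚ , 0<1 , map-ev bound (proj₂ (proj₂ 0<z²) ∩ (2 , λ _ p → p))

ℕ→ℝ : ℕ → ℝ
ℕ→ℝ n = fromℚ (fromℕ n)

0<ℕ→ℝ : ∀ {n} → 3 ℕ.≤ n → 0< ℕ→ℝ n
0<ℕ→ℝ 3≤n = 0<-fromℚ (ℚ.<-≤-trans (fromℕ-suc-pos 2) (fromℕ-mono 3≤n))

abstract
  1<log : ∀ {n} (3≤n : 3 ℕ.≤ n) → 0< log (ℕ→ℝ n) (0<ℕ→ℝ 3≤n) -ᴿ 1ᴿ
  1<log {n} 3≤n = inv (fromℕ 12) , 0<inv (fromℕ-suc-pos 11) , 2 , from-two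
    where
    open ≤-Reasoning
    ν ζ : ℚ
    ν = fromℕ n
    ζ = (ν - 1ℚ) * inv (ν + 1ℚ)

    0<ν+1 : 0ℚ < ν + 1ℚ
    0<ν+1 = ℚ.+-mono-≤-< (0≤fromℕ n) 0<1

    half : ½ * (ν + 1ℚ) ≤ ν - 1ℚ
    half = 0≤q-p⇒p≤q (subst (0ℚ ≤_)
      (solve 1 (λ v → con ½ :* (v :- con (fromℕ 3)) := (v :- con 1ℚ) :- con ½ :* (v :+ con 1ℚ)) refl ν)
      (0≤* (ℚ.nonNegative⁻¹ ½) (p≤q⇒0≤q-p (fromℕ-mono 3≤n))))

    ½≤ζ : ½ ≤ ζ
    ½≤ζ = begin
      ½                                ≡⟨ ℚ.*-identityʳ ½ ⟨
      ½ * 1ℚ                           ≡⟨ cong (½ *_) (inv-inverse 0<ν+1) ⟨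
      ½ * ((ν + 1ℚ) * inv (ν + 1ℚ))    ≡⟨ ℚ.*-assoc ½ (ν + 1ℚ) (inv (ν + 1ℚ)) ⟨
      (½ * (ν + 1ℚ)) * inv (ν + 1ℚ)    ≤⟨ ℚ.*-monoʳ-≤-nonNeg (inv (ν + 1ℚ)) {{ℚ.nonNegative (<⇒≤ (0<inv 0<ν+1))}} half ⟩
      ζ                                ∎

    0≤½ : 0ℚ ≤ ½
    0≤½ = ℚ.nonNegative⁻¹ ½

    ¼≤ζ² : ½ * ½ ≤ ζ * ζ
    ¼≤ζ² = *-mono-≤ 0≤½ ½≤ζ 0≤½ ½≤ζ

    0≤ζ² : 0ℚ ≤ ζ * ζ
    0≤ζ² = ≤-trans (ℚ.nonNegative⁻¹ (½ * ½)) ¼≤ζ²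

    lower : ∀ m → inv (fromℕ 12) ≤ fromℕ 2 * (ζ * partialSum 1/odd (2 ℕ.+ m) (ζ * ζ)) - 1ℚ
    lower m = begin
      inv (fromℕ 12)
        ≡⟨⟩
      fromℕ 2 * (½ * (1ℚ + 1/odd 1 * (½ * ½))) - 1ℚ
        ≤⟨ ℚ.+-monoˡ-≤ (- 1ℚ) (*-monoˡ (0≤fromℕ 2)
             (*-mono-≤ 0≤½ ½≤ζ (ℚ.nonNegative⁻¹ (1ℚ + 1/odd 1 * (½ * ½)))
               (≤-trans (ℚ.+-monoʳ-≤ 1ℚ (*-monoˡ (<⇒≤ (0<1/odd 1)) ¼≤ζ²)) (1+w/3≤sum 0≤ζ² m)))) ⟩
      fromℕ 2 * (ζ * partialSum 1/odd (2 ℕ.+ m) (ζ * ζ)) - 1ℚ ∎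

    from-two : ∀ m → 2 ℕ.≤ m → inv (fromℕ 12) ≤ fromℕ 2 * (ζ * partialSum 1/odd m (ζ * ζ)) - 1ℚ
    from-two zero          ()
    from-two (suc zero)    (ℕ.s≤s ())
    from-two (suc (suc m)) _ = lower m

  0<log : ∀ {n} (3≤n : 3 ℕ.≤ n) → 0< log (ℕ→ℝ n) (0<ℕ→ℝ 3≤n)
  0<log {n} 3≤n = 1<x⇒0<x {log (ℕ→ℝ n) (0<ℕ→ℝ 3≤n)} (1<log 3≤n)

  0<loglog : ∀ {n} (3≤n : 3 ℕ.≤ n) → 0< log (log (ℕ→ℝ n) (0<ℕ→ℝ 3≤n)) (0<log 3≤n)
  0<loglog {n} 3≤n = 0<-log {log (ℕ→ℝ n) (0<ℕ→ℝ 3≤n)} (0<log 3≤n) (1<log 3≤n)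

log/loglog : ∀ n → 3 ℕ.≤ n → ℝ
log/loglog n 3≤n = log n′ 0<n′ ÷ᴿ log (log n′ 0<n′) (0<log 3≤n) [ 0<loglog 3≤n ]
  where
  n′ : ℝ
  n′ = ℕ→ℝ n
  0<n′ : 0< n′
  0<n′ = 0<ℕ→ℝ 3≤n

------------------------------------------------------------------------
record Graph (n : ℕ) : Set₁ where
  field
    _~_      : Rel (Fin n) 0ℓ
    _~?_     : Decidable _~_
    ~-sym    : Symmetric _~_
    ~-irrefl : Irreflexive _≡_ _~_

words : ∀ {A : Set} → List A → ℕ → List (List A)
words xs zero    = [] ∷ []
words xs (suc k) = cartesianProductWith _∷_ xs (words xs k)

module _ {n : ℕ} where
  open DecUnique (Fin._≟_ {n}) using (Unique; unique?) public

-- A bijection [n] → Fin n is a list of length n with distinct entries.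
orders : ∀ n → List (List (Fin n))
orders n = filter unique? (words (allFin n) n)

-- Smallest positive integer not in a list; some integer from 1 to
-- length xs + 1 is missing, so the fuel suffices.
leastMissing : List ℕ → ℕ
leastMissing xs = from 1 (length xs)
  where
  open DecMembership ℕ._≟_ using (_∈?_)
  from : ℕ → ℕ → ℕ
  from c zero       = c
  from c (suc fuel) with c ∈? xs
  ... | yes _ = from (suc c) fuel
  ... | no  _ = c

module _ {n : ℕ} (G : Graph n) where
  open Graph G
  open DecMembership (≡-dec (Fin._≟_ {n}) (Fin._≟_ {n})) using (_∈_; _∈?_)

  -- the accumulator pairs each processed vertex with its colour
  firstFitFrom : List (Fin n × ℕ) → List (Fin n) → List (Fin n × ℕ)
  firstFitFrom done []       = done
  firstFitFrom done (v ∷ vs) = firstFitFrom ((v , colour) ∷ done) vs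
    where
    colour : ℕ
    colour = leastMissing (map proj₂ (filter ((v ~?_) ∘ proj₁) done))

  firstFit : List (Fin n) → List (Fin n × ℕ)
  firstFit = firstFitFrom []

  coloursUsed : List (Fin n) → ℕ
  coloursUsed σ = length (deduplicate ℕ._≟_ (map proj₂ (firstFit σ)))

  expectedColours : ℚ
  expectedColours = (+ sum (map coloursUsed (orders n)) / n !) {{n ℕ.!≢0}}

  IsPath : List (Fin n) → Set
  IsPath vs = Unique vs × Linked _~_ vs

  isPath? : ∀ vs → Dec (IsPath vs)
  isPath? vs = unique? vs ×-dec linked? _~?_ vs

  edges : List (Fin n) → List (Fin n × Fin n)
  edges vs = zip vs (drop 1 vs)

  -- edges are unordered
  HasEdge : List (Fin n) → Fin n × Fin n → Set
  HasEdge vs (u , v) = (u , v) ∈ edges vs ⊎ (v , u) ∈ edges vs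

  hasEdge? : ∀ vs e → Dec (HasEdge vs e)
  hasEdge? vs (u , v) = (u , v) ∈? edges vs ⊎-dec (v , u) ∈? edges vs

  SameEdges : Rel (List (Fin n)) 0ℓ
  SameEdges p q = All (HasEdge q) (edges p) × All (HasEdge p) (edges q)

  sameEdges? : Decidable SameEdges
  sameEdges? p q = all? (hasEdge? q) (edges p) ×-dec all? (hasEdge? p) (edges q)

  -- Paths are counted up to having the same edges, so a path and its reverse
  -- are counted once. One-vertex paths have no edges: numPaths 1 = 1 if n ≥ 1.
  numPaths : ℕ → ℕ
  numPaths k = length (deduplicate sameEdges? (filter isPath? (words (allFin n) k)))

{-# OPTIONS --safe #-}

-- A vertex of colour k ends a path of k vertices that are processed in the
-- order of the path, so by the union bound over the ordered k-paths, each of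
-- which is monotone in n!/k! orders, at least k colours are used with
-- probability at most k P_k(G)/k!. Hence the expectation is at most
-- k + n P_{k+1}(G)/k! ≤ k + O(1) as soon as k! exceeds n^(a+1) b^k, up to a
-- constant, which holds for a suitable k = O(log n / log log n). All constants
-- are crude: logarithms enter only through powers of 2.

module Submission where

open import Defs

open import Data.Empty using (⊥)
open import Data.Fin.Base using (Fin)
import Data.Fin.Properties as Fin
open import Data.Integer.Base as ℤ using (+_)
import Data.Integer.Properties as ℤ
open import Data.List.Base
  using (List; []; _∷_; _++_; _ʳ++_; allFin; cartesianProductWith; deduplicate; filter; length; map; reverse; take; upTo)
import Data.List.Membership.DecPropositional as DecMembership
open import Data.List.Membership.Propositional using (_∈_; _∉_; find; lose)
open import Data.List.Membership.Propositional.Properties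
import Data.List.Properties as List
open import Data.List.Relation.Binary.Permutation.Propositional using (↭⇒↭ₛ; ↭-sym)
open import Data.List.Relation.Binary.Permutation.Propositional.Properties using (↭-reverse)
import Data.List.Relation.Binary.Permutation.Setoid.Properties as Permutation
import Data.List.Relation.Binary.Sublist.DecPropositional as DecSublist
open import Data.List.Relation.Binary.Sublist.Propositional using (_⊆_; []; _∷_; _∷ʳ_; minimum; ⊆-reflexive; ⊆-trans)
import Data.List.Relation.Binary.Sublist.Propositional.Properties as Sublist
open import Data.List.Relation.Unary.All as All using (All; []; _∷_; all?)
import Data.List.Relation.Unary.All.Properties as All
open import Data.List.Relation.Unary.AllPairs using ([]; _∷_)
open import Data.List.Relation.Unary.Any as Any using (Any; here; there; any?)
import Data.List.Relation.Unary.Any.Properties as Any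
open import Data.List.Relation.Unary.Linked using (Linked; [-]; _∷_)
open import Data.List.Relation.Unary.Unique.DecPropositional.Properties using (deduplicate-!)
import Data.List.Relation.Unary.Unique.Propositional as Propositional
import Data.List.Relation.Unary.Unique.Propositional.Properties as Unique
open import Data.Nat.Base as ℕ using (ℕ; zero; suc; _!; z≤n; s≤s)
open import Data.Nat.DivMod using (_/_; m/n*n≤m; m≡m%n+[m/n]*n; m%n<n)
open import Data.Nat.ListAction using (sum)
import Data.Nat.Properties as ℕ
import Data.Nat.Solver as ℕ-Solver
open import Data.Product.Base using (∃-syntax; _×_; _,_; proj₁; proj₂)
open import Data.Rational.Base as ℚ using (ℚ; 0ℚ; 1ℚ; ½; _+_; _-_; _*_; ∣_∣; _≤_; _<_)
open import Data.Rational.Properties as ℚ using (≤-refl; ≤-trans; ≤-reflexive; <⇒≤)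
open import Data.Rational.Solver using (module +-*-Solver)
import Data.Rational.Unnormalised.Base as ℚᵘ
import Data.Rational.Unnormalised.Properties as ℚᵘ
open import Data.Sum.Base using (_⊎_; inj₁; inj₂; swap)
open import Data.Unit.Base using (⊤; tt)
open import Function.Base using (_∘_; _$_)
open import Level using (0ℓ)
open import Relation.Binary.Definitions using (DecidableEquality)
open import Relation.Binary.PropositionalEquality
open import Relation.Nullary.Decidable using (Dec; yes; no; _×-dec_; ¬?)
open import Relation.Nullary.Negation using (¬_; contradiction)
open import Relation.Unary using (Pred; Decidable)

open import Algebra.Definitions.RawSemiring ℚ.+-*-rawSemiring using (_^_)
open +-*-Solver using (solve; con; _:+_; _:*_; _:-_; :-_; _:=_)
open ℕ-Solver.+-*-Solver using ()
  renaming (solve to ℕ-solve; con to κ; _:+_ to infixl 6 _⊕_; _:*_ to infixl 7 _⊗_; _:=_ to infix 4 _⊜_)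

-- Counting

-- Besides the union bound, the work lies in the passage through Cauchy reals. The hypothesis on
-- paths is read at a single late index with error 1, where it becomes an inequality between natural
-- numbers, with `a`, `b`, `C` replaced by natural bounds on the tails of their sequences. The
-- conclusion must hold at all late indices, so `log n` and `log log n` are estimated through their
-- partial sums. Integer scales replace analysis: `l` is the floor of log2 n, `μ` the floor of log4
-- l, and `suc k` has order l / (μ + 1), which still lets (k + 1)! exceed a prescribed 2^(d l + s (k
-- + 1)). Probabilities appear as counts over `orders n` multiplied by factorials. The factor k in k
-- P_k(G)/k! arises because a path is recovered from its edge set and its first vertex, for which
-- there are at most k choices.

module _ {A : Set} where

  count : {P : Pred A 0ℓ} → Decidable P → List A → ℕ
  count P? xs = length (filter P? xs)

module _ {A : Set} where

  module _ {P Q R : Pred A 0ℓ} (P? : Decidable P) (Q? : Decidable Q) (R? : Decidable R) where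

    count-∪ : ∀ xs → (∀ {x} → x ∈ xs → P x → Q x ⊎ R x) → count P? xs ℕ.≤ count Q? xs ℕ.+ count R? xs
    count-∪ []       _ = z≤n
    count-∪ (x ∷ xs) h with P? x | Q? x | R? x | count-∪ xs (h ∘ there)
    ... | no _  | no _  | no _  | ih = ih
    ... | no _  | no _  | yes _ | ih = ℕ.≤-trans ih (ℕ.+-monoʳ-≤ (count Q? xs) (ℕ.n≤1+n _))
    ... | no _  | yes _ | no _  | ih = ℕ.m≤n⇒m≤1+n ih
    ... | no _  | yes _ | yes _ | ih = ℕ.m≤n⇒m≤1+n (ℕ.≤-trans ih (ℕ.+-monoʳ-≤ (count Q? xs) (ℕ.n≤1+n _)))
    ... | yes _ | yes _ | no _  | ih = s≤s ih
    ... | yes _ | yes _ | yes _ | ih = s≤s (ℕ.≤-trans ih (ℕ.+-monoʳ-≤ (count Q? xs) (ℕ.n≤1+n _)))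
    ... | yes _ | no _  | yes _ | ih rewrite ℕ.+-suc (count Q? xs) (count R? xs) = s≤s ih
    ... | yes p | no ¬q | no ¬r | _  with h (here refl) p
    ...   | inj₁ q = contradiction q ¬q
    ...   | inj₂ r = contradiction r ¬r

    count-filter : (∀ {x} → P x → Q x → R x) → ∀ xs → count Q? (filter P? xs) ℕ.≤ count R? xs
    count-filter h []       = z≤n
    count-filter h (x ∷ xs) with P? x
    ... | no _ with R? x
    ...   | no _  = count-filter h xs
    ...   | yes _ = ℕ.m≤n⇒m≤1+n (count-filter h xs)
    count-filter h (x ∷ xs) | yes p with Q? x | R? x
    ...   | no _  | no _  = count-filter h xs
    ...   | no _  | yes _ = ℕ.m≤n⇒m≤1+n (count-filter h xs)
    ...   | yes _ | yes _ = s≤s (count-filter h xs)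
    ...   | yes q | no ¬r = contradiction (h p q) ¬r

  ∅? : Decidable {A = A} (λ _ → ⊥)
  ∅? _ = no λ ()

  count-none : ∀ {P : Pred A 0ℓ} (P? : Decidable P) xs → (∀ {x} → x ∈ xs → ¬ P x) → count P? xs ≡ 0
  count-none P? xs h = cong length (List.filter-none P? (All.tabulate h))

  count-∅ : ∀ xs → count ∅? xs ≡ 0
  count-∅ xs = count-none ∅? xs λ _ ()

  count-mono : ∀ {P Q : Pred A 0ℓ} (P? : Decidable P) (Q? : Decidable Q) xs →
               (∀ {x} → x ∈ xs → P x → Q x) → count P? xs ℕ.≤ count Q? xs
  count-mono P? Q? xs h = subst (count P? xs ℕ.≤_)
    (trans (cong (count Q? xs ℕ.+_) (count-∅ xs)) (ℕ.+-identityʳ _))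
    (count-∪ P? Q? ∅? xs λ x∈ p → inj₁ (h x∈ p))

  -- The union bound over the events `R y`, in counting form.
  count-any : ∀ {B : Set} {P : Pred A 0ℓ} (P? : Decidable P) {R : B → Pred A 0ℓ} (R? : ∀ y → Decidable (R y)) →
              ∀ xs ys → (∀ {x} → x ∈ xs → P x → Any (λ y → R y x) ys) →
              count P? xs ℕ.≤ sum (map (λ y → count (R? y) xs) ys)
  count-any P? R? xs []       h = ℕ.≤-reflexive (count-none P? xs λ x∈ p → Any.¬Any[] (h x∈ p))
  count-any P? R? xs (y ∷ ys) h = ℕ.≤-trans
    (count-∪ P? (R? y) (λ x → any? (λ y → R? y x) ys) xs λ x∈ p → Any.toSum (h x∈ p))
    (ℕ.+-monoʳ-≤ (count (R? y) xs) (count-any (λ x → any? (λ y → R? y x) ys) R? xs ys λ _ r → r))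

  sum-* : ∀ (f : A → ℕ) c xs → sum (map f xs) ℕ.* c ≡ sum (map (λ x → f x ℕ.* c) xs)
  sum-* f c []       = refl
  sum-* f c (x ∷ xs) = trans (ℕ.*-distribʳ-+ c (f x) (sum (map f xs))) (cong (f x ℕ.* c ℕ.+_) (sum-* f c xs))

  sum-≤-length : ∀ (f : A → ℕ) {d} xs → (∀ {x} → x ∈ xs → f x ℕ.≤ d) → sum (map f xs) ℕ.≤ length xs ℕ.* d
  sum-≤-length f []       h = z≤n
  sum-≤-length f (x ∷ xs) h = ℕ.+-mono-≤ (h (here refl)) (sum-≤-length f xs (h ∘ there))

  module _ {P Q : Pred A 0ℓ} (P? : Decidable P) (Q? : Decidable Q) (f : A → ℕ) {a b : ℕ} where

    sum-≤-counts : ∀ xs → (∀ {x} → x ∈ xs → P x → f x ℕ.≤ a) → (∀ {x} → x ∈ xs → Q x → f x ℕ.≤ b) →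
                   (∀ {x} → x ∈ xs → ¬ P x → ¬ Q x → f x ≡ 0) →
                   sum (map f xs) ℕ.≤ count P? xs ℕ.* a ℕ.+ count Q? xs ℕ.* b
    sum-≤-counts []       _ _ _ = z≤n
    sum-≤-counts (x ∷ xs) p q r
      with P? x | Q? x | sum-≤-counts xs (p ∘ there) (q ∘ there) (r ∘ there)
    ... | no ¬p | no ¬q | ih rewrite r (here refl) ¬p ¬q = ih
    ... | yes Px | no _ | ih = begin
      f x ℕ.+ sum (map f xs)                                         ≤⟨ ℕ.+-mono-≤ (p (here refl) Px) ih ⟩
      a ℕ.+ (count P? xs ℕ.* a ℕ.+ count Q? xs ℕ.* b)                 ≡⟨ ℕ.+-assoc a _ _ ⟨
      a ℕ.+ count P? xs ℕ.* a ℕ.+ count Q? xs ℕ.* b                   ∎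
      where open ℕ.≤-Reasoning
    ... | no _ | yes Qx | ih = begin
      f x ℕ.+ sum (map f xs)                                         ≤⟨ ℕ.+-mono-≤ (q (here refl) Qx) ih ⟩
      b ℕ.+ (count P? xs ℕ.* a ℕ.+ count Q? xs ℕ.* b)                 ≡⟨ x∙yz≈y∙xz b (count P? xs ℕ.* a) _ ⟩
      count P? xs ℕ.* a ℕ.+ (b ℕ.+ count Q? xs ℕ.* b)                 ∎
      where open ℕ.≤-Reasoning
            open import Algebra.Properties.CommutativeSemigroup ℕ.+-commutativeSemigroup
    ... | yes Px | yes _ | ih = begin
      f x ℕ.+ sum (map f xs)                                         ≤⟨ ℕ.+-mono-≤ (p (here refl) Px) ih ⟩
      a ℕ.+ (count P? xs ℕ.* a ℕ.+ count Q? xs ℕ.* b)                 ≡⟨ ℕ.+-assoc a _ _ ⟨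
      a ℕ.+ count P? xs ℕ.* a ℕ.+ count Q? xs ℕ.* b                   ≤⟨ ℕ.+-monoʳ-≤ (a ℕ.+ count P? xs ℕ.* a) (ℕ.m≤n+m (count Q? xs ℕ.* b) b) ⟩
      a ℕ.+ count P? xs ℕ.* a ℕ.+ (b ℕ.+ count Q? xs ℕ.* b)           ∎
      where open ℕ.≤-Reasoning

  -- Pigeonhole principle. Deleting the head of `xs` from `ys` shortens `ys`, and by distinctness
  -- the tail of `xs` stays inside.
  distinct-length-≤ : DecidableEquality A → ∀ {xs} ys → Propositional.Unique xs → All (_∈ ys) xs → length xs ℕ.≤ length ys
  distinct-length-≤ _≟_ ys []        []          = z≤n
  distinct-length-≤ _≟_ ys (x∉ ∷ u) (x∈ys ∷ xs⊆) = ℕ.≤-trans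
    (s≤s (distinct-length-≤ _≟_ (filter (¬? ∘ (_ ≟_)) ys) u
      (All.zipWith (λ (x≢y , y∈ys) → ∈-filter⁺ (¬? ∘ (_ ≟_)) y∈ys x≢y) (x∉ , xs⊆))))
    (List.filter-notAll (¬? ∘ (_ ≟_)) ys (Any.map (λ x≡y x≢y → x≢y x≡y) x∈ys))

  count-map : ∀ {B : Set} {P : Pred A 0ℓ} (P? : Decidable P) (f : B → A) xs → count P? (map f xs) ≡ count (P? ∘ f) xs
  count-map P? f []       = refl
  count-map P? f (x ∷ xs) with P? (f x)
  ... | no _  = count-map P? f xs
  ... | yes _ = cong suc (count-map P? f xs)

module _ {A : Set} where

  count-words : ∀ {P : Pred (List A) 0ℓ} (P? : Decidable P) xs m →
                count P? (words xs (suc m)) ≡ sum (map (λ x → count (P? ∘ (x ∷_)) (words xs m)) xs)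
  count-words P? xs m = go xs
    where
    ws = words xs m
    go : ∀ ys → count P? (cartesianProductWith _∷_ ys ws) ≡ sum (map (λ x → count (P? ∘ (x ∷_)) ws) ys)
    go []       = refl
    go (y ∷ ys) = begin
      length (filter P? (map (y ∷_) ws ++ cartesianProductWith _∷_ ys ws))
        ≡⟨ cong length (List.filter-++ P? (map (y ∷_) ws) _) ⟩
      length (filter P? (map (y ∷_) ws) ++ filter P? (cartesianProductWith _∷_ ys ws))
        ≡⟨ List.length-++ (filter P? (map (y ∷_) ws)) ⟩
      count P? (map (y ∷_) ws) ℕ.+ count P? (cartesianProductWith _∷_ ys ws)
        ≡⟨ cong₂ ℕ._+_ (count-map P? (y ∷_) ws) (go ys) ⟩
      count (P? ∘ (y ∷_)) ws ℕ.+ sum (map (λ x → count (P? ∘ (x ∷_)) ws) ys) ∎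
      where open ≡-Reasoning

  words-complete : ∀ {xs : List A} ws → All (_∈ xs) ws → ws ∈ words xs (length ws)
  words-complete []       []         = here refl
  words-complete (w ∷ ws) (w∈ ∷ ws∈) = ∈-cartesianProductWith⁺ _∷_ w∈ (words-complete ws ws∈)

  words-length : ∀ (xs : List A) k {ws} → ws ∈ words xs k → length ws ≡ k
  words-length xs zero    (here refl) = refl
  words-length xs (suc k) ws∈ with ∈-cartesianProductWith⁻ _∷_ xs (words xs k) ws∈
  ... | _ , _ , _ , ws∈′ , refl = cong suc (words-length xs k ws∈′)

-- Orders containing a given sequence

module _ {n : ℕ} where
  open DecMembership (Fin._≟_ {n}) using (_∈?_)
  open DecSublist (Fin._≟_ {n}) using (_⊆?_)

  -- `S` is the stock of letters still available: once the first letter is fixed, the rest is a word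
  -- over `S` without it, so that counting can recurse on the length.
  Embeds : List (Fin n) → List (Fin n) → Pred (List (Fin n)) 0ℓ
  Embeds S c w = Unique w × All (_∈ S) w × c ⊆ w

  embeds? : ∀ S c → Decidable (Embeds S c)
  embeds? S c w = unique? w ×-dec all? (_∈? S) w ×-dec (c ⊆? w)

  _∖_ : List (Fin n) → Fin n → List (Fin n)
  S ∖ x = filter (¬? ∘ (x Fin.≟_)) S

  ∖-length : ∀ {S x m} → x ∈ S → length S ℕ.≤ suc m → length (S ∖ x) ℕ.≤ m
  ∖-length {S} {x} x∈S ∣S∣≤ = ℕ.s≤s⁻¹ (ℕ.≤-trans
    (List.filter-notAll (¬? ∘ (x Fin.≟_)) S (Any.map (λ x≡y x≢y → x≢y x≡y) x∈S)) ∣S∣≤)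

  embeds-∷⁻ : ∀ {S c x w} → Embeds S c (x ∷ w) → x ∈ S × Unique w × All (_∈ S ∖ x) w × x ∉ w
  embeds-∷⁻ {S} {c} {x} (u@(x∉w ∷ uw) , x∈S ∷ w⊆S , _) = x∈S , uw ,
    All.zipWith (λ (x≢y , y∈S) → ∈-filter⁺ (¬? ∘ (x Fin.≟_)) y∈S x≢y) (x∉w , w⊆S) ,
    Unique.Unique[x∷xs]⇒x∉xs u

  tail∉ : ∀ {y x : Fin n} {c w} → y ≢ x → y ∷ c ⊆ x ∷ w → y ∷ c ⊆ w
  tail∉ y≢x (_ ∷ʳ s)  = s
  tail∉ y≢x (y≡x ∷ _) = contradiction y≡x y≢x

  ⊆-tail : ∀ {y x : Fin n} {c w} → y ∷ c ⊆ x ∷ w → c ⊆ w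
  ⊆-tail {y} (_ ∷ʳ s) = ⊆-trans (y ∷ʳ ⊆-reflexive refl) s
  ⊆-tail     (_ ∷ s)  = s

  -- Split by the first letter of a word of length m + 1, and let k be the length of `c`. If it is
  -- the head of `c`, the tail of `c` must lie in the rest, and after multiplication by k! these
  -- words contribute at most k m!. A letter of `S` outside `c` leaves all of `c` to be found and
  -- contributes at most m!. A later letter of `c` cannot come first. As `S` has at most m + 1 - k
  -- letters outside `c`, the total is at most (m + 1)!.
  count-embeds : ∀ m S c → length S ℕ.≤ m → Unique c → All (_∈ S) c →
                 count (embeds? S c) (words (allFin n) m) ℕ.* length c ! ℕ.≤ m !
  count-embeds zero S [] _ _ _ = subst (ℕ._≤ 1) (sym (ℕ.*-identityʳ _)) (List.length-filter (embeds? S []) ([] ∷ []))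
  count-embeds zero [] (_ ∷ _) _ _ (() ∷ _)
  count-embeds zero (_ ∷ _) _ () _ _
  count-embeds (suc m) S [] ∣S∣≤ u c⊆S = begin
    count (embeds? S []) (words (allFin n) (suc m)) ℕ.* 1
      ≡⟨ ℕ.*-identityʳ _ ⟩
    count (embeds? S []) (words (allFin n) (suc m))
      ≡⟨ count-words (embeds? S []) (allFin n) m ⟩
    sum (map f (allFin n))
      ≤⟨ sum-≤-counts (_∈? S) ∅? f {b = 0} (allFin n) (λ {x} _ → bound x) (λ _ ()) (λ {x} _ x∉S _ → vanish x x∉S) ⟩
    count (_∈? S) (allFin n) ℕ.* m ! ℕ.+ count ∅? (allFin n) ℕ.* 0
      ≡⟨ cong (count (_∈? S) (allFin n) ℕ.* m ! ℕ.+_) (ℕ.*-zeroʳ (count ∅? (allFin n))) ⟩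
    count (_∈? S) (allFin n) ℕ.* m ! ℕ.+ 0
      ≡⟨ ℕ.+-identityʳ _ ⟩
    count (_∈? S) (allFin n) ℕ.* m !
      ≤⟨ ℕ.*-monoˡ-≤ (m !) (ℕ.≤-trans ∣∈S∣≤ ∣S∣≤) ⟩
    suc m ℕ.* m ! ∎
    where
    open ℕ.≤-Reasoning
    f : Fin n → ℕ
    f x = count (embeds? S [] ∘ (x ∷_)) (words (allFin n) m)
    ∣∈S∣≤ : count (_∈? S) (allFin n) ℕ.≤ length S
    ∣∈S∣≤ = distinct-length-≤ Fin._≟_ S (Unique.filter⁺ (_∈? S) (Unique.allFin⁺ n)) (All.all-filter (_∈? S) (allFin n))
    vanish : ∀ x → x ∉ S → f x ≡ 0
    vanish x x∉S = count-none (embeds? S [] ∘ (x ∷_)) (words (allFin n) m) λ _ e → x∉S (proj₁ (embeds-∷⁻ e))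
    bound : ∀ x → x ∈ S → f x ℕ.≤ m !
    bound x x∈S = begin
      f x
        ≤⟨ count-mono (embeds? S [] ∘ (x ∷_)) (embeds? (S ∖ x) []) (words (allFin n) m)
             (λ _ e → let _ , uw , w⊆ , _ = embeds-∷⁻ e in uw , w⊆ , minimum _) ⟩
      count (embeds? (S ∖ x) []) (words (allFin n) m)
        ≡⟨ ℕ.*-identityʳ _ ⟨
      count (embeds? (S ∖ x) []) (words (allFin n) m) ℕ.* 1
        ≤⟨ count-embeds m (S ∖ x) [] (∖-length x∈S ∣S∣≤) [] [] ⟩
      m ! ∎
  count-embeds (suc m) S (y ∷ c) ∣S∣≤ uyc@(y∉c ∷ uc) yc⊆S@(y∈S ∷ c⊆S) = begin
    count (embeds? S (y ∷ c)) (words (allFin n) (suc m)) ℕ.* k !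
      ≡⟨ cong (ℕ._* k !) (count-words (embeds? S (y ∷ c)) (allFin n) m) ⟩
    sum (map f (allFin n)) ℕ.* k !
      ≡⟨ sum-* f (k !) (allFin n) ⟩
    sum (map (λ x → f x ℕ.* k !) (allFin n))
      ≤⟨ sum-≤-counts (y Fin.≟_) other? (λ x → f x ℕ.* k !) (allFin n)
           (λ { _ refl → first }) (λ _ → later) (λ {x} _ y≢x ¬o → cong (ℕ._* k !) (vanish x y≢x ¬o)) ⟩
    count (y Fin.≟_) (allFin n) ℕ.* (k ℕ.* m !) ℕ.+ count other? (allFin n) ℕ.* m !
      ≤⟨ ℕ.+-monoˡ-≤ (count other? (allFin n) ℕ.* m !) (ℕ.*-monoˡ-≤ (k ℕ.* m !) one) ⟩
    1 ℕ.* (k ℕ.* m !) ℕ.+ count other? (allFin n) ℕ.* m !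
      ≡⟨ cong (ℕ._+ count other? (allFin n) ℕ.* m !) (ℕ.*-identityˡ (k ℕ.* m !)) ⟩
    k ℕ.* m ! ℕ.+ count other? (allFin n) ℕ.* m !
      ≡⟨ ℕ.*-distribʳ-+ (m !) k (count other? (allFin n)) ⟨
    (k ℕ.+ count other? (allFin n)) ℕ.* m !
      ≤⟨ ℕ.*-monoˡ-≤ (m !) (ℕ.≤-trans ∣others∣≤ ∣S∣≤) ⟩
    suc m ℕ.* m ! ∎
    where
    open ℕ.≤-Reasoning
    k = suc (length c)
    ws = words (allFin n) m
    f : Fin n → ℕ
    f x = count (embeds? S (y ∷ c) ∘ (x ∷_)) ws
    other? : Decidable (λ x → x ∈ S × x ∉ (y ∷ c))
    other? x = (x ∈? S) ×-dec ¬? (x ∈? (y ∷ c))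
    one : count (y Fin.≟_) (allFin n) ℕ.≤ 1
    one = distinct-length-≤ Fin._≟_ (y ∷ []) (Unique.filter⁺ (y Fin.≟_) (Unique.allFin⁺ n))
      (All.map (here ∘ sym) (All.all-filter (y Fin.≟_) (allFin n)))
    ∣others∣≤ : k ℕ.+ count other? (allFin n) ℕ.≤ length S
    ∣others∣≤ = subst (ℕ._≤ length S) (List.length-++ (y ∷ c))
      (distinct-length-≤ Fin._≟_ S
        (Unique.++⁺ uyc (Unique.filter⁺ other? (Unique.allFin⁺ n))
          λ (x∈yc , x∈o) → proj₂ (proj₂ (∈-filter⁻ other? {xs = allFin n} x∈o)) x∈yc)
        (All.++⁺ yc⊆S (All.map proj₁ (All.all-filter other? (allFin n)))))
    vanish : ∀ x → y ≢ x → ¬ (x ∈ S × x ∉ (y ∷ c)) → f x ≡ 0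
    vanish x y≢x ¬o = count-none (embeds? S (y ∷ c) ∘ (x ∷_)) ws λ {w} _ e →
      let x∈S , _ , _ , x∉w = embeds-∷⁻ e in
      ¬o (x∈S , λ x∈yc → x∉w (Sublist.Any-resp-⊆ (tail∉ y≢x (proj₂ (proj₂ e))) x∈yc))
    first : f y ℕ.* k ! ℕ.≤ k ℕ.* m !
    first = begin
      f y ℕ.* (k ℕ.* length c !)     ≡⟨ x∙yz≈y∙xz (f y) k (length c !) ⟩
      k ℕ.* (f y ℕ.* length c !)     ≤⟨ ℕ.*-monoʳ-≤ k (ℕ.*-monoˡ-≤ (length c !)
                                          (count-mono (embeds? S (y ∷ c) ∘ (y ∷_)) (embeds? (S ∖ y) c) ws
                                            λ _ e → let _ , uw , w⊆ , _ = embeds-∷⁻ e in uw , w⊆ , ⊆-tail (proj₂ (proj₂ e)))) ⟩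
      k ℕ.* (count (embeds? (S ∖ y) c) ws ℕ.* length c !)
                                     ≤⟨ ℕ.*-monoʳ-≤ k (count-embeds m (S ∖ y) c (∖-length y∈S ∣S∣≤) uc
                                          (All.zipWith (λ (y≢z , z∈S) → ∈-filter⁺ (¬? ∘ (y Fin.≟_)) z∈S y≢z) (y∉c , c⊆S))) ⟩
      k ℕ.* m ! ∎
      where open import Algebra.Properties.CommutativeSemigroup ℕ.*-commutativeSemigroup
    later : ∀ {x} → x ∈ S × x ∉ (y ∷ c) → f x ℕ.* k ! ℕ.≤ m !
    later {x} (x∈S , x∉yc) = ℕ.≤-trans
      (ℕ.*-monoˡ-≤ (k !) (count-mono (embeds? S (y ∷ c) ∘ (x ∷_)) (embeds? (S ∖ x) (y ∷ c)) ws
        λ _ e → let _ , uw , w⊆ , _ = embeds-∷⁻ e in uw , w⊆ , tail∉ (λ { refl → x∉yc (here refl) }) (proj₂ (proj₂ e))))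
      (count-embeds m (S ∖ x) (y ∷ c) (∖-length x∈S ∣S∣≤) uyc
        (All.tabulate λ z∈yc → ∈-filter⁺ (¬? ∘ (x Fin.≟_)) (All.lookup yc⊆S z∈yc) λ { refl → x∉yc z∈yc }))

  -- `P` is any property that forces `c` into the order, because the application is to paths
  -- contained in the reversed order.
  count-orders : ∀ {P : Pred (List (Fin n)) 0ℓ} (P? : Decidable P) c → Unique c → (∀ {σ} → P σ → c ⊆ σ) →
                 count P? (orders n) ℕ.* length c ! ℕ.≤ n !
  count-orders P? c uc P⇒ = ℕ.≤-trans
    (ℕ.*-monoˡ-≤ (length c !) (count-filter unique? P? (embeds? (allFin n) c)
      (λ uσ p → uσ , All.tabulate (λ {x} _ → ∈-allFin x) , P⇒ p) (words (allFin n) n)))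
    (count-embeds n (allFin n) c (ℕ.≤-reflexive (List.length-tabulate (λ x → x))) uc (All.tabulate (λ {x} _ → ∈-allFin x)))

  -- The empty sequence is contained in every order, so this is an instance of `count-orders`.
  length-orders : length (orders n) ℕ.≤ n !
  length-orders = subst (ℕ._≤ n !) (trans (ℕ.*-identityʳ _) (cong length (List.filter-all all-true? (All.tabulate {xs = orders n} (λ _ → tt)))))
    (count-orders all-true? [] [] (λ _ → minimum _))
    where
    all-true? : Decidable {A = List (Fin n)} (λ _ → ⊤)
    all-true? _ = yes tt

-- FirstFit

mutual
  -- The local function of leastMissing, which is out of scope here, is
  -- recovered by unification once both of its arguments are variables.
  from : List ℕ → ℕ → ℕ → ℕ
  from = _

  leastMissing≡from : ∀ xs → leastMissing xs ≡ from xs 1 (length xs)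
  leastMissing≡from xs with 1 | length xs
  ... | c | fuel = refl

module _ (xs : List ℕ) where
  open DecMembership ℕ._≟_ using (_∈?_)

  from-≥ : ∀ c fuel → c ℕ.≤ from xs c fuel
  from-≥ c zero = ℕ.≤-refl
  from-≥ c (suc fuel) with c ∈? xs
  ... | no  _ = ℕ.≤-refl
  ... | yes _ = ℕ.≤-trans (ℕ.n≤1+n c) (from-≥ (suc c) fuel)

  -- The scan passes a number only after finding it in `xs`, so this holds whether it ends at a gap
  -- or by running out of fuel.
  <from⇒∈ : ∀ c fuel j → c ℕ.≤ j → j ℕ.< from xs c fuel → j ∈ xs
  <from⇒∈ c zero j c≤j j<c = contradiction j<c (ℕ.≤⇒≯ c≤j)
  <from⇒∈ c (suc fuel) j c≤j j< with c ∈? xs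
  ... | no  _ = contradiction j< (ℕ.≤⇒≯ c≤j)
  ... | yes c∈ with ℕ.m≤n⇒m<n∨m≡n c≤j
  ...   | inj₂ refl = c∈
  ...   | inj₁ c<j  = <from⇒∈ (suc c) fuel j c<j j<

  leastMissing-positive : 1 ℕ.≤ leastMissing xs
  leastMissing-positive = subst (1 ℕ.≤_) (sym (leastMissing≡from xs)) (from-≥ 1 (length xs))

  <leastMissing⇒∈ : ∀ j → 1 ℕ.≤ j → j ℕ.< leastMissing xs → j ∈ xs
  <leastMissing⇒∈ j 1≤j j< = <from⇒∈ 1 (length xs) j 1≤j (subst (j ℕ.<_) (leastMissing≡from xs) j<)

module _ {n : ℕ} where

  unique-⊆ : ∀ {xs ys : List (Fin n)} → xs ⊆ ys → Unique ys → Unique xs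
  unique-⊆ []         []         = []
  unique-⊆ (_ ∷ʳ s)   (_ ∷ u)    = unique-⊆ s u
  unique-⊆ (refl ∷ s) (y∉ys ∷ u) = Sublist.All-resp-⊆ s y∉ys ∷ unique-⊆ s u

  unique-reverse : ∀ {xs : List (Fin n)} → Unique xs → Unique (reverse xs)
  unique-reverse {xs} = Permutation.Unique-resp-↭ (setoid (Fin n)) (↭⇒↭ₛ (↭-sym (↭-reverse xs)))

module _ {n : ℕ} (G : Graph n) where
  open Graph G

  -- In a colouring, listed latest vertex first, each vertex of colour c has
  -- earlier neighbours of all colours below c.
  data Greedy : List (Fin n × ℕ) → Set where
    []  : Greedy []
    _∷_ : ∀ {v c done} → (1 ℕ.≤ c) × (∀ j → 1 ℕ.≤ j → j ℕ.< c → ∃[ u ] (u , j) ∈ done × v ~ u) →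
          Greedy done → Greedy ((v , c) ∷ done)

  greedy-firstFitFrom : ∀ {done} → Greedy done → ∀ vs → Greedy (firstFitFrom G done vs)
  greedy-firstFitFrom g []       = g
  greedy-firstFitFrom {done} g (v ∷ vs) = greedy-firstFitFrom ((leastMissing-positive cs , below) ∷ g) vs
    where
    cs = map proj₂ (filter ((v ~?_) ∘ proj₁) done)
    below : ∀ j → 1 ℕ.≤ j → j ℕ.< leastMissing cs → ∃[ u ] (u , j) ∈ done × v ~ u
    below j 1≤j j< with ∈-map∘filter⁻ proj₂ ((v ~?_) ∘ proj₁) {xs = done} (<leastMissing⇒∈ cs j 1≤j j<)
    ... | (u , _) , u∈done , refl , v~u = u , u∈done , v~u

  greedy-firstFit : ∀ σ → Greedy (firstFit G σ)
  greedy-firstFit σ = greedy-firstFitFrom [] σ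

  vertices-firstFitFrom : ∀ done vs → map proj₁ (firstFitFrom G done vs) ≡ vs ʳ++ map proj₁ done
  vertices-firstFitFrom done []       = refl
  vertices-firstFitFrom done (v ∷ vs) = vertices-firstFitFrom _ vs

  greedy-positive : ∀ {done} → Greedy done → All (1 ℕ.≤_) (map proj₂ done)
  greedy-positive []            = []
  greedy-positive ((p , _) ∷ g) = p ∷ greedy-positive g

  -- Descend through the colours: a vertex of colour above `k` has an earlier neighbour of colour
  -- exactly `k`, that one a neighbour of colour k - 1, and so on down to 1. Earlier vertices stand
  -- further on in the list, so the path is a sublist and inherits distinctness of vertices from the
  -- order.
  greedy-chain : ∀ {done} → Greedy done → ∀ {v c} → (v , c) ∈ done → ∀ k → suc k ℕ.≤ c →
                 ∃[ vs ] Linked _~_ (v ∷ vs) × v ∷ vs ⊆ map proj₁ done × length vs ≡ k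
  greedy-chain (_∷_ {v = u} h g) (there v∈) k k<c with greedy-chain g v∈ k k<c
  ... | vs , l , s , e = vs , l , u ∷ʳ s , e
  greedy-chain (h ∷ g) (here refl) zero k<c = [] , [-] , refl ∷ minimum _ , refl
  greedy-chain ((_ , h) ∷ g) (here refl) (suc k) k<c with h (suc k) (s≤s z≤n) k<c
  ... | u , u∈ , v~u with greedy-chain g u∈ k ℕ.≤-refl
  ...   | vs , l , s , e = u ∷ vs , v~u ∷ l , refl ∷ s , cong suc e

  coloursUsed-≤ : ∀ σ → coloursUsed G σ ℕ.≤ length σ
  coloursUsed-≤ σ = begin
    coloursUsed G σ                       ≤⟨ List.length-deduplicate ℕ._≟_ (map proj₂ (firstFit G σ)) ⟩
    length (map proj₂ (firstFit G σ))     ≡⟨ List.length-map proj₂ (firstFit G σ) ⟩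
    length (firstFit G σ)                 ≡⟨ List.length-map proj₁ (firstFit G σ) ⟨
    length (map proj₁ (firstFit G σ))     ≡⟨ cong length (vertices-firstFitFrom [] σ) ⟩
    length (reverse σ)                    ≡⟨ List.length-reverse σ ⟩
    length σ                              ∎
    where open ℕ.≤-Reasoning

  -- The used colours are distinct and positive. If none exceeded `k`, they would lie among 1, ...,
  -- k, and there would be at most `k` of them.
  high-colour : ∀ σ k → suc k ℕ.≤ coloursUsed G σ → Any (λ vc → suc k ℕ.≤ proj₂ vc) (firstFit G σ)
  high-colour σ k k<used with any? (λ vc → suc k ℕ.≤? proj₂ vc) (firstFit G σ)
  ... | yes p = p
  ... | no ¬p = contradiction k<used (ℕ.≤⇒≯ (ℕ.≤-trans
    (distinct-length-≤ ℕ._≟_ (map suc (upTo k)) (deduplicate-! ℕ._≟_ colours)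
      (All.deduplicate⁺ ℕ._≟_ (All.tabulate small)))
    (ℕ.≤-reflexive (trans (List.length-map suc (upTo k)) (List.length-upTo k)))))
    where
    colours = map proj₂ (firstFit G σ)
    small : ∀ {c} → c ∈ colours → c ∈ map suc (upTo k)
    small c∈ with ∈-map⁻ proj₂ c∈ | All.lookup (greedy-positive (greedy-firstFit σ)) c∈
    small c∈ | (v , suc c) , vc∈ , refl | _ = ∈-map⁺ suc (∈-upTo⁺ (ℕ.≮⇒≥ λ k≤c → ¬p (lose vc∈ k≤c)))
    small c∈ | (v , zero) , vc∈ , refl | ()

  -- FirstFit puts each new vertex in front of the processed ones, so the chain, which runs from the
  -- latest vertex to the earliest, lies in the reversed order.
  monotone-path : ∀ {σ} → Unique σ → ∀ k → suc k ℕ.≤ coloursUsed G σ →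
                  ∃[ p ] p ∈ filter (isPath? G) (words (allFin n) (suc k)) × p ⊆ reverse σ
  monotone-path {σ} uσ k k<used with find (high-colour σ k k<used)
  ... | (v , c) , vc∈ , k<c with greedy-chain (greedy-firstFit σ) vc∈ k k<c
  ...   | vs , l , s , refl = v ∷ vs ,
    ∈-filter⁺ (isPath? G) (words-complete (v ∷ vs) (All.tabulate (λ {x} _ → ∈-allFin x))) (u , l) , s′
    where
    s′ : v ∷ vs ⊆ reverse σ
    s′ = subst (v ∷ vs ⊆_) (vertices-firstFitFrom [] σ) s
    u : Unique (v ∷ vs)
    u = unique-⊆ s′ (unique-reverse uσ)

-- Paths

module _ {A : Set} where

  words-unique : ∀ {xs : List A} → Propositional.Unique xs → ∀ k → Propositional.Unique (words xs k)
  words-unique u zero    = [] ∷ []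
  words-unique u (suc k) = Unique.cartesianProductWith⁺ _∷_ List.∷-injective u (words-unique u k)

  constant-length≤1 : ∀ {xs : List A} → Propositional.Unique xs → (∀ {x y} → x ∈ xs → y ∈ xs → x ≡ y) → length xs ℕ.≤ 1
  constant-length≤1 {[]}         _                _ = z≤n
  constant-length≤1 {_ ∷ []}     _                _ = s≤s z≤n
  constant-length≤1 {_ ∷ _ ∷ _}  ((x≢y ∷ _) ∷ _) h = contradiction (h (here refl) (there (here refl))) x≢y

  count-⊤ : ∀ {P : Pred A 0ℓ} (P? : Decidable P) xs → All P xs → count P? xs ≡ length xs
  count-⊤ P? xs = cong length ∘ List.filter-all P?

module _ {n : ℕ} (G : Graph n) where

  hasEdge-sym : ∀ p {u v} → HasEdge G p (u , v) → HasEdge G p (v , u)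
  hasEdge-sym p = swap

  sameEdges-∋ : ∀ {p q} → SameEdges G p q → ∀ {e} → HasEdge G p e → HasEdge G q e
  sameEdges-∋ (p⇒q , _) (inj₁ e∈) = All.lookup p⇒q e∈
  sameEdges-∋ {q = q} (p⇒q , _) (inj₂ e∈) = hasEdge-sym q (All.lookup p⇒q e∈)

  sameEdges-sym : ∀ {p q} → SameEdges G p q → SameEdges G q p
  sameEdges-sym (p⇒q , q⇒p) = q⇒p , p⇒q

  sameEdges-refl : ∀ {p} → SameEdges G p p
  sameEdges-refl = All.tabulate inj₁ , All.tabulate inj₁

  sameEdges-trans : ∀ {p q r} → SameEdges G p q → SameEdges G q r → SameEdges G p r
  sameEdges-trans {p} {q} {r} pq qr =
    All.map (sameEdges-∋ {q} {r} qr) (proj₁ pq) ,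
    All.map (sameEdges-∋ {q} {p} (sameEdges-sym {p} {q} pq)) (proj₂ qr)

  edge-endpoints : ∀ vs {u v} → (u , v) ∈ edges G vs → u ∈ vs × v ∈ vs
  edge-endpoints (x ∷ y ∷ vs) (here refl) = here refl , there (here refl)
  edge-endpoints (x ∷ y ∷ vs) (there e∈)  = let u∈ , v∈ = edge-endpoints (y ∷ vs) e∈ in there u∈ , there v∈

  hasEdge-endpoint : ∀ vs {u v} → HasEdge G vs (u , v) → u ∈ vs
  hasEdge-endpoint vs (inj₁ e∈) = proj₁ (edge-endpoints vs e∈)
  hasEdge-endpoint vs (inj₂ e∈) = proj₂ (edge-endpoints vs e∈)

  hasEdge-there : ∀ {x y vs e} → HasEdge G (y ∷ vs) e → HasEdge G (x ∷ y ∷ vs) e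
  hasEdge-there (inj₁ e∈) = inj₁ (there e∈)
  hasEdge-there (inj₂ e∈) = inj₂ (there e∈)

  hasEdge-drop : ∀ {x y vs u v} → u ≢ x → v ≢ x → HasEdge G (x ∷ y ∷ vs) (u , v) → HasEdge G (y ∷ vs) (u , v)
  hasEdge-drop u≢x v≢x (inj₁ (here refl)) = contradiction refl u≢x
  hasEdge-drop u≢x v≢x (inj₁ (there e∈))  = inj₁ e∈
  hasEdge-drop u≢x v≢x (inj₂ (here refl)) = contradiction refl v≢x
  hasEdge-drop u≢x v≢x (inj₂ (there e∈))  = inj₂ e∈

  second-vertex : ∀ {x y vs v} → x ∉ y ∷ vs → HasEdge G (x ∷ y ∷ vs) (x , v) → v ≡ y
  second-vertex x∉ (inj₁ (here refl)) = refl
  second-vertex {y = y} {vs} x∉ (inj₁ (there e∈)) = contradiction (proj₁ (edge-endpoints (y ∷ vs) e∈)) x∉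
  second-vertex x∉ (inj₂ (here refl)) = refl
  second-vertex {y = y} {vs} x∉ (inj₂ (there e∈)) = contradiction (proj₂ (edge-endpoints (y ∷ vs) e∈)) x∉

  -- Since `x` occurs only at the front, it lies on a single edge, whose other end is the second
  -- vertex. The remaining edges of the first path avoid `x`, hence are edges of the rest of the
  -- second, and the argument repeats. Equal lengths make one inclusion of edge sets enough.
  edges-determine : ∀ x p q → Unique (x ∷ p) → Unique (x ∷ q) → length p ≡ length q →
                    (∀ {u v} → HasEdge G (x ∷ p) (u , v) → HasEdge G (x ∷ q) (u , v)) → p ≡ q
  edges-determine x []      []       _        _        _  _ = refl
  edges-determine x (y ∷ p) (y′ ∷ q) up@(_ ∷ up′) uq@(_ ∷ uq′) ≡l h
    with second-vertex (Unique.Unique[x∷xs]⇒x∉xs uq) (h (inj₁ (here refl)))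
  ... | refl = cong (y ∷_) (edges-determine y p q up′ uq′ (ℕ.suc-injective ≡l) λ e →
    hasEdge-drop (λ { refl → x∉ (hasEdge-endpoint (y ∷ p) e) })
                 (λ { refl → x∉ (hasEdge-endpoint (y ∷ p) (hasEdge-sym (y ∷ p) e)) })
                 (h (hasEdge-there e)))
    where x∉ = Unique.Unique[x∷xs]⇒x∉xs up

  module _ (k : ℕ) where

    -- There are at least two vertices, hence an edge: all one-vertex paths share the empty edge
    -- set, and their class would have size `n`.
    paths : List (List (Fin n))
    paths = filter (isPath? G) (words (allFin n) (2 ℕ.+ k))

    ∈paths⁻ : ∀ {p} → p ∈ paths → length p ≡ 2 ℕ.+ k × IsPath G p
    ∈paths⁻ p∈ = let p∈′ , path = ∈-filter⁻ (isPath? G) {xs = words (allFin n) (2 ℕ.+ k)} p∈ in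
      words-length (allFin n) (2 ℕ.+ k) p∈′ , path

    -- A path is determined by its edge set and its first vertex.
    class-size : ∀ {p} → p ∈ paths → count (sameEdges? G p) paths ℕ.≤ 2 ℕ.+ k
    class-size {p} p∈ = begin
      count (sameEdges? G p) paths
        ≤⟨ count-any (sameEdges? G p) from? paths p starts ⟩
      sum (map (λ v → count (from? v) paths) p)
        ≤⟨ sum-≤-length (λ v → count (from? v) paths) p (λ {v} _ → one v) ⟩
      length p ℕ.* 1
        ≡⟨ ℕ.*-identityʳ (length p) ⟩
      length p
        ≡⟨ proj₁ (∈paths⁻ p∈) ⟩
      2 ℕ.+ k ∎
      where
      open ℕ.≤-Reasoning
      From : Fin n → Pred (List (Fin n)) 0ℓ
      From v q = SameEdges G p q × take 1 q ≡ v ∷ []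
      from? : ∀ v → Decidable (From v)
      from? v q = sameEdges? G p q ×-dec List.≡-dec Fin._≟_ (take 1 q) (v ∷ [])
      -- The first edge of `q` is an edge of `p`, so the first vertex of `q` lies on `p`.
      starts : ∀ {q} → q ∈ paths → SameEdges G p q → Any (λ v → From v q) p
      starts {q} q∈ same with q | proj₁ (∈paths⁻ q∈)
      ... | v ∷ w ∷ q′ | _ = Any.map (λ { refl → same , refl })
        (hasEdge-endpoint p {v} {w} (sameEdges-∋ {v ∷ w ∷ q′} {p} (sameEdges-sym {p} {v ∷ w ∷ q′} same) (inj₁ (here refl))))
      one : ∀ v → count (from? v) paths ℕ.≤ 1
      one v = constant-length≤1
        (Unique.filter⁺ (from? v) (Unique.filter⁺ (isPath? G) (words-unique (Unique.allFin⁺ n) (2 ℕ.+ k))))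
        λ q∈ r∈ → agree (∈-filter⁻ (from? v) {xs = paths} q∈) (∈-filter⁻ (from? v) {xs = paths} r∈)
        where
        agree : ∀ {q r} → q ∈ paths × From v q → r ∈ paths × From v r → q ≡ r
        agree {q} {r} (q∈ , pq , e) (r∈ , pr , e′) with q | r | ∈paths⁻ q∈ | ∈paths⁻ r∈
        agree (q∈ , pq , refl) (r∈ , pr , refl) | x ∷ q | .x ∷ r | lq , uq , _ | lr , ur , _ =
          cong (x ∷_) (edges-determine x q r uq ur (ℕ.suc-injective (trans lq (sym lr)))
            (sameEdges-∋ {x ∷ q} {x ∷ r} (sameEdges-trans {x ∷ q} {p} {x ∷ r} (sameEdges-sym {p} {x ∷ q} pq) pr)))

    -- Every path has the edges of some representative kept by `deduplicate`, and `class-size`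
    -- bounds each class. The true size is 2, but the cruder factor 2 + k is easier to prove and
    -- disappears in `count-many-colours`.
    length-paths : length paths ℕ.≤ (2 ℕ.+ k) ℕ.* numPaths G (2 ℕ.+ k)
    length-paths = begin
      length paths
        ≡⟨ count-⊤ ⊤? paths (All.tabulate (λ _ → tt)) ⟨
      count ⊤? paths
        ≤⟨ count-any ⊤? (sameEdges? G) paths reps (λ p∈ _ → represented p∈) ⟩
      sum (map (λ p → count (sameEdges? G p) paths) reps)
        ≤⟨ sum-≤-length (λ p → count (sameEdges? G p) paths) reps (λ p∈ → class-size (∈-deduplicate⁻ (sameEdges? G) paths p∈)) ⟩
      numPaths G (2 ℕ.+ k) ℕ.* (2 ℕ.+ k)
        ≡⟨ ℕ.*-comm (numPaths G (2 ℕ.+ k)) (2 ℕ.+ k) ⟩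
      (2 ℕ.+ k) ℕ.* numPaths G (2 ℕ.+ k) ∎
      where
      open ℕ.≤-Reasoning
      ⊤? : Decidable {A = List (Fin n)} (λ _ → ⊤)
      ⊤? _ = yes tt
      reps = deduplicate (sameEdges? G) paths
      represented : ∀ {q} → q ∈ paths → Any (λ p → SameEdges G p q) reps
      represented {q} q∈ = Any.deduplicate⁺ (sameEdges? G) (λ {p} {p′} p′p pq → sameEdges-trans {p′} {p} {q} p′p pq)
        (Any.map (λ { refl → sameEdges-refl {q} }) q∈)

    count-many-colours : count (λ σ → 2 ℕ.+ k ℕ.≤? coloursUsed G σ) (orders n) ℕ.* suc k ! ℕ.≤
                         numPaths G (2 ℕ.+ k) ℕ.* n !
    -- The factor 2 + k completes (k + 1)! to (k + 2)!, as the count of orders along one path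
    -- requires, and comes back as the class size.
    count-many-colours = ℕ.*-cancelˡ-≤ (2 ℕ.+ k) (begin
      (2 ℕ.+ k) ℕ.* (count many? (orders n) ℕ.* suc k !)
        ≡⟨ x∙yz≈y∙xz (2 ℕ.+ k) (count many? (orders n)) (suc k !) ⟩
      count many? (orders n) ℕ.* (2 ℕ.+ k) !
        ≤⟨ ℕ.*-monoˡ-≤ ((2 ℕ.+ k) !) (count-any many? (λ p → p ⊆ʳ?_) (orders n) paths along) ⟩
      sum (map (λ p → count (p ⊆ʳ?_) (orders n)) paths) ℕ.* (2 ℕ.+ k) !
        ≡⟨ sum-* (λ p → count (p ⊆ʳ?_) (orders n)) ((2 ℕ.+ k) !) paths ⟩
      sum (map (λ p → count (p ⊆ʳ?_) (orders n) ℕ.* (2 ℕ.+ k) !) paths)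
        ≤⟨ sum-≤-length (λ p → count (p ⊆ʳ?_) (orders n) ℕ.* (2 ℕ.+ k) !) paths each ⟩
      length paths ℕ.* n !
        ≤⟨ ℕ.*-monoˡ-≤ (n !) length-paths ⟩
      (2 ℕ.+ k) ℕ.* numPaths G (2 ℕ.+ k) ℕ.* n !
        ≡⟨ ℕ.*-assoc (2 ℕ.+ k) (numPaths G (2 ℕ.+ k)) (n !) ⟩
      (2 ℕ.+ k) ℕ.* (numPaths G (2 ℕ.+ k) ℕ.* n !) ∎)
      where
      open ℕ.≤-Reasoning
      open import Algebra.Properties.CommutativeSemigroup ℕ.*-commutativeSemigroup
      open DecSublist (Fin._≟_ {n}) using (_⊆?_)
      many? : Decidable (λ σ → 2 ℕ.+ k ℕ.≤ coloursUsed G σ)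
      many? σ = 2 ℕ.+ k ℕ.≤? coloursUsed G σ
      _⊆ʳ?_ : ∀ p σ → Dec (p ⊆ reverse σ)
      p ⊆ʳ? σ = p ⊆? reverse σ
      along : ∀ {σ} → σ ∈ orders n → 2 ℕ.+ k ℕ.≤ coloursUsed G σ → Any (λ p → p ⊆ reverse σ) paths
      along σ∈ many = let p , p∈ , p⊆ = monotone-path G (proj₂ (∈-filter⁻ unique? {xs = words (allFin n) n} σ∈)) (suc k) many in
        lose p∈ p⊆
      each : ∀ {p} → p ∈ paths → count (p ⊆ʳ?_) (orders n) ℕ.* (2 ℕ.+ k) ! ℕ.≤ n !
      each {p} p∈ with ∈paths⁻ p∈
      ... | l , u , _ = subst (λ j → count (p ⊆ʳ?_) (orders n) ℕ.* j ! ℕ.≤ n !) (trans (List.length-reverse p) l)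
        (count-orders (p ⊆ʳ?_) (reverse p) (unique-reverse u)
          λ {σ} p⊆ → subst (reverse p ⊆_) (List.reverse-involutive σ) (Sublist.reverse⁺ p⊆))

  -- The expected number of colours

  length-order : ∀ {σ} → σ ∈ orders n → length σ ≡ n
  length-order σ∈ = words-length (allFin n) n (proj₁ (∈-filter⁻ unique? σ∈))

  -- Orders with few colours contribute at most k + 1 each. The others contribute at most `n` each,
  -- and the hypothesis makes them so rare that together they add at most `A` to the average.
  total-colours-≤ : ∀ k A → n ℕ.* numPaths G (2 ℕ.+ k) ℕ.≤ A ℕ.* suc k ! →
                    sum (map (coloursUsed G) (orders n)) ℕ.≤ n ! ℕ.* (suc k ℕ.+ A)
  total-colours-≤ k A h = begin
    sum (map (coloursUsed G) (orders n))
      ≤⟨ sum-≤-counts few? many? (coloursUsed G) (orders n) (λ _ few → few)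
           (λ {σ} σ∈ _ → ℕ.≤-trans (coloursUsed-≤ G σ) (ℕ.≤-reflexive (length-order σ∈)))
           (λ _ ¬few ¬many → contradiction (ℕ.≰⇒> ¬few) ¬many) ⟩
    count few? (orders n) ℕ.* suc k ℕ.+ count many? (orders n) ℕ.* n
      ≤⟨ ℕ.+-mono-≤ (ℕ.*-monoˡ-≤ (suc k) (ℕ.≤-trans (List.length-filter few? (orders n)) (length-orders {n}))) rare ⟩
    n ! ℕ.* suc k ℕ.+ n ! ℕ.* A
      ≡⟨ ℕ.*-distribˡ-+ (n !) (suc k) A ⟨
    n ! ℕ.* (suc k ℕ.+ A) ∎
    where
    open ℕ.≤-Reasoning
    open import Algebra.Properties.CommutativeSemigroup ℕ.*-commutativeSemigroup
    instance _ = suc k ℕ.!≢0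
    few? : Decidable (λ σ → coloursUsed G σ ℕ.≤ suc k)
    few? σ = coloursUsed G σ ℕ.≤? suc k
    many? : Decidable (λ σ → 2 ℕ.+ k ℕ.≤ coloursUsed G σ)
    many? σ = 2 ℕ.+ k ℕ.≤? coloursUsed G σ
    rare : count many? (orders n) ℕ.* n ℕ.≤ n ! ℕ.* A
    rare = ℕ.*-cancelˡ-≤ (suc k !) (begin
      suc k ! ℕ.* (count many? (orders n) ℕ.* n)      ≡⟨ x∙yz≈yx∙z (suc k !) (count many? (orders n)) n ⟩
      count many? (orders n) ℕ.* suc k ! ℕ.* n        ≤⟨ ℕ.*-monoˡ-≤ n (count-many-colours k) ⟩
      numPaths G (2 ℕ.+ k) ℕ.* n ! ℕ.* n              ≡⟨ xy∙z≈y∙zx (numPaths G (2 ℕ.+ k)) (n !) n ⟩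
      n ! ℕ.* (n ℕ.* numPaths G (2 ℕ.+ k))            ≤⟨ ℕ.*-monoʳ-≤ (n !) h ⟩
      n ! ℕ.* (A ℕ.* suc k !)                         ≡⟨ x∙yz≈z∙xy (n !) A (suc k !) ⟩
      suc k ! ℕ.* (n ! ℕ.* A)                         ∎)

  total-colours-≤-n : sum (map (coloursUsed G) (orders n)) ℕ.≤ n ! ℕ.* n
  total-colours-≤-n = ℕ.≤-trans
    (sum-≤-length (coloursUsed G) (orders n)
      (λ {σ} σ∈ → ℕ.≤-trans (coloursUsed-≤ G σ) (ℕ.≤-reflexive (length-order σ∈))))
    (ℕ.*-monoˡ-≤ n (length-orders {n}))

  expectedColours-≤ : ∀ m → sum (map (coloursUsed G) (orders n)) ℕ.≤ n ! ℕ.* m → expectedColours G ℚ.≤ fromℕ m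
  expectedColours-≤ m = /-≤ (sum (map (coloursUsed G) (orders n))) (n !)
    where
    instance _ = n ℕ.!≢0
    -- A general denominator can be matched as a successor, which `n !` is not.
    /-≤ : ∀ s d .{{_ : ℕ.NonZero d}} → s ℕ.≤ d ℕ.* m → (+ s) ℚ./ d ℚ.≤ fromℕ m
    /-≤ s (suc d) h = ℚ.toℚᵘ-cancel-≤ (ℚᵘ.≤-respˡ-≃ (ℚᵘ.≃-sym (ℚ.toℚᵘ-fromℚᵘ (ℚᵘ.mkℚᵘ (+ s) d)))
      (ℚᵘ.*≤* (subst₂ ℤ._≤_ (sym (ℤ.*-identityʳ (+ s))) (trans (cong +_ (ℕ.*-comm (suc d) m)) (ℤ.pos-* m (suc d))) (ℤ.+≤+ h))))

-- Factorials

-- Pascal's rule cleared of denominators; the claim is that a binomial coefficient is at most 2^(m +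
-- n).
[m+n]!≤2^[m+n]m!n! : ∀ m n → (m ℕ.+ n) ! ℕ.≤ 2 ℕ.^ (m ℕ.+ n) ℕ.* (m ! ℕ.* n !)
[m+n]!≤2^[m+n]m!n! zero n = begin
  n !                           ≡⟨ ℕ.*-identityˡ (n !) ⟨
  1 ℕ.* n !                     ≤⟨ ℕ.*-mono-≤ (ℕ.m^n>0 2 n) (ℕ.≤-reflexive (sym (ℕ.*-identityˡ (n !)))) ⟩
  2 ℕ.^ n ℕ.* (1 ℕ.* n !)       ∎
  where open ℕ.≤-Reasoning
[m+n]!≤2^[m+n]m!n! (suc m) zero rewrite ℕ.+-identityʳ m = begin
  suc m !                                     ≡⟨ ℕ.*-identityˡ (suc m !) ⟨
  1 ℕ.* suc m !                               ≤⟨ ℕ.*-mono-≤ (ℕ.m^n>0 2 (suc m)) (ℕ.≤-reflexive (sym (ℕ.*-identityʳ (suc m !)))) ⟩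
  2 ℕ.^ suc m ℕ.* (suc m ! ℕ.* 1)             ∎
  where open ℕ.≤-Reasoning
[m+n]!≤2^[m+n]m!n! (suc m) (suc n) = begin
  (suc m ℕ.+ suc n) ℕ.* (m ℕ.+ suc n) !
    ≡⟨ ℕ.*-distribʳ-+ ((m ℕ.+ suc n) !) (suc m) (suc n) ⟩
  suc m ℕ.* (m ℕ.+ suc n) ! ℕ.+ suc n ℕ.* (m ℕ.+ suc n) !
    ≤⟨ ℕ.+-mono-≤ (ℕ.*-monoʳ-≤ (suc m) ([m+n]!≤2^[m+n]m!n! m (suc n)))
                  (ℕ.*-monoʳ-≤ (suc n) (subst (λ k → k ! ℕ.≤ 2 ℕ.^ k ℕ.* (suc m ! ℕ.* n !)) (sym (ℕ.+-suc m n)) ([m+n]!≤2^[m+n]m!n! (suc m) n))) ⟩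
  suc m ℕ.* (p ℕ.* (m ! ℕ.* (suc n ℕ.* n !))) ℕ.+ suc n ℕ.* (p ℕ.* ((suc m ℕ.* m !) ℕ.* n !))
    ≡⟨ ℕ-solve 5 (λ a b p x y → a ⊗ (p ⊗ (x ⊗ (b ⊗ y))) ⊕ b ⊗ (p ⊗ ((a ⊗ x) ⊗ y))
                                ⊜ (p ⊕ (p ⊕ κ 0)) ⊗ ((a ⊗ x) ⊗ (b ⊗ y))) refl (suc m) (suc n) p (m !) (n !) ⟩
  (p ℕ.+ (p ℕ.+ 0)) ℕ.* (suc m ! ℕ.* suc n !) ∎
  where
  open ℕ.≤-Reasoning
  p = 2 ℕ.^ (m ℕ.+ suc n)

m!m^n≤[m+n]! : ∀ m n → m ! ℕ.* m ℕ.^ n ℕ.≤ (m ℕ.+ n) !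
m!m^n≤[m+n]! m zero    = ℕ.≤-reflexive (trans (ℕ.*-identityʳ (m !)) (cong _! (sym (ℕ.+-identityʳ m))))
m!m^n≤[m+n]! m (suc n) rewrite ℕ.+-suc m n = begin
  m ! ℕ.* (m ℕ.* m ℕ.^ n)                ≡⟨ x∙yz≈y∙xz (m !) m (m ℕ.^ n) ⟩
  m ℕ.* (m ! ℕ.* m ℕ.^ n)                ≤⟨ ℕ.*-mono-≤ (ℕ.m≤n⇒m≤1+n (ℕ.m≤m+n m n)) (m!m^n≤[m+n]! m n) ⟩
  suc (m ℕ.+ n) ℕ.* (m ℕ.+ n) !          ∎
  where
  open ℕ.≤-Reasoning
  open import Algebra.Properties.CommutativeSemigroup ℕ.*-commutativeSemigroup

^-distrib-* : ∀ i m n → (m ℕ.* n) ℕ.^ i ≡ m ℕ.^ i ℕ.* n ℕ.^ i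
^-distrib-* zero    m n = refl
^-distrib-* (suc i) m n = trans (cong (m ℕ.* n ℕ.*_) (^-distrib-* i m n)) (interchange m n (m ℕ.^ i) (n ℕ.^ i))
  where open import Algebra.Properties.CommutativeSemigroup ℕ.*-commutativeSemigroup

-- With M = 4 m, the two preceding factorial estimates give M^i at most 2^M 2^i i!, and halving the
-- base removes 2^i. The base 2 m, rather than m, later provides the geometric decay of the
-- exponential series.
[2m]^i≤16^m*i! : ∀ m i → (2 ℕ.* m) ℕ.^ i ℕ.≤ 16 ℕ.^ m ℕ.* i !
[2m]^i≤16^m*i! m i = ℕ.*-cancelˡ-≤ (2 ℕ.^ i) {{ℕ.m^n≢0 2 i}} $ ℕ.*-cancelˡ-≤ (M !) {{M ℕ.!≢0}} (begin
  M ! ℕ.* (2 ℕ.^ i ℕ.* (2 ℕ.* m) ℕ.^ i)       ≡⟨ cong (M ! ℕ.*_) (^-distrib-* i 2 (2 ℕ.* m)) ⟨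
  M ! ℕ.* (2 ℕ.* (2 ℕ.* m)) ℕ.^ i             ≡⟨ cong (λ k → M ! ℕ.* k ℕ.^ i) (ℕ.*-assoc 2 2 m) ⟨
  M ! ℕ.* M ℕ.^ i                             ≤⟨ m!m^n≤[m+n]! M i ⟩
  (M ℕ.+ i) !                                 ≤⟨ [m+n]!≤2^[m+n]m!n! M i ⟩
  2 ℕ.^ (M ℕ.+ i) ℕ.* (M ! ℕ.* i !)           ≡⟨ cong (ℕ._* (M ! ℕ.* i !)) (ℕ.^-distribˡ-+-* 2 M i) ⟩
  2 ℕ.^ M ℕ.* 2 ℕ.^ i ℕ.* (M ! ℕ.* i !)       ≡⟨ cong (λ k → k ℕ.* 2 ℕ.^ i ℕ.* (M ! ℕ.* i !)) (ℕ.^-*-assoc 2 4 m) ⟨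
  16 ℕ.^ m ℕ.* 2 ℕ.^ i ℕ.* (M ! ℕ.* i !)      ≡⟨ ℕ-solve 4 (λ a b c d → a ⊗ b ⊗ (c ⊗ d) ⊜ c ⊗ (b ⊗ (a ⊗ d))) refl (16 ℕ.^ m) (2 ℕ.^ i) (M !) (i !) ⟩
  M ! ℕ.* (2 ℕ.^ i ℕ.* (16 ℕ.^ m ℕ.* i !))    ∎)
  where
  open ℕ.≤-Reasoning
  M = 4 ℕ.* m

n<2^n : ∀ n → n ℕ.< 2 ℕ.^ n
n<2^n zero    = s≤s z≤n
n<2^n (suc n) = ℕ.+-mono-≤ (ℕ.m^n>0 2 n) (ℕ.≤-trans (n<2^n n) (ℕ.≤-reflexive (sym (ℕ.+-identityʳ (2 ℕ.^ n)))))

floor-log : ∀ b n → ∃[ l ] (2 ℕ.+ b) ℕ.^ l ℕ.≤ suc n × suc n ℕ.< (2 ℕ.+ b) ℕ.^ suc l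
floor-log b zero = 0 , s≤s z≤n , s≤s (s≤s z≤n)
floor-log b (suc n) with floor-log b n
... | l , ≤n , n< with suc (suc n) ℕ.<? (2 ℕ.+ b) ℕ.^ suc l
...   | yes n+1< = l , ℕ.m≤n⇒m≤1+n ≤n , n+1<
...   | no  n+1≮ = suc l , ℕ.≮⇒≥ n+1≮ , ℕ.≤-<-trans n< (ℕ.^-monoʳ-< (2 ℕ.+ b) (s≤s (s≤s z≤n)) (ℕ.n<1+n (suc l)))

u^u≤[u+u]! : ∀ u → u ℕ.^ u ℕ.≤ (u ℕ.+ u) !
u^u≤[u+u]! u = ℕ.≤-trans (ℕ.m≤n*m (u ℕ.^ u) (u !) {{u ℕ.!≢0}}) (m!m^n≤[m+n]! u u)

-- For l < 4^(μ+1), t = Θ(l / log l) and t ≥ 2^μ; with a large constant K and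
-- u = Kt, already (2u)! ≥ u^u ≥ (K 2^μ)^u outweighs 2^(d l + 2 s u).
module Scale (d s l μ : ℕ) (≤l : 4 ℕ.^ μ ℕ.≤ l) where
  E K : ℕ
  E = 2 ℕ.* s ℕ.+ d
  K = 2 ℕ.^ E
  open ℕ.≤-Reasoning
  t u : ℕ
  -- Rounding up ensures l ≤ t (μ + 1). The excess is at most μ + 1, hence at most l, so t (μ + 1) ≤
  -- 2 l.
  t = suc (l / suc μ)
  u = K ℕ.* t
  μ<l : suc μ ℕ.≤ l
  μ<l = ℕ.≤-trans (n<2^n μ) (ℕ.≤-trans (ℕ.^-monoˡ-≤ μ {2} {4} (s≤s (s≤s z≤n))) ≤l)
  tμ≤ : t ℕ.* suc μ ℕ.≤ 2 ℕ.* l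
  tμ≤ = begin
    suc μ ℕ.+ l / suc μ ℕ.* suc μ       ≤⟨ ℕ.+-mono-≤ μ<l (m/n*n≤m l (suc μ)) ⟩
    l ℕ.+ l                             ≡⟨ cong (l ℕ.+_) (ℕ.+-identityʳ l) ⟨
    2 ℕ.* l                             ∎
  l≤tμ : l ℕ.≤ t ℕ.* suc μ
  l≤tμ = ℕ.≤-trans (ℕ.≤-reflexive (m≡m%n+[m/n]*n l (suc μ)))
    (ℕ.+-monoˡ-≤ (l / suc μ ℕ.* suc μ) (ℕ.<⇒≤ (m%n<n l (suc μ))))
  -- This is the reason for base 4: of the two factors 2^μ in 4^μ, one pays for μ + 1 and the other
  -- is left for `t`.
  2^μ≤t : 2 ℕ.^ μ ℕ.≤ t
  2^μ≤t = ℕ.*-cancelʳ-≤ (2 ℕ.^ μ) t (2 ℕ.^ μ) {{ℕ.m^n≢0 2 μ}} (begin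
    2 ℕ.^ μ ℕ.* 2 ℕ.^ μ      ≡⟨ ^-distrib-* μ 2 2 ⟨
    4 ℕ.^ μ                  ≤⟨ ≤l ⟩
    l                        ≤⟨ l≤tμ ⟩
    t ℕ.* suc μ              ≤⟨ ℕ.*-monoʳ-≤ t (n<2^n μ) ⟩
    t ℕ.* 2 ℕ.^ μ            ∎)
  few : suc μ ℕ.* (u ℕ.+ u) ℕ.≤ 4 ℕ.* K ℕ.* l
  few = begin
    suc μ ℕ.* (K ℕ.* t ℕ.+ K ℕ.* t)      ≡⟨ ℕ-solve 3 (λ m k t → m ⊗ (k ⊗ t ⊕ k ⊗ t) ⊜ κ 2 ⊗ k ⊗ (t ⊗ m)) refl (suc μ) K t ⟩
    2 ℕ.* K ℕ.* (t ℕ.* suc μ)            ≤⟨ ℕ.*-monoʳ-≤ (2 ℕ.* K) tμ≤ ⟩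
    2 ℕ.* K ℕ.* (2 ℕ.* l)                ≡⟨ ℕ-solve 2 (λ k l → κ 2 ⊗ k ⊗ (κ 2 ⊗ l) ⊜ κ 4 ⊗ k ⊗ l) refl K l ⟩
    4 ℕ.* K ℕ.* l                        ∎
  -- By l ≤ t (μ + 1), the term d l is at most d t + μ d t. The first part joins 2 s u to form
  -- `E * u` by t ≤ u; the second is at most μ u because `K` also dominates `d`.
  exponent : d ℕ.* l ℕ.+ s ℕ.* (u ℕ.+ u) ℕ.≤ (E ℕ.+ μ) ℕ.* u
  exponent = begin
    d ℕ.* l ℕ.+ s ℕ.* (u ℕ.+ u)
      ≤⟨ ℕ.+-monoˡ-≤ (s ℕ.* (u ℕ.+ u)) (ℕ.*-monoʳ-≤ d l≤tμ) ⟩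
    d ℕ.* (t ℕ.* suc μ) ℕ.+ s ℕ.* (u ℕ.+ u)
      ≡⟨ ℕ-solve 5 (λ d t m s u → d ⊗ (t ⊗ (κ 1 ⊕ m)) ⊕ s ⊗ (u ⊕ u) ⊜ d ⊗ t ⊕ (κ 2 ⊗ s ⊗ u ⊕ m ⊗ (d ⊗ t))) refl d t μ s u ⟩
    d ℕ.* t ℕ.+ (2 ℕ.* s ℕ.* u ℕ.+ μ ℕ.* (d ℕ.* t))
      ≤⟨ ℕ.+-mono-≤ (ℕ.*-monoʳ-≤ d t≤u) (ℕ.+-monoʳ-≤ (2 ℕ.* s ℕ.* u) (ℕ.*-monoʳ-≤ μ (ℕ.*-monoˡ-≤ t d≤K))) ⟩
    d ℕ.* u ℕ.+ (2 ℕ.* s ℕ.* u ℕ.+ μ ℕ.* u)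
      ≡⟨ ℕ-solve 4 (λ d m s u → d ⊗ u ⊕ (κ 2 ⊗ s ⊗ u ⊕ m ⊗ u) ⊜ (κ 2 ⊗ s ⊕ d ⊕ m) ⊗ u) refl d μ s u ⟩
    (E ℕ.+ μ) ℕ.* u ∎
    where
    d≤K : d ℕ.≤ K
    d≤K = ℕ.≤-trans (ℕ.m≤n+m d (2 ℕ.* s)) (ℕ.<⇒≤ (n<2^n E))
    t≤u : t ℕ.≤ u
    t≤u = ℕ.m≤n*m t K {{ℕ.m^n≢0 2 E}}
  large : 2 ℕ.^ (d ℕ.* l ℕ.+ s ℕ.* (u ℕ.+ u)) ℕ.≤ (u ℕ.+ u) !
  large = begin
    2 ℕ.^ (d ℕ.* l ℕ.+ s ℕ.* (u ℕ.+ u))      ≤⟨ ℕ.^-monoʳ-≤ 2 exponent ⟩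
    2 ℕ.^ ((E ℕ.+ μ) ℕ.* u)                  ≡⟨ ℕ.^-*-assoc 2 (E ℕ.+ μ) u ⟨
    (2 ℕ.^ (E ℕ.+ μ)) ℕ.^ u                  ≡⟨ cong (ℕ._^ u) (ℕ.^-distribˡ-+-* 2 E μ) ⟩
    (K ℕ.* 2 ℕ.^ μ) ℕ.^ u                    ≤⟨ ℕ.^-monoˡ-≤ u (ℕ.*-monoʳ-≤ K 2^μ≤t) ⟩
    u ℕ.^ u                                  ≤⟨ u^u≤[u+u]! u ⟩
    (u ℕ.+ u) !                              ∎
  1≤u+u : 1 ℕ.≤ u ℕ.+ u
  1≤u+u = ℕ.≤-trans (ℕ.*-mono-≤ (ℕ.m^n>0 2 E) (s≤s {n = l / suc μ} z≤n)) (ℕ.m≤m+n u u)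

-- Chooses the threshold for the number of colours. With `l` about log2 n, the part d l of the
-- exponent pays for a power of n, the part s (k + 1) for b^k, and `suc μ` stands for log log n. The
-- constant `c` is fixed before `l`.
factorial-scale : ∀ d s → ∃[ c ] ∀ l → 1 ℕ.≤ l → ∃[ μ ] ∃[ k ]
  l ℕ.< 4 ℕ.^ suc μ × suc μ ℕ.≤ l × suc μ ℕ.* suc k ℕ.≤ c ℕ.* l ×
  2 ℕ.^ (d ℕ.* l ℕ.+ s ℕ.* suc k) ℕ.≤ suc k !
factorial-scale d s = 4 ℕ.* 2 ℕ.^ (2 ℕ.* s ℕ.+ d) , λ where
  l@(suc l′) _ →
    let μ , ≤l , l< = floor-log 2 l′
        open Scale d s l μ ≤l
        k , k+1≡ = ℕ.m≤n⇒∃[o]m+o≡n 1≤u+u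
    in μ , k , l< , μ<l ,
       subst (λ v → suc μ ℕ.* v ℕ.≤ 4 ℕ.* K ℕ.* l) (sym k+1≡) few ,
       subst (λ v → 2 ℕ.^ (d ℕ.* l ℕ.+ s ℕ.* v) ℕ.≤ v !) (sym k+1≡) large

-- Bounds on exponentials and logarithms

open ℚ.≤-Reasoning

fromℕ-^ : ∀ m k → fromℕ (m ℕ.^ k) ≡ fromℕ m ^ k
fromℕ-^ m zero    = refl
fromℕ-^ m (suc k) = trans (fromℕ-* m (m ℕ.^ k)) (cong (fromℕ m *_) (fromℕ-^ m k))

*-monoʳ : ∀ {p r s} → 0ℚ ≤ p → r ≤ s → r * p ≤ s * p
*-monoʳ {p} 0≤p = ℚ.*-monoʳ-≤-nonNeg p {{ℚ.nonNegative 0≤p}}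

∣*∣≤ : ∀ p q {r s} → ∣ p ∣ ≤ r → ∣ q ∣ ≤ s → ∣ p * q ∣ ≤ r * s
∣*∣≤ p q {r} {s} p≤r q≤s = subst (_≤ r * s) (sym (ℚ.∣p*q∣≡∣p∣*∣q∣ p q))
  (*-mono-≤ (ℚ.0≤∣p∣ p) p≤r (ℚ.0≤∣p∣ q) q≤s)

∣/!∣≤ : ∀ {x} m → ∣ x ∣ ≤ fromℕ m → ∀ i → ∣ 1/! i * x ^ i ∣ ≤ fromℕ (16 ℕ.^ m) * ½ ^ i
∣/!∣≤ {x} m x≤m i = *-cancelˡ (0<i! i) (begin
  fromℕ (i !) * ∣ 1/! i * x ^ i ∣                ≡⟨ cong (fromℕ (i !) *_) (ℚ.∣p*q∣≡∣p∣*∣q∣ (1/! i) (x ^ i)) ⟩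
  fromℕ (i !) * (∣ 1/! i ∣ * ∣ x ^ i ∣)          ≡⟨ cong (λ u → fromℕ (i !) * (u * ∣ x ^ i ∣)) (ℚ.0≤p⇒∣p∣≡p (<⇒≤ (0<inv (0<i! i)))) ⟩
  fromℕ (i !) * (1/! i * ∣ x ^ i ∣)              ≡⟨ ℚ.*-assoc (fromℕ (i !)) (1/! i) (∣ x ^ i ∣) ⟨
  fromℕ (i !) * 1/! i * ∣ x ^ i ∣                ≡⟨ cong (_* ∣ x ^ i ∣) (inv-inverse (0<i! i)) ⟩
  1ℚ * ∣ x ^ i ∣                                 ≡⟨ ℚ.*-identityˡ (∣ x ^ i ∣) ⟩
  ∣ x ^ i ∣                                      ≤⟨ ∣^∣≤ x x≤m i ⟩
  fromℕ m ^ i                                    ≡⟨ fromℕ^≡ m i ⟩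
  fromℕ ((m ℕ.+ m) ℕ.^ i) * ½ ^ i                ≤⟨ *-monoʳ (0≤^ (ℚ.nonNegative⁻¹ ½) i) (fromℕ-mono
                                                      (subst (λ k → (m ℕ.+ k) ℕ.^ i ℕ.≤ 16 ℕ.^ m ℕ.* i !) (ℕ.+-identityʳ m) ([2m]^i≤16^m*i! m i))) ⟩
  fromℕ (16 ℕ.^ m ℕ.* i !) * ½ ^ i               ≡⟨ cong (_* ½ ^ i) (fromℕ-* (16 ℕ.^ m) (i !)) ⟩
  fromℕ (16 ℕ.^ m) * fromℕ (i !) * ½ ^ i         ≡⟨ solve 3 (λ a b c → a :* b :* c := b :* (a :* c)) refl (fromℕ (16 ℕ.^ m)) (fromℕ (i !)) (½ ^ i) ⟩
  fromℕ (i !) * (fromℕ (16 ℕ.^ m) * ½ ^ i)       ∎)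

module Halving = Geometric ½ (ℚ.positive⁻¹ ½) (ℚ.nonNegative⁻¹ ½)

-- The terms are dominated by 16^m times a geometric series of sum 2, uniformly in `n`. Any bound
-- exponential in `m` would serve: for m = O(log n) it is a power of n.
∣partialExp∣≤ : ∀ {x} m → ∣ x ∣ ≤ fromℕ m → ∀ n → ∣ partialSum 1/! n x ∣ ≤ fromℕ (2 ℕ.* 16 ℕ.^ m)
∣partialExp∣≤ {x} m x≤m n = begin
  ∣ partialSum 1/! n x ∣                    ≤⟨ go n ⟩
  fromℕ (16 ℕ.^ m) * Halving.geo n          ≤⟨ *-monoˡ (0≤fromℕ (16 ℕ.^ m)) (Halving.geo-bound n) ⟩
  fromℕ (16 ℕ.^ m) * fromℕ 2                ≡⟨ ℚ.*-comm (fromℕ (16 ℕ.^ m)) (fromℕ 2) ⟩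
  fromℕ 2 * fromℕ (16 ℕ.^ m)                ≡⟨ fromℕ-* 2 (16 ℕ.^ m) ⟨
  fromℕ (2 ℕ.* 16 ℕ.^ m)                    ∎
  where
  go : ∀ n → ∣ partialSum 1/! n x ∣ ≤ fromℕ (16 ℕ.^ m) * Halving.geo n
  go zero    = ≤-reflexive (sym (ℚ.*-zeroʳ (fromℕ (16 ℕ.^ m))))
  go (suc n) = begin
    ∣ partialSum 1/! n x + 1/! n * x ^ n ∣                       ≤⟨ ℚ.∣p+q∣≤∣p∣+∣q∣ (partialSum 1/! n x) (1/! n * x ^ n) ⟩
    ∣ partialSum 1/! n x ∣ + ∣ 1/! n * x ^ n ∣                   ≤⟨ ℚ.+-mono-≤ (go n) (∣/!∣≤ m x≤m n) ⟩
    fromℕ (16 ℕ.^ m) * Halving.geo n + fromℕ (16 ℕ.^ m) * ½ ^ n  ≡⟨ ℚ.*-distribˡ-+ (fromℕ (16 ℕ.^ m)) (Halving.geo n) (½ ^ n) ⟨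
    fromℕ (16 ℕ.^ m) * Halving.geo (suc n)                       ∎

-- Finite sums and the odd harmonic series

∑-+ : ∀ m k f → ∑ (m ℕ.+ k) f ≡ ∑ m f + ∑ k (λ j → f (m ℕ.+ j))
∑-+ m zero    f = trans (cong (λ i → ∑ i f) (ℕ.+-identityʳ m)) (sym (ℚ.+-identityʳ (∑ m f)))
∑-+ m (suc k) f = trans (cong (λ i → ∑ i f) (ℕ.+-suc m k))
  (trans (cong (_+ f (m ℕ.+ k)) (∑-+ m k f)) (ℚ.+-assoc (∑ m f) (∑ k (λ j → f (m ℕ.+ j))) (f (m ℕ.+ k))))

∑-mono : ∀ n {f g : ℕ → ℚ} → (∀ i → i ℕ.< n → f i ≤ g i) → ∑ n f ≤ ∑ n g
∑-mono zero    h = ≤-refl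
∑-mono (suc n) h = ℚ.+-mono-≤ (∑-mono n λ i i<n → h i (ℕ.m≤n⇒m≤1+n i<n)) (h n ℕ.≤-refl)

∑-const : ∀ n c → ∑ n (λ _ → c) ≡ fromℕ n * c
∑-const zero    c = sym (ℚ.*-zeroˡ c)
∑-const (suc n) c = begin-equality
  ∑ n (λ _ → c) + c      ≡⟨ cong (_+ c) (∑-const n c) ⟩
  fromℕ n * c + c        ≡⟨ solve 2 (λ n c → n :* c :+ c := (con 1ℚ :+ n) :* c) refl (fromℕ n) c ⟩
  (1ℚ + fromℕ n) * c     ≡⟨ cong (_* c) (fromℕ-+ 1 n) ⟨
  fromℕ (suc n) * c      ∎

∑-*ˡ : ∀ n c f → ∑ n (λ i → c * f i) ≡ c * ∑ n f
∑-*ˡ zero    c f = sym (ℚ.*-zeroʳ c)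
∑-*ˡ (suc n) c f = trans (cong (_+ c * f n) (∑-*ˡ n c f)) (sym (ℚ.*-distribˡ-+ c (∑ n f) (f n)))

0≤∑ : ∀ n {f} → (∀ i → 0ℚ ≤ f i) → 0ℚ ≤ ∑ n f
0≤∑ zero    h = ≤-refl
0≤∑ (suc n) h = 0≤+ (0≤∑ n h) (h n)

∑-length-mono : ∀ {m n} {f : ℕ → ℚ} → (∀ i → 0ℚ ≤ f i) → m ℕ.≤ n → ∑ m f ≤ ∑ n f
∑-length-mono {m} {f = f} h m≤n with ℕ.m≤n⇒∃[o]m+o≡n m≤n
... | k , refl = begin
  ∑ m f                                     ≡⟨ ℚ.+-identityʳ (∑ m f) ⟨
  ∑ m f + 0ℚ                                ≤⟨ ℚ.+-monoʳ-≤ (∑ m f) (0≤∑ k (λ j → h (m ℕ.+ j))) ⟩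
  ∑ m f + ∑ k (λ j → f (m ℕ.+ j))           ≡⟨ ∑-+ m k f ⟨
  ∑ (m ℕ.+ k) f                             ∎

0≤1/odd : ∀ i → 0ℚ ≤ 1/odd i
0≤1/odd i = <⇒≤ (0<1/odd i)

-- Doubling the length from M to 2 M adds M terms of at most 1/M, so at most 1.
∑1/odd≤ : ∀ m → ∑ (2 ℕ.^ m) 1/odd ≤ fromℕ (suc m)
∑1/odd≤ zero    = ≤-refl
∑1/odd≤ (suc m) = begin
  ∑ (M ℕ.+ (M ℕ.+ 0)) 1/odd                     ≡⟨ cong (λ k → ∑ (M ℕ.+ k) 1/odd) (ℕ.+-identityʳ M) ⟩
  ∑ (M ℕ.+ M) 1/odd                             ≡⟨ ∑-+ M M 1/odd ⟩
  ∑ M 1/odd + ∑ M (λ j → 1/odd (M ℕ.+ j))       ≤⟨ ℚ.+-mono-≤ (∑1/odd≤ m) (∑-mono M λ j _ → inv-antitone 0<M (fromℕ-mono (M≤ j))) ⟩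
  fromℕ (suc m) + ∑ M (λ _ → inv (fromℕ M))     ≡⟨ cong (λ u → fromℕ (suc m) + u) (trans (∑-const M (inv (fromℕ M))) (inv-inverse 0<M)) ⟩
  fromℕ (suc m) + 1ℚ                            ≡⟨ trans (ℚ.+-comm (fromℕ (suc m)) 1ℚ) (sym (fromℕ-+ 1 (suc m))) ⟩
  fromℕ (suc (suc m))                           ∎
  where
  M = 2 ℕ.^ m
  0<M : 0ℚ < fromℕ M
  0<M = 0<fromℕ M {{ℕ.m^n≢0 2 m}}
  M≤ : ∀ j → M ℕ.≤ suc ((M ℕ.+ j) ℕ.+ (M ℕ.+ j))
  M≤ j = ℕ.m≤n⇒m≤1+n (ℕ.≤-trans (ℕ.m≤m+n M j) (ℕ.m≤m+n (M ℕ.+ j) (M ℕ.+ j)))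

-- Doubling the length from M to 2 M adds M terms of at least 1/(4 M), so at least a quarter.
∑1/odd≥ : ∀ m → fromℕ m ≤ fromℕ 4 * ∑ (2 ℕ.^ m) 1/odd
∑1/odd≥ zero    = 0≤* (0≤fromℕ 4) (0≤∑ 1 0≤1/odd)
∑1/odd≥ (suc m) = begin
  fromℕ (suc m)                                      ≡⟨ trans (fromℕ-+ 1 m) (ℚ.+-comm 1ℚ (fromℕ m)) ⟩
  fromℕ m + 1ℚ                                       ≡⟨ cong (λ u → fromℕ m + u) (inv-inverse 0<4M) ⟨
  fromℕ m + fromℕ (4 ℕ.* M) * inv (fromℕ (4 ℕ.* M))  ≡⟨ cong (λ u → fromℕ m + u * inv (fromℕ (4 ℕ.* M))) (fromℕ-* 4 M) ⟩
  fromℕ m + fromℕ 4 * fromℕ M * inv (fromℕ (4 ℕ.* M))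
    ≡⟨ cong (λ u → fromℕ m + u) (ℚ.*-assoc (fromℕ 4) (fromℕ M) (inv (fromℕ (4 ℕ.* M)))) ⟩
  fromℕ m + fromℕ 4 * (fromℕ M * inv (fromℕ (4 ℕ.* M)))
    ≡⟨ cong (λ u → fromℕ m + fromℕ 4 * u) (∑-const M (inv (fromℕ (4 ℕ.* M)))) ⟨
  fromℕ m + fromℕ 4 * ∑ M (λ _ → inv (fromℕ (4 ℕ.* M)))
    ≤⟨ ℚ.+-mono-≤ (∑1/odd≥ m) (*-monoˡ (0≤fromℕ 4) (∑-mono M λ j j<M → inv-antitone (fromℕ-suc-pos _) (fromℕ-mono (≤4M j j<M)))) ⟩
  fromℕ 4 * ∑ M 1/odd + fromℕ 4 * ∑ M (λ j → 1/odd (M ℕ.+ j))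
    ≡⟨ ℚ.*-distribˡ-+ (fromℕ 4) (∑ M 1/odd) (∑ M (λ j → 1/odd (M ℕ.+ j))) ⟨
  fromℕ 4 * (∑ M 1/odd + ∑ M (λ j → 1/odd (M ℕ.+ j)))
    ≡⟨ cong (fromℕ 4 *_) (∑-+ M M 1/odd) ⟨
  fromℕ 4 * ∑ (M ℕ.+ M) 1/odd
    ≡⟨ cong (λ k → fromℕ 4 * ∑ (M ℕ.+ k) 1/odd) (ℕ.+-identityʳ M) ⟨
  fromℕ 4 * ∑ (M ℕ.+ (M ℕ.+ 0)) 1/odd ∎
  where
  M = 2 ℕ.^ m
  0<4M : 0ℚ < fromℕ (4 ℕ.* M)
  0<4M = 0<fromℕ (4 ℕ.* M) {{ℕ.m*n≢0 4 M {{_}} {{ℕ.m^n≢0 2 m}}}}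
  ≤4M : ∀ j → j ℕ.< M → suc ((M ℕ.+ j) ℕ.+ (M ℕ.+ j)) ℕ.≤ 4 ℕ.* M
  ≤4M j j<M = ℕ.≤-trans
    (ℕ.≤-trans (ℕ.≤-reflexive (sym (ℕ.+-suc (M ℕ.+ j) (M ℕ.+ j))))
      (ℕ.+-mono-≤ (ℕ.+-monoʳ-≤ M (ℕ.<⇒≤ j<M)) (subst (ℕ._≤ M ℕ.+ M) (ℕ.+-suc M j) (ℕ.+-monoʳ-≤ M j<M))))
    (ℕ.≤-reflexive (ℕ-solve 1 (λ M → (M ⊕ M) ⊕ (M ⊕ M) ⊜ κ 4 ⊗ M) refl M))

-- Two-sided bounds on the partial sums of the logarithm

cayleyℚ : ℚ → ℚ
cayleyℚ x = (x - 1ℚ) * inv (x + 1ℚ)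

-- By definition, the n-th approximation of `log y` is `logℚ n` at the n-th approximation of `y`;
-- for the iterated logarithm this is used with y = log n.
logℚ : ℕ → ℚ → ℚ
logℚ n x = fromℕ 2 * (cayleyℚ x * partialSum 1/odd n (cayleyℚ x * cayleyℚ x))

0≤odd-term : ∀ {q} → 0ℚ ≤ q → ∀ i → 0ℚ ≤ 1/odd i * q ^ i
0≤odd-term 0≤q i = 0≤* (0≤1/odd i) (0≤^ 0≤q i)

^≤1 : ∀ {q} → 0ℚ ≤ q → q ≤ 1ℚ → ∀ i → q ^ i ≤ 1ℚ
^≤1 0≤q q≤1 zero    = ≤-refl
^≤1 0≤q q≤1 (suc i) = *-mono-≤ 0≤q q≤1 (0≤^ 0≤q i) (^≤1 0≤q q≤1 i)

^-+ : ∀ q m n → q ^ (m ℕ.+ n) ≡ q ^ m * q ^ n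
^-+ q zero    n = sym (ℚ.*-identityˡ (q ^ n))
^-+ q (suc m) n = trans (cong (q *_) (^-+ q m n)) (sym (ℚ.*-assoc q (q ^ m) (q ^ n)))

[1-q]*∑ : ∀ q n → (1ℚ - q) * ∑ n (q ^_) ≡ 1ℚ - q ^ n
[1-q]*∑ q zero    = ℚ.*-zeroʳ (1ℚ - q)
[1-q]*∑ q (suc n) = begin-equality
  (1ℚ - q) * (∑ n (q ^_) + q ^ n)               ≡⟨ ℚ.*-distribˡ-+ (1ℚ - q) (∑ n (q ^_)) (q ^ n) ⟩
  (1ℚ - q) * ∑ n (q ^_) + (1ℚ - q) * q ^ n      ≡⟨ cong (_+ (1ℚ - q) * q ^ n) ([1-q]*∑ q n) ⟩
  (1ℚ - q ^ n) + (1ℚ - q) * q ^ n               ≡⟨ solve 2 (λ q s → (con 1ℚ :- s) :+ (con 1ℚ :- q) :* s := con 1ℚ :- q :* s) refl q (q ^ n) ⟩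
  1ℚ - q ^ suc n                                ∎

bernoulli : ∀ {q} → 0ℚ ≤ q → ∀ i → 1ℚ - fromℕ i * (1ℚ - q) ≤ q ^ i
bernoulli {q} 0≤q zero    = ≤-reflexive (solve 1 (λ q → con 1ℚ :- con 0ℚ :* (con 1ℚ :- q) := con 1ℚ) refl q)
bernoulli {q} 0≤q (suc i) = begin
  1ℚ - fromℕ (suc i) * (1ℚ - q)                 ≡⟨ cong (λ u → 1ℚ - u * (1ℚ - q)) (fromℕ-+ 1 i) ⟩
  1ℚ - (1ℚ + fromℕ i) * (1ℚ - q)                ≡⟨ ℚ.+-identityʳ (1ℚ - (1ℚ + fromℕ i) * (1ℚ - q)) ⟨
  1ℚ - (1ℚ + fromℕ i) * (1ℚ - q) + 0ℚ           ≤⟨ ℚ.+-monoʳ-≤ (1ℚ - (1ℚ + fromℕ i) * (1ℚ - q)) (0≤* (0≤fromℕ i) (0≤square (1ℚ - q))) ⟩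
  1ℚ - (1ℚ + fromℕ i) * (1ℚ - q) + fromℕ i * ((1ℚ - q) * (1ℚ - q))
                                                ≡⟨ solve 2 (λ q i → con 1ℚ :- (con 1ℚ :+ i) :* (con 1ℚ :- q) :+ i :* ((con 1ℚ :- q) :* (con 1ℚ :- q))
                                                                    := q :* (con 1ℚ :- i :* (con 1ℚ :- q))) refl q (fromℕ i) ⟩
  q * (1ℚ - fromℕ i * (1ℚ - q))                 ≤⟨ *-monoˡ 0≤q (bernoulli 0≤q i) ⟩
  q ^ suc i                                     ∎
  where
  0≤square : ∀ p → 0ℚ ≤ p * p
  0≤square p with ℚ.≤-total 0ℚ p
  ... | inj₁ 0≤p = 0≤* 0≤p 0≤p
  ... | inj₂ p≤0 = subst (0ℚ ≤_) (solve 1 (λ p → (:- p) :* (:- p) := p :* p) refl p)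
                     (0≤* (ℚ.neg-antimono-≤ p≤0) (ℚ.neg-antimono-≤ p≤0))

module _ {q : ℚ} (0≤q : 0ℚ ≤ q) (q≤1 : q ≤ 1ℚ) where

  -- The first 2^m terms are bounded by harmonic ones, the others by a geometric series.
  artanh-sum-≤ : ∀ m → 1ℚ ≤ fromℕ (2 ℕ.^ m) * (1ℚ - q) → ∀ n → partialSum 1/odd n q ≤ fromℕ (2 ℕ.+ m)
  artanh-sum-≤ m 1≤ n = begin
    partialSum 1/odd n q                                              ≤⟨ ∑-length-mono (0≤odd-term 0≤q) (ℕ.m≤n+m n M) ⟩
    partialSum 1/odd (M ℕ.+ n) q                                      ≡⟨ ∑-+ M n (λ i → 1/odd i * q ^ i) ⟩
    partialSum 1/odd M q + ∑ n (λ j → 1/odd (M ℕ.+ j) * q ^ (M ℕ.+ j)) ≤⟨ ℚ.+-mono-≤ head tail ⟩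
    fromℕ (suc m) + 1ℚ                                                ≡⟨ trans (ℚ.+-comm (fromℕ (suc m)) 1ℚ) (sym (fromℕ-+ 1 (suc m))) ⟩
    fromℕ (2 ℕ.+ m)                                                   ∎
    where
    M = 2 ℕ.^ m
    0<M : 0ℚ < fromℕ M
    0<M = 0<fromℕ M {{ℕ.m^n≢0 2 m}}
    head : partialSum 1/odd M q ≤ fromℕ (suc m)
    head = ≤-trans
      (∑-mono M λ i _ → ≤-trans (*-monoˡ (0≤1/odd i) (^≤1 0≤q q≤1 i)) (≤-reflexive (ℚ.*-identityʳ (1/odd i))))
      (∑1/odd≤ m)
    geo≤ : ∑ n (q ^_) ≤ fromℕ M
    geo≤ = begin
      ∑ n (q ^_)                                ≡⟨ ℚ.*-identityˡ (∑ n (q ^_)) ⟨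
      1ℚ * ∑ n (q ^_)                           ≤⟨ *-monoʳ (0≤∑ n (0≤^ 0≤q)) 1≤ ⟩
      fromℕ M * (1ℚ - q) * ∑ n (q ^_)           ≡⟨ ℚ.*-assoc (fromℕ M) (1ℚ - q) (∑ n (q ^_)) ⟩
      fromℕ M * ((1ℚ - q) * ∑ n (q ^_))         ≡⟨ cong (fromℕ M *_) ([1-q]*∑ q n) ⟩
      fromℕ M * (1ℚ - q ^ n)                    ≤⟨ *-monoˡ (0≤fromℕ M) (ℚ.+-monoʳ-≤ 1ℚ (ℚ.neg-antimono-≤ (0≤^ 0≤q n))) ⟩
      fromℕ M * 1ℚ                              ≡⟨ ℚ.*-identityʳ (fromℕ M) ⟩
      fromℕ M                                   ∎
    tail : ∑ n (λ j → 1/odd (M ℕ.+ j) * q ^ (M ℕ.+ j)) ≤ 1ℚ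
    tail = begin
      ∑ n (λ j → 1/odd (M ℕ.+ j) * q ^ (M ℕ.+ j))
        ≤⟨ ∑-mono n (λ j _ → *-mono-≤ (0≤1/odd (M ℕ.+ j))
             (inv-antitone 0<M (fromℕ-mono (ℕ.m≤n⇒m≤1+n (ℕ.≤-trans (ℕ.m≤m+n M j) (ℕ.m≤m+n (M ℕ.+ j) (M ℕ.+ j))))))
             (0≤^ 0≤q (M ℕ.+ j)) (power≤ j)) ⟩
      ∑ n (λ j → inv (fromℕ M) * q ^ j)         ≡⟨ ∑-*ˡ n (inv (fromℕ M)) (q ^_) ⟩
      inv (fromℕ M) * ∑ n (q ^_)                ≤⟨ *-monoˡ (<⇒≤ (0<inv 0<M)) geo≤ ⟩
      inv (fromℕ M) * fromℕ M                   ≡⟨ trans (ℚ.*-comm (inv (fromℕ M)) (fromℕ M)) (inv-inverse 0<M) ⟩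
      1ℚ                                        ∎
      where
      power≤ : ∀ j → q ^ (M ℕ.+ j) ≤ q ^ j
      power≤ j = begin
        q ^ (M ℕ.+ j)        ≡⟨ ^-+ q M j ⟩
        q ^ M * q ^ j        ≤⟨ *-monoʳ (0≤^ 0≤q j) (^≤1 0≤q q≤1 M) ⟩
        1ℚ * q ^ j           ≡⟨ ℚ.*-identityˡ (q ^ j) ⟩
        q ^ j                ∎

  -- By Bernoulli's inequality, the powers in the first 2^m terms are at least ½.
  artanh-sum-≥ : ∀ m → fromℕ (2 ℕ.^ m) * (1ℚ - q) ≤ ½ → ∀ {n} → 2 ℕ.^ m ℕ.≤ n →
                 fromℕ m ≤ fromℕ 8 * partialSum 1/odd n q
  artanh-sum-≥ m small {n} M≤n = begin
    fromℕ m                                            ≤⟨ ∑1/odd≥ m ⟩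
    fromℕ 4 * ∑ M 1/odd                                ≡⟨ solve 1 (λ s → con (fromℕ 4) :* s := con (fromℕ 8) :* (con ½ :* s)) refl (∑ M 1/odd) ⟩
    fromℕ 8 * (½ * ∑ M 1/odd)                          ≡⟨ cong (fromℕ 8 *_) (∑-*ˡ M ½ 1/odd) ⟨
    fromℕ 8 * ∑ M (λ i → ½ * 1/odd i)                  ≤⟨ *-monoˡ (0≤fromℕ 8) (∑-mono M λ i i<M →
                                                             ≤-trans (*-monoʳ (0≤1/odd i) (½≤^ i i<M)) (≤-reflexive (ℚ.*-comm (q ^ i) (1/odd i)))) ⟩
    fromℕ 8 * partialSum 1/odd M q                     ≤⟨ *-monoˡ (0≤fromℕ 8) (∑-length-mono (0≤odd-term 0≤q) M≤n) ⟩
    fromℕ 8 * partialSum 1/odd n q                     ∎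
    where
    M = 2 ℕ.^ m
    ½≤^ : ∀ i → i ℕ.< M → ½ ≤ q ^ i
    ½≤^ i i<M = begin
      ½                                ≡⟨⟩
      1ℚ - ½                           ≤⟨ ℚ.+-monoʳ-≤ 1ℚ (ℚ.neg-antimono-≤ (≤-trans (*-monoʳ (p≤q⇒0≤q-p q≤1) (fromℕ-mono (ℕ.<⇒≤ i<M))) small)) ⟩
      1ℚ - fromℕ i * (1ℚ - q)          ≤⟨ bernoulli 0≤q i ⟩
      q ^ i                            ∎

module _ {x : ℚ} (1≤x : 1ℚ ≤ x) where

  private
    j ζ : ℚ
    j = inv (x + 1ℚ)
    ζ = cayleyℚ x
    0≤x : 0ℚ ≤ x
    0≤x = ≤-trans 0≤1 1≤x
    0<1+x : 0ℚ < x + 1ℚ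
    0<1+x = ℚ.+-mono-≤-< 0≤x 0<1
    0≤j : 0ℚ ≤ j
    0≤j = <⇒≤ (0<inv 0<1+x)
    [x+1]j≡1 : (x + 1ℚ) * j ≡ 1ℚ
    [x+1]j≡1 = inv-inverse 0<1+x
    xj≤1 : x * j ≤ 1ℚ
    xj≤1 = ≤-trans (*-monoʳ 0≤j (subst (_≤ x + 1ℚ) (ℚ.+-identityʳ x) (ℚ.+-monoʳ-≤ x 0≤1))) (≤-reflexive [x+1]j≡1)

  0≤cayley : 0ℚ ≤ ζ
  0≤cayley = 0≤* (p≤q⇒0≤q-p 1≤x) 0≤j

  cayley≤1 : ζ ≤ 1ℚ
  cayley≤1 = ≤-trans (*-monoʳ 0≤j (ℚ.+-monoʳ-≤ x (ℚ.neg-antimono-≤ {0ℚ} {1ℚ} 0≤1))) (≤-trans (≤-reflexive (cong (_* j) (ℚ.+-identityʳ x))) xj≤1)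

  0≤cayley² : 0ℚ ≤ ζ * ζ
  0≤cayley² = 0≤* 0≤cayley 0≤cayley

  cayley²≤1 : ζ * ζ ≤ 1ℚ
  cayley²≤1 = *-mono-≤ 0≤cayley cayley≤1 0≤cayley cayley≤1

  -- Here 1 - ζ² = 4 x / (x + 1)². As 2 x / (x + 1) lies between 1 and 2, the gap 1 - ζ² is
  -- comparable to 1/x, so the series behaves harmonically for about x terms and decays
  -- geometrically afterwards.
  x[1-cayley²] : x * (1ℚ - ζ * ζ) ≡ fromℕ 2 * (x * j) * (fromℕ 2 * (x * j))
  x[1-cayley²] = begin-equality
    -- Writing 1 as the square of (x + 1) j leaves a polynomial identity in `x` and `j`.
    x * (1ℚ - ζ * ζ)                                     ≡⟨ cong (λ u → x * (u * u - ζ * ζ)) [x+1]j≡1 ⟨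
    x * ((x + 1ℚ) * j * ((x + 1ℚ) * j) - ζ * ζ)          ≡⟨ solve 2 (λ x j → x :* ((x :+ con 1ℚ) :* j :* ((x :+ con 1ℚ) :* j) :- (x :- con 1ℚ) :* j :* ((x :- con 1ℚ) :* j))
                                                                             := con (fromℕ 2) :* (x :* j) :* (con (fromℕ 2) :* (x :* j))) refl x j ⟩
    fromℕ 2 * (x * j) * (fromℕ 2 * (x * j))              ∎

  1≤x[1-cayley²] : 1ℚ ≤ x * (1ℚ - ζ * ζ)
  1≤x[1-cayley²] = subst (1ℚ ≤_) (sym x[1-cayley²]) (*-mono-≤ 0≤1 1≤2xj 0≤1 1≤2xj)
    where
    1≤2xj : 1ℚ ≤ fromℕ 2 * (x * j)
    1≤2xj = begin
      1ℚ                       ≡⟨ [x+1]j≡1 ⟨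
      (x + 1ℚ) * j             ≤⟨ *-monoʳ 0≤j (ℚ.+-monoʳ-≤ x 1≤x) ⟩
      (x + x) * j              ≡⟨ solve 2 (λ x j → (x :+ x) :* j := con (fromℕ 2) :* (x :* j)) refl x j ⟩
      fromℕ 2 * (x * j)        ∎

  x[1-cayley²]≤4 : x * (1ℚ - ζ * ζ) ≤ fromℕ 4
  x[1-cayley²]≤4 = subst (_≤ fromℕ 4) (sym x[1-cayley²]) (*-mono-≤ 0≤2xj 2xj≤2 0≤2xj 2xj≤2)
    where
    0≤2xj : 0ℚ ≤ fromℕ 2 * (x * j)
    0≤2xj = 0≤* (0≤fromℕ 2) (0≤* 0≤x 0≤j)
    2xj≤2 : fromℕ 2 * (x * j) ≤ fromℕ 2
    2xj≤2 = *-monoˡ {s = 1ℚ} (0≤fromℕ 2) xj≤1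

  logℚ-≥0 : ∀ n → 0ℚ ≤ logℚ n x
  logℚ-≥0 n = 0≤* (0≤fromℕ 2) (0≤* 0≤cayley (0≤∑ n (0≤odd-term 0≤cayley²)))

  logℚ-≤ : ∀ m → x ≤ fromℕ (2 ℕ.^ m) → ∀ n → logℚ n x ≤ fromℕ (2 ℕ.* (2 ℕ.+ m))
  logℚ-≤ m x≤ n = begin
    fromℕ 2 * (ζ * partialSum 1/odd n (ζ * ζ))      ≤⟨ *-monoˡ (0≤fromℕ 2) (*-mono-≤ 0≤cayley cayley≤1 (0≤∑ n (0≤odd-term 0≤cayley²))
                                                          (artanh-sum-≤ 0≤cayley² cayley²≤1 m
                                                            (≤-trans 1≤x[1-cayley²] (*-monoʳ (p≤q⇒0≤q-p cayley²≤1) x≤)) n)) ⟩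
    fromℕ 2 * (1ℚ * fromℕ (2 ℕ.+ m))                ≡⟨ cong (fromℕ 2 *_) (ℚ.*-identityˡ (fromℕ (2 ℕ.+ m))) ⟩
    fromℕ 2 * fromℕ (2 ℕ.+ m)                       ≡⟨ fromℕ-* 2 (2 ℕ.+ m) ⟨
    fromℕ (2 ℕ.* (2 ℕ.+ m))                         ∎

  -- The shift by 3 is the factor 8 that brings 2^m (1 - ζ²) from 4 down to one half. The bound x ≥
  -- 3 gives ζ ≥ 1/2, which cancels the 2 in front of artanh.
  logℚ-≥ : fromℕ 3 ≤ x → ∀ m → fromℕ (2 ℕ.^ (3 ℕ.+ m)) ≤ x → ∀ {n} → 2 ℕ.^ m ℕ.≤ n → fromℕ m ≤ fromℕ 8 * logℚ n x
  logℚ-≥ 3≤x m ≤x {n} M≤n = begin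
    fromℕ m                                ≤⟨ artanh-sum-≥ 0≤cayley² cayley²≤1 m small M≤n ⟩
    fromℕ 8 * S                            ≡⟨ solve 1 (λ s → con (fromℕ 8) :* s := con (fromℕ 8) :* (con (fromℕ 2) :* (con ½ :* s))) refl S ⟩
    fromℕ 8 * (fromℕ 2 * (½ * S))          ≤⟨ *-monoˡ (0≤fromℕ 8) (*-monoˡ (0≤fromℕ 2) (*-monoʳ (0≤∑ n (0≤odd-term 0≤cayley²)) ½≤ζ)) ⟩
    fromℕ 8 * (fromℕ 2 * (ζ * S))          ∎
    where
    S e : ℚ
    S = partialSum 1/odd n (ζ * ζ)
    e = 1ℚ - ζ * ζ
    ½≤ζ : ½ ≤ ζ
    ½≤ζ = begin
      ½                       ≡⟨ cong (½ *_) [x+1]j≡1 ⟨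
      ½ * ((x + 1ℚ) * j)      ≡⟨ ℚ.*-assoc ½ (x + 1ℚ) j ⟨
      ½ * (x + 1ℚ) * j        ≤⟨ *-monoʳ 0≤j (0≤q-p⇒p≤q {½ * (x + 1ℚ)} {x - 1ℚ} (subst (0ℚ ≤_)
                                   (solve 1 (λ v → con ½ :* (v :- con (fromℕ 3)) := (v :- con 1ℚ) :- con ½ :* (v :+ con 1ℚ)) refl x)
                                   (0≤* (ℚ.nonNegative⁻¹ ½) (p≤q⇒0≤q-p 3≤x)))) ⟩
      ζ                       ∎
    small : fromℕ (2 ℕ.^ m) * e ≤ ½
    small = *-cancelˡ (fromℕ-suc-pos 7) (begin
      fromℕ 8 * (fromℕ (2 ℕ.^ m) * e)      ≡⟨ ℚ.*-assoc (fromℕ 8) (fromℕ (2 ℕ.^ m)) e ⟨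
      fromℕ 8 * fromℕ (2 ℕ.^ m) * e        ≡⟨ cong (_* e) (trans (cong fromℕ (ℕ.^-distribˡ-+-* 2 3 m)) (fromℕ-* 8 (2 ℕ.^ m))) ⟨
      fromℕ (2 ℕ.^ (3 ℕ.+ m)) * e          ≤⟨ *-monoʳ (p≤q⇒0≤q-p cayley²≤1) ≤x ⟩
      x * e                                ≤⟨ x[1-cayley²]≤4 ⟩
      fromℕ 4                              ≡⟨⟩
      fromℕ 8 * ½                          ∎)

-- From real hypotheses to natural numbers and back

fromℕ-cancel-≤ : ∀ {m n} → fromℕ m ≤ fromℕ n → m ℕ.≤ n
fromℕ-cancel-≤ {m} {n} (ℚ.*≤* m≤n) = ℤ.drop‿+≤+ (subst₂ ℤ._≤_ (ℤ.*-identityʳ (ℤ.+ m)) (ℤ.*-identityʳ (ℤ.+ n)) m≤n)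

witness : ∀ {P} → Eventually P → ∃[ n ] P n
witness (N , p) = N , p N ℕ.≤-refl

seq-^ᴿ : ∀ x k {N b} → ∣ seq x N ∣ ≤ fromℕ b → ∣ seq (x ^ᴿ k) N ∣ ≤ fromℕ (b ℕ.^ k)
seq-^ᴿ x zero    _ = ≤-refl
seq-^ᴿ x (suc k) {N} {b} p = ≤-trans (∣*∣≤ (seq x N) (seq (x ^ᴿ k) N) p (seq-^ᴿ x k p)) (≤-reflexive (sym (fromℕ-* b (b ℕ.^ k))))

1≤fromℕ : ∀ {n} → 3 ℕ.≤ n → 1ℚ ≤ fromℕ n
1≤fromℕ 3≤n = fromℕ-mono (ℕ.≤-trans (s≤s z≤n) 3≤n)

logᴺ : ∀ {n} → 3 ℕ.≤ n → ℝ
logᴺ {n} 3≤n = log (ℕ→ℝ n) (0<ℕ→ℝ 3≤n)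

logᴺ-≤ : ∀ {n} (3≤n : 3 ℕ.≤ n) l → n ℕ.< 2 ℕ.^ suc l → ∀ N → seq (logᴺ 3≤n) N ≤ fromℕ (2 ℕ.* (3 ℕ.+ l))
logᴺ-≤ 3≤n l n< = logℚ-≤ (1≤fromℕ 3≤n) (suc l) (fromℕ-mono (ℕ.<⇒≤ n<))

1≤logᴺ : ∀ {n} (3≤n : 3 ℕ.≤ n) → Eventually λ N → 1ℚ ≤ seq (logᴺ 3≤n) N
1≤logᴺ 3≤n = let δ , 0<δ , δ≤ = 1<log 3≤n in map-ev (λ N p → 0≤q-p⇒p≤q (≤-trans (<⇒≤ 0<δ) p)) δ≤

-- 11 = 3 + 8: the shift by 3 in `logℚ-≥` is paid for by log n ≥ 1, and the remaining l - 3 costs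
-- the factor 8.
logᴺ-≥ : ∀ {n} (3≤n : 3 ℕ.≤ n) l → 2 ℕ.^ l ℕ.≤ n → Eventually λ N → fromℕ l ≤ fromℕ 11 * seq (logᴺ 3≤n) N
logᴺ-≥ {n} 3≤n l ≤n = map-ev bound (1≤logᴺ 3≤n ∩ (2 ℕ.^ (l ℕ.∸ 3) , λ _ p → p))
  where
  bound : ∀ N → 1ℚ ≤ seq (logᴺ 3≤n) N × 2 ℕ.^ (l ℕ.∸ 3) ℕ.≤ N → fromℕ l ≤ fromℕ 11 * seq (logᴺ 3≤n) N
  bound N (1≤L , ≤N) with ℕ.≤-total 3 l
  ... | inj₂ l≤3 = begin
    fromℕ l             ≤⟨ fromℕ-mono (ℕ.≤-trans l≤3 (ℕ.m≤m+n 3 8)) ⟩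
    fromℕ 11            ≡⟨ ℚ.*-identityʳ (fromℕ 11) ⟨
    fromℕ 11 * 1ℚ       ≤⟨ *-monoˡ (0≤fromℕ 11) 1≤L ⟩
    fromℕ 11 * L        ∎
    where L = seq (logᴺ 3≤n) N
  ... | inj₁ 3≤l with ℕ.m≤n⇒∃[o]m+o≡n 3≤l
  ...   | m , refl = begin
    fromℕ (3 ℕ.+ m)                    ≡⟨ fromℕ-+ 3 m ⟩
    fromℕ 3 + fromℕ m                  ≤⟨ ℚ.+-mono-≤ (*-monoˡ {r = 1ℚ} (0≤fromℕ 3) 1≤L) (logℚ-≥ (1≤fromℕ 3≤n) (fromℕ-mono 3≤n) m (fromℕ-mono ≤n) ≤N) ⟩
    fromℕ 3 * L + fromℕ 8 * L          ≡⟨ ℚ.*-distribʳ-+ L (fromℕ 3) (fromℕ 8) ⟨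
    fromℕ 11 * L                       ∎
    where L = seq (logᴺ 3≤n) N

-- The constants and the final estimate

module _ (a b C : ℝ) where

  private
    -- `D` is the coefficient of `l` in the exponent of 2 bounding n P_(k+2): n itself gives 1, and
    -- n^a gives 8 α, as log n ≤ 2 (3 + l) and exponentials are bounded by powers of 16 = 2^4. `A₀`
    -- collects what depends on neither `l` nor `k`.
    α β γ D c₀ A₀ : ℕ
    α = proj₁ (bounded a)
    β = proj₁ (bounded b)
    γ = proj₁ (bounded C)
    D = 1 ℕ.+ 8 ℕ.* α
    c₀ = proj₁ (factorial-scale D β)
    A₀ = (2 ℕ.* γ ℕ.+ 1) ℕ.* 2 ℕ.^ (1 ℕ.+ 24 ℕ.* α ℕ.+ β)

  -- One index where the tails of `a`, `b`, `C` are bounded suffices, since the result is about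
  -- natural numbers. The added 1 is the error allowed there.
  real-bound⇒ℕ-bound : ∀ {n} (3≤n : 3 ℕ.≤ n) l → n ℕ.< 2 ℕ.^ suc l → ∀ p k →
    ℕ→ℝ p ≤ᴿ C *ᴿ rpow (ℕ→ℝ n) (0<ℕ→ℝ 3≤n) a *ᴿ b ^ᴿ k →
    p ℕ.≤ γ ℕ.* (2 ℕ.* 16 ℕ.^ (α ℕ.* (2 ℕ.* (3 ℕ.+ l)))) ℕ.* β ℕ.^ k ℕ.+ 1
  real-bound⇒ℕ-bound {n} 3≤n l n< p k p≤ =
    let N , p≤N , a≤ , b≤ , C≤ = witness (p≤ 1ℚ 0<1 ∩ proj₂ (bounded a) ∩ proj₂ (bounded b) ∩ proj₂ (bounded C)) in
    at N p≤N a≤ b≤ C≤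
    where
    m X : ℕ
    m = α ℕ.* (2 ℕ.* (3 ℕ.+ l))
    X = 2 ℕ.* 16 ℕ.^ m
    e : ℕ → ℚ
    e N = seq (rpow (ℕ→ℝ n) (0<ℕ→ℝ 3≤n) a) N
    L≤ : ∀ N → ∣ seq (logᴺ 3≤n) N ∣ ≤ fromℕ (2 ℕ.* (3 ℕ.+ l))
    L≤ N = subst (_≤ fromℕ (2 ℕ.* (3 ℕ.+ l))) (sym (ℚ.0≤p⇒∣p∣≡p (logℚ-≥0 (1≤fromℕ 3≤n) N))) (logᴺ-≤ 3≤n l n< N)
    e≤ : ∀ N → ∣ seq a N ∣ ≤ fromℕ α → ∣ e N ∣ ≤ fromℕ X
    e≤ N a≤ = ∣partialExp∣≤ m (≤-trans (∣*∣≤ (seq a N) (seq (logᴺ 3≤n) N) a≤ (L≤ N)) (≤-reflexive (sym (fromℕ-* α (2 ℕ.* (3 ℕ.+ l)))))) N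
    at : ∀ N → fromℕ p ≤ seq C N * e N * seq (b ^ᴿ k) N + 1ℚ →
         ∣ seq a N ∣ ≤ fromℕ α → ∣ seq b N ∣ ≤ fromℕ β → ∣ seq C N ∣ ≤ fromℕ γ → p ℕ.≤ γ ℕ.* X ℕ.* β ℕ.^ k ℕ.+ 1
    at N p≤N a≤ b≤ C≤ = fromℕ-cancel-≤ (begin
      fromℕ p
        ≤⟨ p≤N ⟩
      seq C N * e N * seq (b ^ᴿ k) N + 1ℚ
        ≤⟨ ℚ.+-monoˡ-≤ 1ℚ (≤-trans (p≤∣p∣ (seq C N * e N * seq (b ^ᴿ k) N))
             (∣*∣≤ (seq C N * e N) (seq (b ^ᴿ k) N) (∣*∣≤ (seq C N) (e N) C≤ (e≤ N a≤)) (seq-^ᴿ b k b≤))) ⟩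
      fromℕ γ * fromℕ X * fromℕ (β ℕ.^ k) + 1ℚ
        ≡⟨ cong (λ u → u * fromℕ (β ℕ.^ k) + 1ℚ) (fromℕ-* γ X) ⟨
      fromℕ (γ ℕ.* X) * fromℕ (β ℕ.^ k) + 1ℚ
        ≡⟨ cong (_+ 1ℚ) (fromℕ-* (γ ℕ.* X) (β ℕ.^ k)) ⟨
      fromℕ (γ ℕ.* X ℕ.* β ℕ.^ k) + 1ℚ
        ≡⟨ fromℕ-+ (γ ℕ.* X ℕ.* β ℕ.^ k) 1 ⟨
      fromℕ (γ ℕ.* X ℕ.* β ℕ.^ k ℕ.+ 1) ∎)

  few-paths : ∀ {n} l → n ℕ.< 2 ℕ.^ suc l → ∀ p k →
    p ℕ.≤ γ ℕ.* (2 ℕ.* 16 ℕ.^ (α ℕ.* (2 ℕ.* (3 ℕ.+ l)))) ℕ.* β ℕ.^ (2 ℕ.+ k) ℕ.+ 1 →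
    2 ℕ.^ (D ℕ.* l ℕ.+ β ℕ.* suc k) ℕ.≤ suc k ! → n ℕ.* p ℕ.≤ A₀ ℕ.* suc k !
  few-paths {n} l n< p k p≤ large = N.begin
    n ℕ.* p
      N.≤⟨ ℕ.*-mono-≤ (ℕ.<⇒≤ n<) p≤ ⟩
    N ℕ.* (γ ℕ.* (2 ℕ.* 16 ℕ.^ m) ℕ.* β ℕ.^ (2 ℕ.+ k) ℕ.+ 1)
      -- The added 1 is absorbed as one more X Y, which makes 2 γ into 2 γ + 1.
      N.≤⟨ ℕ.*-monoʳ-≤ N (ℕ.+-mono-≤ (ℕ.*-mono-≤ (ℕ.≤-reflexive (cong (λ v → γ ℕ.* (2 ℕ.* v)) (ℕ.^-*-assoc 2 4 m))) β^≤)
                                   (ℕ.*-mono-≤ (ℕ.m^n>0 2 (4 ℕ.* m)) (ℕ.m^n>0 2 (β ℕ.* (2 ℕ.+ k))))) ⟩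
    N ℕ.* (γ ℕ.* (2 ℕ.* X) ℕ.* Y ℕ.+ X ℕ.* Y)
      N.≡⟨ ℕ-solve 4 (λ n g x y → n ⊗ (g ⊗ (κ 2 ⊗ x) ⊗ y ⊕ x ⊗ y) ⊜ (κ 2 ⊗ g ⊕ κ 1) ⊗ (n ⊗ (x ⊗ y))) refl N γ X Y ⟩
    (2 ℕ.* γ ℕ.+ 1) ℕ.* (N ℕ.* (X ℕ.* Y))
      N.≡⟨ cong ((2 ℕ.* γ ℕ.+ 1) ℕ.*_) powers ⟩
    (2 ℕ.* γ ℕ.+ 1) ℕ.* (2 ℕ.^ (1 ℕ.+ 24 ℕ.* α ℕ.+ β) ℕ.* 2 ℕ.^ (D ℕ.* l ℕ.+ β ℕ.* suc k))
      N.≡⟨ ℕ.*-assoc (2 ℕ.* γ ℕ.+ 1) (2 ℕ.^ (1 ℕ.+ 24 ℕ.* α ℕ.+ β)) (2 ℕ.^ (D ℕ.* l ℕ.+ β ℕ.* suc k)) ⟨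
    A₀ ℕ.* 2 ℕ.^ (D ℕ.* l ℕ.+ β ℕ.* suc k)
      N.≤⟨ ℕ.*-monoʳ-≤ A₀ large ⟩
    A₀ ℕ.* suc k ! N.∎
    where
    module N = ℕ.≤-Reasoning
    m N X Y : ℕ
    m = α ℕ.* (2 ℕ.* (3 ℕ.+ l))
    N = 2 ℕ.^ suc l
    X = 2 ℕ.^ (4 ℕ.* m)
    Y = 2 ℕ.^ (β ℕ.* (2 ℕ.+ k))
    β^≤ : β ℕ.^ (2 ℕ.+ k) ℕ.≤ Y
    β^≤ = ℕ.≤-trans (ℕ.^-monoˡ-≤ (2 ℕ.+ k) (ℕ.<⇒≤ (n<2^n β))) (ℕ.≤-reflexive (ℕ.^-*-assoc 2 β (2 ℕ.+ k)))
    powers : N ℕ.* (X ℕ.* Y) ≡ 2 ℕ.^ (1 ℕ.+ 24 ℕ.* α ℕ.+ β) ℕ.* 2 ℕ.^ (D ℕ.* l ℕ.+ β ℕ.* suc k)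
    powers = N.begin-equality
      N ℕ.* (X ℕ.* Y)
        N.≡⟨ cong (N ℕ.*_) (ℕ.^-distribˡ-+-* 2 (4 ℕ.* m) (β ℕ.* (2 ℕ.+ k))) ⟨
      N ℕ.* 2 ℕ.^ (4 ℕ.* m ℕ.+ β ℕ.* (2 ℕ.+ k))
        N.≡⟨ ℕ.^-distribˡ-+-* 2 (suc l) (4 ℕ.* m ℕ.+ β ℕ.* (2 ℕ.+ k)) ⟨
      2 ℕ.^ (suc l ℕ.+ (4 ℕ.* m ℕ.+ β ℕ.* (2 ℕ.+ k)))
        N.≡⟨ cong (2 ℕ.^_) (ℕ-solve 4 (λ a b l k → κ 1 ⊕ l ⊕ (κ 4 ⊗ (a ⊗ (κ 2 ⊗ (κ 3 ⊕ l))) ⊕ b ⊗ (κ 2 ⊕ k))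
             ⊜ κ 1 ⊕ κ 24 ⊗ a ⊕ b ⊕ ((κ 1 ⊕ κ 8 ⊗ a) ⊗ l ⊕ b ⊗ (κ 1 ⊕ k))) refl α β l k) ⟩
      2 ℕ.^ (1 ℕ.+ 24 ℕ.* α ℕ.+ β ℕ.+ (D ℕ.* l ℕ.+ β ℕ.* suc k))
        N.≡⟨ ℕ.^-distribˡ-+-* 2 (1 ℕ.+ 24 ℕ.* α ℕ.+ β) (D ℕ.* l ℕ.+ β ℕ.* suc k) ⟩
      2 ℕ.^ (1 ℕ.+ 24 ℕ.* α ℕ.+ β) ℕ.* 2 ℕ.^ (D ℕ.* l ℕ.+ β ℕ.* suc k) N.∎

  -- 154 = 14 · 11: in the notation of factorial-scale, log log n ≤ 14 (μ + 1)
  -- and log n ≥ l / 11.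
  Q : ℕ
  Q = 154 ℕ.* (c₀ ℕ.+ A₀)

  colours-bound : ∀ {n} (3≤n : 3 ℕ.≤ n) (G : Graph n) →
    (∀ k → 1 ℕ.≤ k → k ℕ.≤ n → ℕ→ℝ (numPaths G k) ≤ᴿ C *ᴿ rpow (ℕ→ℝ n) (0<ℕ→ℝ 3≤n) a *ᴿ b ^ᴿ k) →
    ∀ l → n ℕ.< 2 ℕ.^ suc l → ∀ k → 2 ℕ.^ (D ℕ.* l ℕ.+ β ℕ.* suc k) ℕ.≤ suc k ! →
    expectedColours G ≤ fromℕ (suc k ℕ.+ A₀)
  colours-bound {n} 3≤n G paths≤ l n< k large = expectedColours-≤ G (suc k ℕ.+ A₀) total
    where
    total : sum (map (coloursUsed G) (orders n)) ℕ.≤ n ! ℕ.* (suc k ℕ.+ A₀)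
    total with 2 ℕ.+ k ℕ.≤? n
    ... | yes k≤n = total-colours-≤ G k A₀ (few-paths l n< (numPaths G (2 ℕ.+ k)) k
      (real-bound⇒ℕ-bound 3≤n l n< (numPaths G (2 ℕ.+ k)) (2 ℕ.+ k) (paths≤ (2 ℕ.+ k) (s≤s z≤n) k≤n)) large)
    -- The path hypothesis stops at `n` vertices. Beyond that, n ≤ k + 1, and the trivial bound by
    -- `n` colours is enough.
    ... | no k≰n = ℕ.≤-trans (total-colours-≤-n G)
      (ℕ.*-monoʳ-≤ (n !) (ℕ.≤-trans (ℕ.s≤s⁻¹ (ℕ.≰⇒> k≰n)) (ℕ.m≤m+n (suc k) A₀)))

  firstFit-bound-at : ∀ {n} (3≤n : 3 ℕ.≤ n) (G : Graph n) →
    (∀ k → 1 ℕ.≤ k → k ℕ.≤ n → ℕ→ℝ (numPaths G k) ≤ᴿ C *ᴿ rpow (ℕ→ℝ n) (0<ℕ→ℝ 3≤n) a *ᴿ b ^ᴿ k) →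
    ∀ l μ k → 2 ℕ.^ l ℕ.≤ n → n ℕ.< 2 ℕ.^ suc l → l ℕ.< 4 ℕ.^ suc μ → suc μ ℕ.≤ l → suc μ ℕ.* suc k ℕ.≤ c₀ ℕ.* l →
    2 ℕ.^ (D ℕ.* l ℕ.+ β ℕ.* suc k) ℕ.≤ suc k ! →
    fromℚ (expectedColours G) ≤ᴿ ℕ→ℝ Q *ᴿ log/loglog n 3≤n
  firstFit-bound-at {n} 3≤n G paths≤ l μ k ≤n n< l< μ<l few large ε 0<ε =
    map-ev bound (logᴺ-≥ 3≤n l ≤n ∩ 1≤logᴺ 3≤n ∩ proj₂ (proj₂ (0<loglog 3≤n)))
    where
    LL : ℝ
    LL = log (logᴺ 3≤n) (0<log 3≤n)
    δ : ℚ
    δ = proj₁ (0<loglog 3≤n)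
    K : ℕ
    K = suc k ℕ.+ A₀
    -- The constant `A₀` is also multiplied by μ + 1 and is charged to `l` through μ + 1 ≤ l.
    counts : (2 ℕ.* (2 ℕ.+ (2 ℕ.* μ ℕ.+ 5))) ℕ.* K ℕ.≤ 14 ℕ.* (c₀ ℕ.+ A₀) ℕ.* l
    counts = N.begin
      (2 ℕ.* (2 ℕ.+ (2 ℕ.* μ ℕ.+ 5))) ℕ.* K          N.≤⟨ ℕ.*-monoˡ-≤ K (ℕ.≤-trans (ℕ.m≤m+n (2 ℕ.* (2 ℕ.+ (2 ℕ.* μ ℕ.+ 5))) (10 ℕ.* μ)) (ℕ.≤-reflexive
                                                           (ℕ-solve 1 (λ m → κ 2 ⊗ (κ 2 ⊕ (κ 2 ⊗ m ⊕ κ 5)) ⊕ κ 10 ⊗ m ⊜ κ 14 ⊗ (κ 1 ⊕ m)) refl μ))) ⟩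
      14 ℕ.* suc μ ℕ.* (suc k ℕ.+ A₀)                N.≡⟨ ℕ-solve 3 (λ m k a → κ 14 ⊗ m ⊗ (k ⊕ a) ⊜ κ 14 ⊗ (m ⊗ k ⊕ a ⊗ m)) refl (suc μ) (suc k) A₀ ⟩
      14 ℕ.* (suc μ ℕ.* suc k ℕ.+ A₀ ℕ.* suc μ)      N.≤⟨ ℕ.*-monoʳ-≤ 14 (ℕ.+-mono-≤ few (ℕ.*-monoʳ-≤ A₀ μ<l)) ⟩
      14 ℕ.* (c₀ ℕ.* l ℕ.+ A₀ ℕ.* l)                 N.≡⟨ ℕ-solve 3 (λ c a l → κ 14 ⊗ (c ⊗ l ⊕ a ⊗ l) ⊜ κ 14 ⊗ (c ⊕ a) ⊗ l) refl c₀ A₀ l ⟩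
      14 ℕ.* (c₀ ℕ.+ A₀) ℕ.* l                       N.∎
      where module N = ℕ.≤-Reasoning
    1≤l : 1 ℕ.≤ l
    1≤l = ℕ.≤-trans (s≤s z≤n) μ<l
    -- Bounds log n by a power of 2, as `logℚ-≤` needs for log log n; the 5 comes from 8 * 4 = 2^5.
    2[3+l]≤ : 2 ℕ.* (3 ℕ.+ l) ℕ.≤ 2 ℕ.^ (2 ℕ.* μ ℕ.+ 5)
    2[3+l]≤ = N.begin
      2 ℕ.* (3 ℕ.+ l)                 N.≤⟨ ℕ.*-monoʳ-≤ 2 (ℕ.+-monoˡ-≤ l (ℕ.*-monoʳ-≤ 3 1≤l)) ⟩
      2 ℕ.* (3 ℕ.* l ℕ.+ l)           N.≡⟨ ℕ-solve 1 (λ l → κ 2 ⊗ (κ 3 ⊗ l ⊕ l) ⊜ κ 8 ⊗ l) refl l ⟩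
      8 ℕ.* l                         N.≤⟨ ℕ.*-monoʳ-≤ 8 (ℕ.<⇒≤ l<) ⟩
      8 ℕ.* (4 ℕ.* 4 ℕ.^ μ)           N.≡⟨ cong (λ v → 8 ℕ.* (4 ℕ.* v)) (ℕ.^-*-assoc 2 2 μ) ⟩
      8 ℕ.* (4 ℕ.* 2 ℕ.^ (2 ℕ.* μ))   N.≡⟨ ℕ-solve 1 (λ v → κ 8 ⊗ (κ 4 ⊗ v) ⊜ v ⊗ κ 32) refl (2 ℕ.^ (2 ℕ.* μ)) ⟩
      2 ℕ.^ (2 ℕ.* μ) ℕ.* 32          N.≡⟨ ℕ.^-distribˡ-+-* 2 (2 ℕ.* μ) 5 ⟨
      2 ℕ.^ (2 ℕ.* μ ℕ.+ 5)           N.∎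
      where module N = ℕ.≤-Reasoning
    bound : ∀ N → fromℕ l ≤ fromℕ 11 * seq (logᴺ 3≤n) N × 1ℚ ≤ seq (logᴺ 3≤n) N × δ ≤ seq LL N →
            expectedColours G ≤ fromℕ Q * (seq (logᴺ 3≤n) N * inv (seq LL N)) + ε
    bound N (l≤L , 1≤L , δ≤LL) = begin
      expectedColours G                     ≤⟨ colours-bound 3≤n G paths≤ l n< k large ⟩
      fromℕ K                               ≡⟨ ℚ.*-identityˡ (fromℕ K) ⟨
      -- Multiplying and dividing by log log n reduces the claim to an upper bound on its product
      -- with `K`, which is compared with `l` and then with log n.
      1ℚ * fromℕ K                          ≡⟨ cong (_* fromℕ K) (inv-inverse 0<LL) ⟨
      LLN * inv LLN * fromℕ K               ≡⟨ solve 3 (λ a i k → a :* i :* k := (a :* k) :* i) refl LLN (inv LLN) (fromℕ K) ⟩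
      LLN * fromℕ K * inv LLN               ≤⟨ *-monoʳ (<⇒≤ (0<inv 0<LL)) (*-monoʳ (0≤fromℕ K)
                                                 (logℚ-≤ 1≤L (2 ℕ.* μ ℕ.+ 5) (≤-trans (logᴺ-≤ 3≤n l n< N) (fromℕ-mono 2[3+l]≤)) N)) ⟩
      fromℕ M * fromℕ K * inv LLN           ≡⟨ cong (_* inv LLN) (fromℕ-* M K) ⟨
      fromℕ (M ℕ.* K) * inv LLN             ≤⟨ *-monoʳ (<⇒≤ (0<inv 0<LL)) (fromℕ-mono counts) ⟩
      fromℕ (14 ℕ.* (c₀ ℕ.+ A₀) ℕ.* l) * inv LLN
                                            ≡⟨ cong (_* inv LLN) (fromℕ-* (14 ℕ.* (c₀ ℕ.+ A₀)) l) ⟩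
      fromℕ (14 ℕ.* (c₀ ℕ.+ A₀)) * fromℕ l * inv LLN
                                            ≤⟨ *-monoʳ (<⇒≤ (0<inv 0<LL)) (*-monoˡ (0≤fromℕ (14 ℕ.* (c₀ ℕ.+ A₀))) l≤L) ⟩
      fromℕ (14 ℕ.* (c₀ ℕ.+ A₀)) * (fromℕ 11 * LN) * inv LLN
                                            ≡⟨ solve 4 (λ c e L i → c :* (e :* L) :* i := (c :* e) :* (L :* i)) refl (fromℕ (14 ℕ.* (c₀ ℕ.+ A₀))) (fromℕ 11) LN (inv LLN) ⟩
      fromℕ (14 ℕ.* (c₀ ℕ.+ A₀)) * fromℕ 11 * (LN * inv LLN)
                                            ≡⟨ cong (_* (LN * inv LLN)) (trans (sym (fromℕ-* (14 ℕ.* (c₀ ℕ.+ A₀)) 11))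
                                                 (cong fromℕ (ℕ-solve 1 (λ v → κ 14 ⊗ v ⊗ κ 11 ⊜ κ 154 ⊗ v) refl (c₀ ℕ.+ A₀)))) ⟩
      fromℕ Q * (LN * inv LLN)              ≡⟨ ℚ.+-identityʳ (fromℕ Q * (LN * inv LLN)) ⟨
      fromℕ Q * (LN * inv LLN) + 0ℚ         ≤⟨ ℚ.+-monoʳ-≤ (fromℕ Q * (LN * inv LLN)) (<⇒≤ 0<ε) ⟩
      fromℕ Q * (LN * inv LLN) + ε          ∎
      where
      LN LLN : ℚ
      LN = seq (logᴺ 3≤n) N
      LLN = seq LL N
      M : ℕ
      M = 2 ℕ.* (2 ℕ.+ (2 ℕ.* μ ℕ.+ 5))
      0<LL : 0ℚ < LLN
      0<LL = ℚ.<-≤-trans (proj₁ (proj₂ (0<loglog 3≤n))) δ≤LL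

  firstFit-bound : ∀ {n} (3≤n : 3 ℕ.≤ n) (G : Graph n) →
    (∀ k → 1 ℕ.≤ k → k ℕ.≤ n → ℕ→ℝ (numPaths G k) ≤ᴿ C *ᴿ rpow (ℕ→ℝ n) (0<ℕ→ℝ 3≤n) a *ᴿ b ^ᴿ k) →
    fromℚ (expectedColours G) ≤ᴿ ℕ→ℝ Q *ᴿ log/loglog n 3≤n
  firstFit-bound {suc n′} 3≤n G paths≤ =
    let l , ≤n , n< = floor-log 0 n′
        μ , k , l< , μ<l , few , large = proj₂ (factorial-scale D β) l (1≤floor-log l n<)
    in firstFit-bound-at 3≤n G paths≤ l μ k ≤n n< l< μ<l few large
    where
    1≤floor-log : ∀ l → suc n′ ℕ.< 2 ℕ.^ suc l → 1 ℕ.≤ l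
    1≤floor-log zero    n< = contradiction (ℕ.≤-trans 3≤n (ℕ.s≤s⁻¹ n<)) λ { (s≤s ()) }
    1≤floor-log (suc _) _  = s≤s z≤n

  0<Q : 0ℚ < fromℕ Q
  0<Q = 0<fromℕ Q {{ℕ.>-nonZero 1≤Q}}
    where
    1≤Q : 1 ℕ.≤ Q
    1≤Q = ℕ.*-mono-≤ {1} {154} (s≤s z≤n) (ℕ.≤-trans
      (ℕ.*-mono-≤ (ℕ.m≤n+m 1 (2 ℕ.* γ)) (ℕ.m^n>0 2 (1 ℕ.+ 24 ℕ.* α ℕ.+ β)))
      (ℕ.m≤n+m A₀ c₀))

theorem1 :
    (a b C : ℝ) (0<a : 0< a) (0<b : 0< b) (0<C : 0< C) →
    ∃[ C′ ] (0< C′) ×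
      (∀ (n : ℕ) (3≤n : 3 ℕ.≤ n) (G : Graph n) →
        (∀ k → 1 ℕ.≤ k → k ℕ.≤ n →
          ℕ→ℝ (numPaths G k) ≤ᴿ C *ᴿ rpow (ℕ→ℝ n) (0<ℕ→ℝ 3≤n) a *ᴿ b ^ᴿ k) →
        fromℚ (expectedColours G) ≤ᴿ C′ *ᴿ log/loglog n 3≤n)
theorem1 a b C _ _ _ = ℕ→ℝ (Q a b C) , 0<-fromℚ (0<Q a b C) , λ n 3≤n → firstFit-bound a b C 3≤n
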